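{- Let $I\in\mathbb{N}$ and let $r,r_1,r_2\in\mathbb{N}$ be such that $r=r_1r_2$. Let the functions $b,b_{1i},b_{2i}:\mathbb{Z}\to\mathbb{C}$ ($1\le i\le I$) and $R_1,R_2\in\mathbb{R}$ be such that $$b(m)=\sum_{i=1}^{I}b_{1i}(m)b_{2i}(m)\qquad(m\in\mathbb{Z})$$ and, for all $m\in\mathbb{Z}$ and $1\le i\le I$, $$b_{1i}(m+r_1)=b_{1i}(m),\quad|b_{1i}(m)|\le R_1,\qquad b_{2i}(m+r_2)=b_{2i}(m),\quad|b_{2i}(m)|\le R_2.$$ Let $H\in\mathbb{N}$, and for $h,k\in\mathbb{Z}$ and $1\le i\le I$ let $$\hat B_{1i,hH}(k)=\sum_{m\bmod r_1}b_{1i}(m+hHr_2)\overline{b_{1i}(m)}\,e\Bigl(-\frac{km}{r_1}\Bigr).$$ Then, for every $A\in\mathbb{Z}$ and $M\in\mathbb{N}$, $$\Bigl|\sum_{A<m\le A+M}b(m)\Bigr|^2\ll(M+Hr_2)Hr_2(R_1R_2)^2I^2+Hr_2R_2^2I\sum_{0<|h|\le\frac{M}{Hr_2}}\ \sum_{|k|\le r_1/2}\Bigl|\sum_{i=1}^{I}\hat B_{1i,hH}(k)\Bigr|\min\Bigl(\frac{M}{r_1},\frac1{|k|}\Bigr),$$ with an absolute implied constant.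
   Context: $e(x)=e^{2\pi ix}$. For $k=0$, $\min(M/r_1,1/|k|)$ is read as $M/r_1$. The sums over $h,k$ are over integers. -}

module Defs where

open import Data.Integer.Base as ℤ using (ℤ; +_; -[1+_]; 0ℤ; +[1+_]; +0)
import Data.Integer.Properties as ℤₚ
open import Data.List.Base using (List; []; _∷_; map; foldr; concatMap; upTo)
open import Data.Nat.Base as ℕ using (ℕ; zero; suc; _!; NonZero)
import Data.Nat.Properties as ℕₚ
open import Data.Nat.Solver renaming (module +-*-Solver to ℕ-Solver)
open import Data.Product.Base using (∃-syntax; _×_; _,_; proj₁; proj₂)
open import Data.Rational.Base as ℚ using (ℚ; 0ℚ; 1ℚ; ½; ↥_; ↧ₙ_) hiding (module ℚ)
import Data.Rational.Properties as ℚₚ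
import Data.Rational.Solver as ℚ-Solver
open import Data.Rational.Unnormalised.Base as ℚᵘ using (mkℚᵘ)
import Data.Rational.Unnormalised.Properties as ℚᵘₚ
open import Data.Sum.Base as Sum using (_⊎_; inj₁; inj₂)
open import Function.Base using (_$_)
open import Relation.Binary.PropositionalEquality
open import Relation.Nullary using (¬_; Dec; yes; no)

------------------------------------------------------------------------
-- Rational arithmetic

infixl 7 _/_

-- Opaque, because unfolding it exposes the computation of a gcd.
opaque
  _/_ : (i : ℤ) (n : ℕ) .{{_ : NonZero n}} → ℚ
  i / n = i ℚ./ n

module ℚ-Lemmas where

  open ℚ using (_+_; _*_; _-_; -_; _≤_; _<_; ∣_∣)
  open ℚ-Solver.+-*-Solver

  opaque

    unfolding _/_

    /-mono-≤ : ∀ a b c d .{{_ : NonZero b}} .{{_ : NonZero d}} →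
               a ℕ.* d ℕ.≤ c ℕ.* b → + a / b ≤ + c / d
    /-mono-≤ a (suc b) c (suc d) ad≤cb = ℚₚ.toℚᵘ-cancel-≤ $ begin
      ℚ.toℚᵘ (+ a / suc b) ≃⟨ ℚₚ.toℚᵘ-fromℚᵘ (mkℚᵘ (+ a) b) ⟩
      mkℚᵘ (+ a) b         ≤⟨ ℚᵘ.*≤* (subst₂ ℤ._≤_ (ℤₚ.pos-* a (suc d)) (ℤₚ.pos-* c (suc b)) (ℤ.+≤+ ad≤cb)) ⟩
      mkℚᵘ (+ c) d         ≃⟨ ℚₚ.toℚᵘ-fromℚᵘ (mkℚᵘ (+ c) d) ⟨
      ℚ.toℚᵘ (+ c / suc d) ∎
      where open ℚᵘₚ.≤-Reasoning

    /-* : ∀ a b c d .{{_ : NonZero b}} .{{_ : NonZero d}} .{{_ : NonZero (b ℕ.* d)}} →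
          (+ a / b) * (+ c / d) ≡ + (a ℕ.* c) / (b ℕ.* d)
    /-* a (suc b) c (suc d) = ℚₚ.toℚᵘ-injective $ begin
      ℚ.toℚᵘ ((+ a / suc b) * (+ c / suc d))              ≈⟨ ℚₚ.toℚᵘ-homo-* (+ a / suc b) (+ c / suc d) ⟩
      ℚ.toℚᵘ (+ a / suc b) ℚᵘ.* ℚ.toℚᵘ (+ c / suc d)      ≈⟨ ℚᵘₚ.*-cong (ℚₚ.toℚᵘ-fromℚᵘ (mkℚᵘ (+ a) b)) (ℚₚ.toℚᵘ-fromℚᵘ (mkℚᵘ (+ c) d)) ⟩
      mkℚᵘ (+ a) b ℚᵘ.* mkℚᵘ (+ c) d                      ≈⟨ ℚᵘ.*≡* (cong (ℤ._* + (suc b ℕ.* suc d)) (sym (ℤₚ.pos-* a c))) ⟩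
      mkℚᵘ (+ (a ℕ.* c)) (d ℕ.+ b ℕ.* suc d)              ≈⟨ ℚₚ.toℚᵘ-fromℚᵘ (mkℚᵘ (+ (a ℕ.* c)) (d ℕ.+ b ℕ.* suc d)) ⟨
      ℚ.toℚᵘ (+ (a ℕ.* c) / (suc b ℕ.* suc d))            ∎
      where open ℚᵘₚ.≃-Reasoning

    /-+ : ∀ a c n .{{_ : NonZero n}} → + (a ℕ.+ c) / n ≡ + a / n + + c / n
    /-+ a c (suc n) = sym $ ℚₚ.toℚᵘ-injective $ begin
      ℚ.toℚᵘ (+ a / suc n + + c / suc n)                  ≈⟨ ℚₚ.toℚᵘ-homo-+ (+ a / suc n) (+ c / suc n) ⟩
      ℚ.toℚᵘ (+ a / suc n) ℚᵘ.+ ℚ.toℚᵘ (+ c / suc n)      ≈⟨ ℚᵘₚ.+-cong (ℚₚ.toℚᵘ-fromℚᵘ (mkℚᵘ (+ a) n)) (ℚₚ.toℚᵘ-fromℚᵘ (mkℚᵘ (+ c) n)) ⟩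
      mkℚᵘ (+ a) n ℚᵘ.+ mkℚᵘ (+ c) n                      ≈⟨ ℚᵘ.*≡* eq ⟩
      mkℚᵘ (+ (a ℕ.+ c)) n                                ≈⟨ ℚₚ.toℚᵘ-fromℚᵘ (mkℚᵘ (+ (a ℕ.+ c)) n) ⟨
      ℚ.toℚᵘ (+ (a ℕ.+ c) / suc n)                        ∎
      where
      open ℚᵘₚ.≃-Reasoning
      eq : (+ a ℤ.* + suc n ℤ.+ + c ℤ.* + suc n) ℤ.* + suc n ≡ + (a ℕ.+ c) ℤ.* + (suc n ℕ.* suc n)
      eq = trans (cong (ℤ._* + suc n) (sym (ℤₚ.*-distribʳ-+ (+ suc n) (+ a) (+ c))))
          (trans (ℤₚ.*-assoc (+ (a ℕ.+ c)) (+ suc n) (+ suc n))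
                 (cong (+ (a ℕ.+ c) ℤ.*_) (sym (ℤₚ.pos-* (suc n) (suc n)))))

    /-≡ : ∀ a b c d .{{_ : NonZero b}} .{{_ : NonZero d}} →
          a ℕ.* d ≡ c ℕ.* b → + a / b ≡ + c / d
    /-≡ a b c d ad≡cb = ℚₚ.≤-antisym (/-mono-≤ a b c d (ℕₚ.≤-reflexive ad≡cb))
                                     (/-mono-≤ c d a b (ℕₚ.≤-reflexive (sym ad≡cb)))

    0≤/ : ∀ a b .{{_ : NonZero b}} → 0ℚ ≤ + a / b
    0≤/ a b = /-mono-≤ 0 1 a b ℕ.z≤n

    0</ : ∀ a b .{{_ : NonZero a}} .{{_ : NonZero b}} → 0ℚ < + a / b
    0</ a b = ℚₚ.positive⁻¹ _ {{ℚₚ.normalize-pos a b}}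

    0/1≡0 : + 0 / 1 ≡ 0ℚ
    0/1≡0 = refl

    1/1≡1 : + 1 / 1 ≡ 1ℚ
    1/1≡1 = refl

    2/1*½≡1 : (+ 2 / 1) * ½ ≡ 1ℚ
    2/1*½≡1 = refl

    /-suc : ∀ n → + suc n / 1 ≡ + n / 1 + 1ℚ
    /-suc n = trans (cong (λ k → + k / 1) (ℕₚ.+-comm 1 n)) (/-+ n 1 1)

  0<1 : 0ℚ < 1ℚ
  0<1 = ℚₚ.positive⁻¹ 1ℚ

  0<½ : 0ℚ < ½
  0<½ = ℚₚ.positive⁻¹ ½

  2/1*_ : ∀ x → (+ 2 / 1) * x ≡ x + x
  2/1* x = begin
    (+ 2 / 1) * x          ≡⟨ cong (_* x) (trans (/-suc 1) (cong (_+ 1ℚ) 1/1≡1)) ⟩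
    (1ℚ + 1ℚ) * x          ≡⟨ ℚₚ.*-distribʳ-+ x 1ℚ 1ℚ ⟩
    1ℚ * x + 1ℚ * x        ≡⟨ cong₂ _+_ (ℚₚ.*-identityˡ x) (ℚₚ.*-identityˡ x) ⟩
    x + x                  ∎
    where open ≡-Reasoning

  *-mono-≤ : ∀ {a b c d} → 0ℚ ≤ a → 0ℚ ≤ d → a ≤ b → c ≤ d → a * c ≤ b * d
  *-mono-≤ {a} {b} {c} {d} 0≤a 0≤d a≤b c≤d =
    ℚₚ.≤-trans (ℚₚ.*-monoˡ-≤-nonNeg a {{ℚ.nonNegative 0≤a}} c≤d)
               (ℚₚ.*-monoʳ-≤-nonNeg d {{ℚ.nonNegative 0≤d}} a≤b)

  0≤* : ∀ {a b} → 0ℚ ≤ a → 0ℚ ≤ b → 0ℚ ≤ a * b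
  0≤* {a} {b} 0≤a 0≤b = subst (_≤ a * b) (ℚₚ.*-zeroʳ a)
    (ℚₚ.*-monoˡ-≤-nonNeg a {{ℚ.nonNegative 0≤a}} 0≤b)

  0<* : ∀ {a b} → 0ℚ < a → 0ℚ < b → 0ℚ < a * b
  0<* {a} {b} 0<a 0<b = subst (_< a * b) (ℚₚ.*-zeroʳ a)
    (ℚₚ.*-monoʳ-<-pos a {{ℚ.positive 0<a}} 0<b)

  0<+ : ∀ {a b} → 0ℚ < a → 0ℚ ≤ b → 0ℚ < a + b
  0<+ 0<a 0≤b = ℚₚ.+-mono-<-≤ 0<a 0≤b

  0<-half : ∀ {ε} → 0ℚ < ε → 0ℚ < ½ * ε
  0<-half = 0<* 0<½

  halves : ∀ ε → ½ * ε + ½ * ε ≡ ε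
  halves ε = trans (sym (ℚₚ.*-distribʳ-+ ε ½ ½)) (ℚₚ.*-identityˡ ε)

  divide : ∀ {c ε} → 0ℚ < c → 0ℚ < ε → ∃[ δ ] 0ℚ < δ × δ * c ≡ ε
  divide {c} {ε} 0<c 0<ε = ε * 1/c , 0<* 0<ε (ℚₚ.positive⁻¹ 1/c {{ℚₚ.1/pos⇒pos c {{ℚ.positive 0<c}}}}) ,
    trans (ℚₚ.*-assoc ε 1/c c)
          (trans (cong (ε *_) (ℚₚ.*-inverseˡ c {{c≢0}})) (ℚₚ.*-identityʳ ε))
    where
    c≢0 = ℚ.>-nonZero 0<c
    1/c = ℚ.1/_ c {{c≢0}}

  p≤∣p∣ : ∀ p → p ≤ ∣ p ∣
  p≤∣p∣ p with ℚₚ.≤-total 0ℚ p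
  ... | inj₁ 0≤p = ℚₚ.≤-reflexive (sym (ℚₚ.0≤p⇒∣p∣≡p 0≤p))
  ... | inj₂ p≤0 = ℚₚ.≤-trans p≤0 (ℚₚ.0≤∣p∣ p)

  -p≤∣p∣ : ∀ p → - p ≤ ∣ p ∣
  -p≤∣p∣ p = subst (- p ≤_) (ℚₚ.∣-p∣≡∣p∣ p) (p≤∣p∣ (- p))

  ∣∣≤ : ∀ {p b} → p ≤ b → - p ≤ b → ∣ p ∣ ≤ b
  ∣∣≤ {p} p≤b -p≤b with ℚₚ.∣p∣≡p∨∣p∣≡-p p
  ... | inj₁ eq = subst (_≤ _) (sym eq) p≤b
  ... | inj₂ eq = subst (_≤ _) (sym eq) -p≤b

  ∣∣< : ∀ {p b} → p < b → - p < b → ∣ p ∣ < b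
  ∣∣< {p} p<b -p<b with ℚₚ.∣p∣≡p∨∣p∣≡-p p
  ... | inj₁ eq = subst (_< _) (sym eq) p<b
  ... | inj₂ eq = subst (_< _) (sym eq) -p<b

  neg-difference : ∀ x y → y - x ≡ - (x - y)
  neg-difference = solve 2 (λ x y → y :- x := :- (x :- y)) refl

  [x+y]-x≡y : ∀ x y → (x + y) - x ≡ y
  [x+y]-x≡y = solve 2 (λ x y → (x :+ y) :- x := y) refl

  ∣x-y∣≡∣y-x∣ : ∀ x y → ∣ x - y ∣ ≡ ∣ y - x ∣
  ∣x-y∣≡∣y-x∣ x y = trans (sym (ℚₚ.∣-p∣≡∣p∣ (x - y)))
    (cong ∣_∣ (sym (neg-difference x y)))

  ∣x-x∣≡0 : ∀ x → ∣ x - x ∣ ≡ 0ℚ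
  ∣x-x∣≡0 x = cong ∣_∣ (ℚₚ.+-inverseʳ x)

  ∣-∣-triangle : ∀ x y z → ∣ x - z ∣ ≤ ∣ x - y ∣ + ∣ y - z ∣
  ∣-∣-triangle x y z = subst (λ w → ∣ w ∣ ≤ ∣ x - y ∣ + ∣ y - z ∣)
    (solve 3 (λ x y z → (x :- y) :+ (y :- z) := x :- z) refl x y z)
    (ℚₚ.∣p+q∣≤∣p∣+∣q∣ (x - y) (y - z))

  ceil : ℚ → ℕ
  ceil q = ℤ.∣ ↥ q ∣

  opaque

    unfolding _/_

    ≤ceil : ∀ q → q ≤ + ceil q / 1
    ≤ceil q = ℚₚ.≤-trans (p≤∣p∣ q) (subst (_≤ + ceil q / 1) ∣ q ∣-reduced
        (/-mono-≤ (ceil q) (↧ₙ q) (ceil q) 1 (ℕₚ.*-monoʳ-≤ (ceil q) (ℕ.>-nonZero⁻¹ (↧ₙ q)))))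
      where
      ∣_∣-reduced : ∀ q → + ceil q / ↧ₙ q ≡ ∣ q ∣
      ∣ ℚ.mkℚ _ _ c ∣-reduced = ℚₚ.normalize-coprime c

  archimedean : ∀ c {ε} → 0ℚ < ε → ∃[ n ] c < (+ suc n / 1) * ε
  archimedean c {ε} 0<ε with divide 0<ε 0<1
  ... | δ , 0<δ , δε≡1 = n , ℚₚ.≤-<-trans c≤ (ℚₚ.*-monoˡ-<-pos ε {{ℚ.positive 0<ε}} n<1+n)
    where
    n = ceil (c * δ)
    c≤ : c ≤ (+ n / 1) * ε
    c≤ = subst (_≤ (+ n / 1) * ε)
      (trans (ℚₚ.*-assoc c δ ε) (trans (cong (c *_) δε≡1) (ℚₚ.*-identityʳ c)))
      (ℚₚ.*-monoʳ-≤-nonNeg ε {{ℚ.nonNegative (ℚₚ.<⇒≤ 0<ε)}} (≤ceil (c * δ)))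
    n<1+n : + n / 1 < + suc n / 1
    n<1+n = subst₂ _<_ (ℚₚ.+-identityʳ (+ n / 1)) (sym (/-suc n)) (ℚₚ.+-monoʳ-< (+ n / 1) 0<1)

open ℚ-Lemmas

------------------------------------------------------------------------
-- Cauchy sequences of rationals

IsCauchy : (ℕ → ℚ) → Set
IsCauchy x = ∀ ε → 0ℚ ℚ.< ε →
  ∃[ N ] (∀ m n → N ℕ.≤ m → N ℕ.≤ n → ℚ.∣ x m ℚ.- x n ∣ ℚ.< ε)

module _ where

  open ℚ using (_+_; _*_; _-_; -_; ∣_∣) renaming (_≤_ to _≤ℚ_; _<_ to _<ℚ_)
  open ℚ-Solver.+-*-Solver

  +-cauchy : ∀ x y → IsCauchy x → IsCauchy y → IsCauchy (λ n → x n + y n)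
  +-cauchy x y cx cy ε 0<ε
    with cx (½ * ε) (0<-half 0<ε) | cy (½ * ε) (0<-half 0<ε)
  ... | N , close-x | N′ , close-y = N ℕ.⊔ N′ , λ m n ≤m ≤n → begin-strict
    ∣ (x m + y m) - (x n + y n) ∣      ≡⟨ cong ∣_∣ (solve 4 (λ a b c d → (a :+ b) :- (c :+ d) := (a :- c) :+ (b :- d)) refl (x m) (y m) (x n) (y n)) ⟩
    ∣ (x m - x n) + (y m - y n) ∣      ≤⟨ ℚₚ.∣p+q∣≤∣p∣+∣q∣ (x m - x n) (y m - y n) ⟩
    ∣ x m - x n ∣ + ∣ y m - y n ∣      <⟨ ℚₚ.+-mono-<
                                            (close-x m n (ℕₚ.m⊔n≤o⇒m≤o N N′ ≤m) (ℕₚ.m⊔n≤o⇒m≤o N N′ ≤n))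
                                            (close-y m n (ℕₚ.m⊔n≤o⇒n≤o N N′ ≤m) (ℕₚ.m⊔n≤o⇒n≤o N N′ ≤n)) ⟩
    ½ * ε + ½ * ε                      ≡⟨ halves ε ⟩
    ε                                  ∎
    where open ℚₚ.≤-Reasoning

  neg-cauchy : ∀ x → IsCauchy x → IsCauchy (λ n → - x n)
  neg-cauchy x cx ε 0<ε with cx ε 0<ε
  ... | N , close = N , λ m n ≤m ≤n → subst (_<ℚ ε)
    (trans (sym (ℚₚ.∣-p∣≡∣p∣ (x m - x n)))
           (cong ∣_∣ (solve 2 (λ a b → :- (a :- b) := :- a :- (:- b)) refl (x m) (x n))))
    (close m n ≤m ≤n)

  -- |x 0| + ⋯ + |x n|
  ∑∣_∣ : (ℕ → ℚ) → ℕ → ℚ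
  ∑∣ x ∣ zero    = ∣ x 0 ∣
  ∑∣ x ∣ (suc n) = ∑∣ x ∣ n + ∣ x (suc n) ∣

  ∣x∣≤∑∣x∣ : ∀ x {m n} → m ℕ.≤ n → ∣ x m ∣ ≤ℚ ∑∣ x ∣ n
  ∣x∣≤∑∣x∣ x {m} {n} m≤n = go (ℕₚ.≤⇒≤′ m≤n)
    where
    0≤∑ : ∀ n → 0ℚ ≤ℚ ∑∣ x ∣ n
    0≤∑ zero    = ℚₚ.0≤∣p∣ (x 0)
    0≤∑ (suc n) = ℚₚ.+-mono-≤ (0≤∑ n) (ℚₚ.0≤∣p∣ (x (suc n)))
    last : ∀ n → ∣ x n ∣ ≤ℚ ∑∣ x ∣ n
    last zero    = ℚₚ.≤-refl
    last (suc n) = subst (_≤ℚ ∑∣ x ∣ (suc n)) (ℚₚ.+-identityˡ _) (ℚₚ.+-monoˡ-≤ ∣ x (suc n) ∣ (0≤∑ n))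
    go : ∀ {n} → m ℕ.≤′ n → ∣ x m ∣ ≤ℚ ∑∣ x ∣ n
    go {n} ℕ.≤′-refl = last n
    go {suc n} (ℕ.≤′-step m≤n) = ℚₚ.≤-trans (go m≤n)
      (subst (_≤ℚ ∑∣ x ∣ (suc n)) (ℚₚ.+-identityʳ _) (ℚₚ.+-monoʳ-≤ (∑∣ x ∣ n) (ℚₚ.0≤∣p∣ (x (suc n)))))

  bounded : ∀ x → IsCauchy x → ∃[ B ] 0ℚ <ℚ B × (∀ n → ∣ x n ∣ ≤ℚ B)
  bounded x cx with cx 1ℚ 0<1
  ... | N , close = 1ℚ + ∑∣ x ∣ N , 0<+ 0<1 0≤∑ , bound
    where
    open ℚₚ.≤-Reasoning
    0≤∑ : 0ℚ ≤ℚ ∑∣ x ∣ N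
    0≤∑ = ℚₚ.≤-trans (ℚₚ.0≤∣p∣ (x N)) (∣x∣≤∑∣x∣ x ℕₚ.≤-refl)
    bound : ∀ n → ∣ x n ∣ ≤ℚ 1ℚ + ∑∣ x ∣ N
    bound n with ℕₚ.≤-total n N
    ... | inj₁ n≤N = ℚₚ.≤-trans (∣x∣≤∑∣x∣ x n≤N)
      (subst (_≤ℚ 1ℚ + ∑∣ x ∣ N) (ℚₚ.+-identityˡ _) (ℚₚ.+-monoˡ-≤ (∑∣ x ∣ N) (ℚₚ.<⇒≤ 0<1)))
    ... | inj₂ N≤n = begin
      ∣ x n ∣                  ≡⟨ cong ∣_∣ (solve 2 (λ a b → a := (a :- b) :+ b) refl (x n) (x N)) ⟩
      ∣ (x n - x N) + x N ∣    ≤⟨ ℚₚ.∣p+q∣≤∣p∣+∣q∣ (x n - x N) (x N) ⟩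
      ∣ x n - x N ∣ + ∣ x N ∣  ≤⟨ ℚₚ.+-mono-≤ (ℚₚ.<⇒≤ (close n N N≤n ℕₚ.≤-refl)) (∣x∣≤∑∣x∣ x ℕₚ.≤-refl) ⟩
      1ℚ + ∑∣ x ∣ N            ∎

  *-cauchy : ∀ x y → IsCauchy x → IsCauchy y → IsCauchy (λ n → x n * y n)
  *-cauchy x y cx cy ε 0<ε
    with bounded x cx | bounded y cy
  ... | B , 0<B , ∣x∣≤B | B′ , 0<B′ , ∣y∣≤B′
    with divide (0<+ 0<B (ℚₚ.<⇒≤ 0<B′)) 0<ε
  ... | δ , 0<δ , δ[B+B′]≡ε
    with cx δ 0<δ | cy δ 0<δ
  ... | N , close-x | N′ , close-y = N ℕ.⊔ N′ , λ m n ≤m ≤n → begin-strict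
    ∣ x m * y m - x n * y n ∣                              ≡⟨ cong ∣_∣ (solve 4 (λ a b c d → a :* b :- c :* d := a :* (b :- d) :+ (a :- c) :* d) refl (x m) (y m) (x n) (y n)) ⟩
    ∣ x m * (y m - y n) + (x m - x n) * y n ∣              ≤⟨ ℚₚ.∣p+q∣≤∣p∣+∣q∣ (x m * (y m - y n)) ((x m - x n) * y n) ⟩
    ∣ x m * (y m - y n) ∣ + ∣ (x m - x n) * y n ∣          ≡⟨ cong₂ _+_ (ℚₚ.∣p*q∣≡∣p∣*∣q∣ (x m) (y m - y n)) (ℚₚ.∣p*q∣≡∣p∣*∣q∣ (x m - x n) (y n)) ⟩
    ∣ x m ∣ * ∣ y m - y n ∣ + ∣ x m - x n ∣ * ∣ y n ∣      ≤⟨ ℚₚ.+-mono-≤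
                                                                (ℚₚ.*-monoʳ-≤-nonNeg ∣ y m - y n ∣ {{ℚₚ.∣-∣-nonNeg (y m - y n)}} (∣x∣≤B m))
                                                                (ℚₚ.*-monoˡ-≤-nonNeg ∣ x m - x n ∣ {{ℚₚ.∣-∣-nonNeg (x m - x n)}} (∣y∣≤B′ n)) ⟩
    B * ∣ y m - y n ∣ + ∣ x m - x n ∣ * B′                 <⟨ ℚₚ.+-mono-<
                                                                (ℚₚ.*-monoʳ-<-pos B {{ℚ.positive 0<B}} (close-y m n (ℕₚ.m⊔n≤o⇒n≤o N N′ ≤m) (ℕₚ.m⊔n≤o⇒n≤o N N′ ≤n)))
                                                                (ℚₚ.*-monoˡ-<-pos B′ {{ℚ.positive 0<B′}} (close-x m n (ℕₚ.m⊔n≤o⇒m≤o N N′ ≤m) (ℕₚ.m⊔n≤o⇒m≤o N N′ ≤n))) ⟩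
    B * δ + δ * B′                                         ≡⟨ solve 3 (λ B B′ δ → B :* δ :+ δ :* B′ := δ :* (B :+ B′)) refl B B′ δ ⟩
    δ * (B + B′)                                           ≡⟨ δ[B+B′]≡ε ⟩
    ε                                                      ∎
    where open ℚₚ.≤-Reasoning

------------------------------------------------------------------------
-- Rational square roots

module _ where

  open ℚ using (_+_; _*_; _-_; -_; ∣_∣) renaming (_≤_ to _≤ℚ_; _<_ to _<ℚ_)
  open ℚ-Solver.+-*-Solver

  -- s = √q up to an error of δ; for q < 0 this means s = 0.
  record √-Approx (q δ s : ℚ) : Set where
    constructor mk√
    field
      nonneg : 0ℚ ≤ℚ s
      lower  : s ≡ 0ℚ ⊎ s * s ≤ℚ q
      upper  : q <ℚ (s + δ) * (s + δ)

  √-search : ∀ q δ → 0ℚ <ℚ δ → ∀ k → let s = (+ suc k / 1) * δ in q <ℚ s * s → ∃[ s ] √-Approx q δ s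
  √-search q δ 0<δ zero q< = 0ℚ , mk√ ℚₚ.≤-refl (inj₁ refl)
    (subst (λ s → q <ℚ s * s) (trans (cong (_* δ) 1/1≡1) (trans (ℚₚ.*-identityˡ δ) (sym (ℚₚ.+-identityˡ δ)))) q<)
  √-search q δ 0<δ (suc k) q< = decide (s * s ℚₚ.≤? q)
    where
    s = (+ suc k / 1) * δ
    next : (+ suc (suc k) / 1) * δ ≡ s + δ
    next = begin
      (+ suc (suc k) / 1) * δ          ≡⟨ cong (_* δ) (/-suc (suc k)) ⟩
      (+ suc k / 1 + 1ℚ) * δ           ≡⟨ ℚₚ.*-distribʳ-+ δ (+ suc k / 1) 1ℚ ⟩
      s + 1ℚ * δ                       ≡⟨ cong (λ x → s + x) (ℚₚ.*-identityˡ δ) ⟩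
      s + δ                            ∎
      where open ≡-Reasoning
    decide : Dec (s * s ≤ℚ q) → ∃[ s ] √-Approx q δ s
    decide (yes s²≤q) = s , mk√ (0≤* (0≤/ (suc k) 1) (ℚₚ.<⇒≤ 0<δ)) (inj₂ s²≤q) (subst (λ s → q <ℚ s * s) next q<)
    decide (no  s²≰q) = √-search q δ 0<δ k (ℚₚ.≰⇒> s²≰q)

  opaque
    √-approx : ∀ q δ → 0ℚ <ℚ δ → ∃[ s ] √-Approx q δ s
    √-approx q δ 0<δ = √-search q δ 0<δ (proj₁ far) (q<s² _ (proj₂ far))
      where
      open ℚₚ.≤-Reasoning
      c : ℕ
      c = suc (ceil q)
      far : ∃[ n ] + c / 1 <ℚ (+ suc n / 1) * δ
      far = archimedean (+ c / 1) 0<δ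
      1≤c : 1ℚ ≤ℚ + c / 1
      1≤c = subst (_≤ℚ + c / 1) 1/1≡1 (/-mono-≤ 1 1 c 1 (ℕ.s≤s ℕ.z≤n))
      q<s² : ∀ s → + c / 1 <ℚ s → q <ℚ s * s
      q<s² s c<s = begin-strict
        q                     ≤⟨ ≤ceil q ⟩
        + ceil q / 1          ≤⟨ /-mono-≤ (ceil q) 1 c 1 (ℕₚ.*-monoˡ-≤ 1 (ℕₚ.n≤1+n (ceil q))) ⟩
        + c / 1               <⟨ c<s ⟩
        s                     ≡⟨ ℚₚ.*-identityˡ s ⟨
        1ℚ * s                ≤⟨ *-mono-≤ (ℚₚ.<⇒≤ 0<1) (ℚₚ.≤-trans (0≤/ c 1) (ℚₚ.<⇒≤ c<s)) (ℚₚ.≤-trans 1≤c (ℚₚ.<⇒≤ c<s)) ℚₚ.≤-refl ⟩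
        s * s                 ∎

  √-close : ∀ {a b δ δ′ ε s t} → √-Approx a δ′ s → √-Approx b δ t → 0ℚ <ℚ δ → 0ℚ <ℚ ε → δ ≤ℚ ½ * ε →
            a - b <ℚ (½ * ε) * (½ * ε) → s - t <ℚ ε
  √-close {a} {b} {δ} {_} {ε} {s} {t} (mk√ _ s-lower _) (mk√ 0≤t _ t-upper) 0<δ 0<ε δ≤ε/2 a-b<ε²/4 =
    ℚₚ.≰⇒> λ ε≤s-t → contra ε≤s-t s-lower
    where
    open ℚₚ.≤-Reasoning
    η = ½ * ε
    0≤η : 0ℚ ≤ℚ η
    0≤η = ℚₚ.<⇒≤ (0<-half 0<ε)
    0≤t+δ : 0ℚ ≤ℚ t + δ
    0≤t+δ = ℚₚ.+-mono-≤ 0≤t (ℚₚ.<⇒≤ 0<δ)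
    contra : ε ≤ℚ s - t → ¬ (s ≡ 0ℚ ⊎ s * s ≤ℚ a)
    contra ε≤s-t = λ where
        (inj₁ s≡0)  → ℚₚ.<-irrefl refl (ℚₚ.<-≤-trans 0<s (ℚₚ.≤-reflexive s≡0))
        (inj₂ s²≤a) → ℚₚ.<-irrefl refl (begin-strict
          a                                    ≡⟨ solve 2 (λ a b → a := (a :- b) :+ b) refl a b ⟩
          (a - b) + b                          <⟨ ℚₚ.+-mono-< a-b<ε²/4 t-upper ⟩
          η * η + (t + δ) * (t + δ)            ≡⟨ ℚₚ.+-identityʳ _ ⟨
          η * η + (t + δ) * (t + δ) + 0ℚ       ≤⟨ ℚₚ.+-monoʳ-≤ (η * η + (t + δ) * (t + δ)) (0≤* 0≤t+δ (ℚₚ.+-mono-≤ 0≤η 0≤η)) ⟩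
          η * η + (t + δ) * (t + δ) + (t + δ) * (η + η)
                                               ≡⟨ solve 2 (λ η u → η :* η :+ u :* u :+ u :* (η :+ η) := (u :+ η) :* (u :+ η)) refl η (t + δ) ⟩
          ((t + δ) + η) * ((t + δ) + η)        ≤⟨ *-mono-≤ 0≤u (ℚₚ.≤-trans 0≤u u≤s) u≤s u≤s ⟩
          s * s                                ≤⟨ s²≤a ⟩
          a                                    ∎)
      where
      u≤s : (t + δ) + η ≤ℚ s
      u≤s = begin
        (t + δ) + η    ≤⟨ ℚₚ.+-monoˡ-≤ η (ℚₚ.+-monoʳ-≤ t δ≤ε/2) ⟩
        (t + η) + η    ≡⟨ ℚₚ.+-assoc t η η ⟩
        t + (η + η)    ≡⟨ cong (λ x → t + x) (halves ε) ⟩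
        t + ε          ≤⟨ ℚₚ.+-monoʳ-≤ t ε≤s-t ⟩
        t + (s - t)    ≡⟨ solve 2 (λ s t → t :+ (s :- t) := s) refl s t ⟩
        s              ∎
      0≤u : 0ℚ ≤ℚ (t + δ) + η
      0≤u = ℚₚ.+-mono-≤ 0≤t+δ 0≤η
      0<s : 0ℚ <ℚ s
      0<s = ℚₚ.<-≤-trans (ℚₚ.+-mono-≤-< 0≤t+δ (0<-half 0<ε)) u≤s

  1/-small : ∀ {ε} → 0ℚ <ℚ ε → ∃[ N ] (∀ n → N ℕ.≤ n → + 1 / suc n ≤ℚ ε)
  1/-small {ε} 0<ε with archimedean 1ℚ 0<ε
  ... | N , 1<[N+1]ε = N , λ n N≤n → ℚₚ.≤-trans (/-mono-≤ 1 (suc n) 1 (suc N) (ℕₚ.*-monoʳ-≤ 1 (ℕ.s≤s N≤n))) (begin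
    + 1 / suc N                        ≡⟨ ℚₚ.*-identityʳ _ ⟨
    (+ 1 / suc N) * 1ℚ                 ≤⟨ ℚₚ.*-monoˡ-≤-nonNeg (+ 1 / suc N) {{ℚ.nonNegative (0≤/ 1 (suc N))}} (ℚₚ.<⇒≤ 1<[N+1]ε) ⟩
    (+ 1 / suc N) * ((+ suc N / 1) * ε) ≡⟨ ℚₚ.*-assoc (+ 1 / suc N) (+ suc N / 1) ε ⟨
    (+ 1 / suc N) * (+ suc N / 1) * ε  ≡⟨ cong (_* ε) (trans (/-* 1 (suc N) (suc N) 1) eq) ⟩
    1ℚ * ε                             ≡⟨ ℚₚ.*-identityˡ ε ⟩
    ε                                  ∎)
    where
    open ℚₚ.≤-Reasoning
    eq : + (1 ℕ.* suc N) / (suc N ℕ.* 1) ≡ 1ℚ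
    eq = trans (/-≡ (1 ℕ.* suc N) (suc N ℕ.* 1) 1 1
      (ℕ-Solver.solve 1 (λ n → (ℕ-Solver.con 1 ℕ-Solver.:* n) ℕ-Solver.:* ℕ-Solver.con 1 ℕ-Solver.:= ℕ-Solver.con 1 ℕ-Solver.:* (n ℕ-Solver.:* ℕ-Solver.con 1)) refl (suc N))) 1/1≡1

  √-seq : (ℕ → ℚ) → ℕ → ℚ
  √-seq x n = proj₁ (√-approx (x n) (+ 1 / suc n) (0</ 1 (suc n)))

  √-seq-close : ∀ x {ε N N′} → 0ℚ <ℚ ε →
    (∀ m n → N ℕ.≤ m → N ℕ.≤ n → ∣ x m - x n ∣ <ℚ (½ * ε) * (½ * ε)) →
    (∀ n → N′ ℕ.≤ n → + 1 / suc n ≤ℚ ½ * ε) →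
    ∀ m n → N ℕ.⊔ N′ ℕ.≤ m → N ℕ.⊔ N′ ℕ.≤ n → √-seq x m - √-seq x n <ℚ ε
  √-seq-close x {ε} {N} {N′} 0<ε close small m n ≤m ≤n =
    √-close {x m} {x n} {+ 1 / suc n} {+ 1 / suc m} {ε} {√-seq x m} {√-seq x n}
      (proj₂ (√-approx (x m) (+ 1 / suc m) (0</ 1 (suc m))))
      (proj₂ (√-approx (x n) (+ 1 / suc n) (0</ 1 (suc n))))
      (0</ 1 (suc n)) 0<ε (small n (ℕₚ.m⊔n≤o⇒n≤o N N′ ≤n))
      (ℚₚ.≤-<-trans (p≤∣p∣ (x m - x n)) (close m n (ℕₚ.m⊔n≤o⇒m≤o N N′ ≤m) (ℕₚ.m⊔n≤o⇒m≤o N N′ ≤n)))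

  √-cauchy : ∀ x → IsCauchy x → IsCauchy (√-seq x)
  √-cauchy x cx ε 0<ε = N ℕ.⊔ N′ , λ m n ≤m ≤n →
    ∣∣< {√-seq x m - √-seq x n} (√-seq-close x 0<ε close small m n ≤m ≤n)
        (subst (_<ℚ ε) (neg-difference (√-seq x m) (√-seq x n)) (√-seq-close x 0<ε close small n m ≤n ≤m))
    where
    x-close = cx ((½ * ε) * (½ * ε)) (0<* (0<-half 0<ε) (0<-half 0<ε))
    N = proj₁ x-close
    close = proj₂ x-close
    δ-small = 1/-small (0<-half 0<ε)
    N′ = proj₁ δ-small
    small = proj₂ δ-small

------------------------------------------------------------------------
-- Riemann sums for ∫₀¹ 4/(1+t²) dt

∑ℚ : ℕ → (ℕ → ℚ) → ℚ
∑ℚ zero    f = 0ℚ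
∑ℚ (suc n) f = ∑ℚ n f ℚ.+ f n

-- (1/n) · 4/(1+(j/n)²) for n = suc a
πterm : ℕ → ℕ → ℚ
πterm a j = + (4 ℕ.* suc a) / (suc a ℕ.* suc a ℕ.+ j ℕ.* j)

πℚ : ℕ → ℚ
πℚ a = ∑ℚ (suc a) (πterm a)

module _ where

  open ℚ using (_+_; _*_; _-_; -_; ∣_∣) renaming (_≤_ to _≤ℚ_; _<_ to _<ℚ_)
  open ℚ-Solver.+-*-Solver

  ∑ℚ-mono : ∀ n {f g} → (∀ j → j ℕ.< n → f j ≤ℚ g j) → ∑ℚ n f ≤ℚ ∑ℚ n g
  ∑ℚ-mono zero    f≤g = ℚₚ.≤-refl
  ∑ℚ-mono (suc n) f≤g = ℚₚ.+-mono-≤ (∑ℚ-mono n λ j j<n → f≤g j (ℕₚ.m<n⇒m<1+n j<n)) (f≤g n ℕₚ.≤-refl)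

  ∑ℚ-*ˡ : ∀ n c f → ∑ℚ n (λ j → c * f j) ≡ c * ∑ℚ n f
  ∑ℚ-*ˡ zero    c f = sym (ℚₚ.*-zeroʳ c)
  ∑ℚ-*ˡ (suc n) c f = trans (cong (_+ c * f n) (∑ℚ-*ˡ n c f)) (sym (ℚₚ.*-distribˡ-+ c (∑ℚ n f) (f n)))

  ∑ℚ-const : ∀ n c → ∑ℚ n (λ _ → c) ≡ (+ n / 1) * c
  ∑ℚ-const zero    c = sym (trans (cong (_* c) 0/1≡0) (ℚₚ.*-zeroˡ c))
  ∑ℚ-const (suc n) c = begin
    ∑ℚ n (λ _ → c) + c             ≡⟨ cong₂ _+_ (∑ℚ-const n c) (sym (ℚₚ.*-identityˡ c)) ⟩
    (+ n / 1) * c + 1ℚ * c         ≡⟨ ℚₚ.*-distribʳ-+ c (+ n / 1) 1ℚ ⟨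
    (+ n / 1 + 1ℚ) * c             ≡⟨ cong (_* c) (/-suc n) ⟨
    (+ suc n / 1) * c              ∎
    where open ≡-Reasoning

  ∑ℚ-split : ∀ m k f → ∑ℚ (m ℕ.+ k) f ≡ ∑ℚ k f + ∑ℚ m (λ i → f (i ℕ.+ k))
  ∑ℚ-split zero    k f = sym (ℚₚ.+-identityʳ (∑ℚ k f))
  ∑ℚ-split (suc m) k f = trans (cong (_+ f (m ℕ.+ k)) (∑ℚ-split m k f))
    (ℚₚ.+-assoc (∑ℚ k f) (∑ℚ m (λ i → f (i ℕ.+ k))) (f (m ℕ.+ k)))

  ∑ℚ-blocks : ∀ n m f → ∑ℚ (n ℕ.* m) f ≡ ∑ℚ n (λ j → ∑ℚ m (λ i → f (i ℕ.+ j ℕ.* m)))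
  ∑ℚ-blocks zero    m f = refl
  ∑ℚ-blocks (suc n) m f = trans (∑ℚ-split m (n ℕ.* m) f)
    (cong (_+ ∑ℚ m (λ i → f (i ℕ.+ n ℕ.* m))) (∑ℚ-blocks n m f))

  ∑ℚ-shift : ∀ n f → ∑ℚ n f + f n ≡ f 0 + ∑ℚ n (λ j → f (suc j))
  ∑ℚ-shift zero    f = ℚₚ.+-comm 0ℚ (f 0)
  ∑ℚ-shift (suc n) f = trans (cong (_+ f (suc n)) (∑ℚ-shift n f))
    (ℚₚ.+-assoc (f 0) (∑ℚ n (λ j → f (suc j))) (f (suc n)))

  block-≤ : ∀ m .{{_ : NonZero m}} {f c} → (∀ i → i ℕ.< m → (+ m / 1) * f i ≤ℚ c) → ∑ℚ m f ≤ℚ c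
  block-≤ m {f} {c} h = ℚₚ.*-cancelˡ-≤-pos (+ m / 1) {{ℚ.positive (0</ m 1)}}
    (subst₂ _≤ℚ_ (∑ℚ-*ˡ m (+ m / 1) f) (∑ℚ-const m c) (∑ℚ-mono m h))

  block-≥ : ∀ m .{{_ : NonZero m}} {f c} → (∀ i → i ℕ.< m → c ≤ℚ (+ m / 1) * f i) → c ≤ℚ ∑ℚ m f
  block-≥ m {f} {c} h = ℚₚ.*-cancelˡ-≤-pos (+ m / 1) {{ℚ.positive (0</ m 1)}}
    (subst₂ _≤ℚ_ (∑ℚ-const m c) (∑ℚ-*ˡ m (+ m / 1) f) (∑ℚ-mono m h))

  module _ (a b : ℕ) where

    private
      n = suc a
      m = suc b
      -- suc p = n * m, by definition
      p = b ℕ.+ a ℕ.* m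

      scaled : ∀ l → (+ m / 1) * πterm p l ≡ + (m ℕ.* (4 ℕ.* suc p)) / (1 ℕ.* (suc p ℕ.* suc p ℕ.+ l ℕ.* l))
      scaled l = /-* m 1 (4 ℕ.* suc p) (suc p ℕ.* suc p ℕ.+ l ℕ.* l)

    πterm-upper : ∀ i j → (+ m / 1) * πterm p (i ℕ.+ j ℕ.* m) ≤ℚ πterm a j
    πterm-upper i j = subst (_≤ℚ πterm a j) (sym (scaled l))
      (/-mono-≤ (m ℕ.* (4 ℕ.* suc p)) (1 ℕ.* (suc p ℕ.* suc p ℕ.+ l ℕ.* l)) (4 ℕ.* n) (n ℕ.* n ℕ.+ j ℕ.* j) (begin
        m ℕ.* (4 ℕ.* (n ℕ.* m)) ℕ.* (n ℕ.* n ℕ.+ j ℕ.* j)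
          ≡⟨ ℕ-Solver.solve 3 (λ n m j → m ⊗ (κ 4 ⊗ (n ⊗ m)) ⊗ (n ⊗ n ⊕ j ⊗ j) ⊜ (κ 4 ⊗ n) ⊗ (κ 1 ⊗ ((n ⊗ m) ⊗ (n ⊗ m) ⊕ (j ⊗ m) ⊗ (j ⊗ m)))) refl n m j ⟩
        4 ℕ.* n ℕ.* (1 ℕ.* ((n ℕ.* m) ℕ.* (n ℕ.* m) ℕ.+ (j ℕ.* m) ℕ.* (j ℕ.* m)))
          ≤⟨ ℕₚ.*-monoʳ-≤ (4 ℕ.* n) (ℕₚ.*-monoʳ-≤ 1 (ℕₚ.+-monoʳ-≤ ((n ℕ.* m) ℕ.* (n ℕ.* m)) (ℕₚ.*-mono-≤ (ℕₚ.m≤n+m (j ℕ.* m) i) (ℕₚ.m≤n+m (j ℕ.* m) i)))) ⟩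
        4 ℕ.* n ℕ.* (1 ℕ.* ((n ℕ.* m) ℕ.* (n ℕ.* m) ℕ.+ l ℕ.* l)) ∎))
      where
      open ℕₚ.≤-Reasoning
      open ℕ-Solver using () renaming (_:+_ to _⊕_; _:*_ to _⊗_; _:=_ to _⊜_; con to κ)
      l = i ℕ.+ j ℕ.* m

    πterm-lower : ∀ i j → i ℕ.< m → πterm a (suc j) ≤ℚ (+ m / 1) * πterm p (i ℕ.+ j ℕ.* m)
    πterm-lower i j i<m = subst (πterm a (suc j) ≤ℚ_) (sym (scaled l))
      (/-mono-≤ (4 ℕ.* n) (n ℕ.* n ℕ.+ suc j ℕ.* suc j) (m ℕ.* (4 ℕ.* suc p)) (1 ℕ.* (suc p ℕ.* suc p ℕ.+ l ℕ.* l)) (begin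
        4 ℕ.* n ℕ.* (1 ℕ.* ((n ℕ.* m) ℕ.* (n ℕ.* m) ℕ.+ l ℕ.* l))
          ≤⟨ ℕₚ.*-monoʳ-≤ (4 ℕ.* n) (ℕₚ.*-monoʳ-≤ 1 (ℕₚ.+-monoʳ-≤ ((n ℕ.* m) ℕ.* (n ℕ.* m)) (ℕₚ.*-mono-≤ l≤ l≤))) ⟩
        4 ℕ.* n ℕ.* (1 ℕ.* ((n ℕ.* m) ℕ.* (n ℕ.* m) ℕ.+ (suc j ℕ.* m) ℕ.* (suc j ℕ.* m)))
          ≡⟨ ℕ-Solver.solve 3 (λ n m j → m ⊗ (κ 4 ⊗ (n ⊗ m)) ⊗ (n ⊗ n ⊕ j ⊗ j) ⊜ (κ 4 ⊗ n) ⊗ (κ 1 ⊗ ((n ⊗ m) ⊗ (n ⊗ m) ⊕ (j ⊗ m) ⊗ (j ⊗ m)))) refl n m (suc j) ⟨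
        m ℕ.* (4 ℕ.* (n ℕ.* m)) ℕ.* (n ℕ.* n ℕ.+ suc j ℕ.* suc j) ∎))
      where
      open ℕₚ.≤-Reasoning
      open ℕ-Solver using () renaming (_:+_ to _⊕_; _:*_ to _⊗_; _:=_ to _⊜_; con to κ)
      l = i ℕ.+ j ℕ.* m
      l≤ : l ℕ.≤ suc j ℕ.* m
      l≤ = ℕₚ.+-monoˡ-≤ (j ℕ.* m) (ℕₚ.<⇒≤ i<m)

    πℚ-refine-≤ : πℚ p ≤ℚ πℚ a
    πℚ-refine-≤ = subst (_≤ℚ πℚ a) (sym (∑ℚ-blocks n m (πterm p)))
      (∑ℚ-mono n λ j _ → block-≤ m λ i _ → πterm-upper i j)

    πℚ-refine-≥ : πℚ a ≤ℚ πℚ p + + 4 / n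
    πℚ-refine-≥ = begin
      πℚ a                                          ≡⟨ ℚₚ.+-identityʳ (πℚ a) ⟨
      πℚ a + 0ℚ                                     ≤⟨ ℚₚ.+-monoʳ-≤ (πℚ a) (0≤/ (4 ℕ.* n) (n ℕ.* n ℕ.+ n ℕ.* n)) ⟩
      πℚ a + πterm a n                              ≡⟨ ∑ℚ-shift n (πterm a) ⟩
      πterm a 0 + ∑ℚ n (λ j → πterm a (suc j))      ≤⟨ ℚₚ.+-mono-≤ first lower ⟩
      + 4 / n + πℚ p                                ≡⟨ ℚₚ.+-comm (+ 4 / n) (πℚ p) ⟩
      πℚ p + + 4 / n                                ∎
      where
      open ℚₚ.≤-Reasoning
      first : πterm a 0 ≤ℚ + 4 / n
      first = /-mono-≤ (4 ℕ.* n) (n ℕ.* n ℕ.+ 0) 4 n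
        (ℕₚ.≤-reflexive (trans (ℕₚ.*-assoc 4 n n) (cong (4 ℕ.*_) (sym (ℕₚ.+-identityʳ (n ℕ.* n))))))
      lower : ∑ℚ n (λ j → πterm a (suc j)) ≤ℚ πℚ p
      lower = subst (∑ℚ n (λ j → πterm a (suc j)) ≤ℚ_) (sym (∑ℚ-blocks n m (πterm p)))
        (∑ℚ-mono n λ j _ → block-≥ m λ i i<m → πterm-lower i j i<m)

  πℚ-close : ∀ a b → πℚ a - πℚ b ≤ℚ + 4 / suc a
  πℚ-close a b = begin
    πℚ a - πℚ b                            ≤⟨ ℚₚ.+-monoˡ-≤ (- πℚ b) (πℚ-refine-≥ a b) ⟩
    (πℚ p + + 4 / suc a) - πℚ b            ≤⟨ ℚₚ.+-monoˡ-≤ (- πℚ b) (ℚₚ.+-monoˡ-≤ (+ 4 / suc a) p≤b) ⟩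
    (πℚ b + + 4 / suc a) - πℚ b            ≡⟨ [x+y]-x≡y (πℚ b) (+ 4 / suc a) ⟩
    + 4 / suc a                            ∎
    where
    open ℚₚ.≤-Reasoning
    p = b ℕ.+ a ℕ.* suc b
    p≤b : πℚ p ≤ℚ πℚ b
    p≤b = subst (λ k → πℚ k ≤ℚ πℚ b) (ℕₚ.suc-injective (ℕₚ.*-comm (suc b) (suc a))) (πℚ-refine-≤ b a)

  πℚ-cauchy : IsCauchy πℚ
  πℚ-cauchy ε 0<ε with divide (0</ 4 1) (0<-half 0<ε)
  ... | δ , 0<δ , δ*4≡ε/2 with 1/-small 0<δ
  ... | N , small = N , λ m n N≤m N≤n → ∣∣<
      (ℚₚ.≤-<-trans (πℚ-close m n) (4/ m N≤m))
      (subst (_<ℚ ε) (neg-difference (πℚ m) (πℚ n))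
        (ℚₚ.≤-<-trans (πℚ-close n m) (4/ n N≤n)))
    where
    open ℚₚ.≤-Reasoning
    4/ : ∀ n → N ℕ.≤ n → + 4 / suc n <ℚ ε
    4/ n N≤n = begin-strict
      + 4 / suc n                       ≡⟨ /-≡ 4 (suc n) (1 ℕ.* 4) (suc n ℕ.* 1) (cong (4 ℕ.*_) (ℕₚ.*-identityʳ (suc n))) ⟩
      + (1 ℕ.* 4) / (suc n ℕ.* 1)       ≡⟨ /-* 1 (suc n) 4 1 ⟨
      (+ 1 / suc n) * (+ 4 / 1)    ≤⟨ ℚₚ.*-monoʳ-≤-nonNeg (+ 4 / 1) {{ℚ.nonNegative (0≤/ 4 1)}} (small n N≤n) ⟩
      δ * (+ 4 / 1)                ≡⟨ δ*4≡ε/2 ⟩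
      ½ * ε                             ≡⟨ ℚₚ.+-identityˡ (½ * ε) ⟨
      0ℚ + ½ * ε                        <⟨ ℚₚ.+-monoˡ-< (½ * ε) (0<-half 0<ε) ⟩
      ½ * ε + ½ * ε                     ≡⟨ halves ε ⟩
      ε                                 ∎

------------------------------------------------------------------------
-- The majorant bʲ/j! of the exponential series

majorant : ℕ → ℕ → ℚ
majorant b j = (+ (b ℕ.^ j) / j !) {{j ℕₚ.!≢0}}

module _ (b : ℕ) where

  open ℚ using (_+_; _*_; _-_; -_; ∣_∣) renaming (_≤_ to _≤ℚ_; _<_ to _<ℚ_)
  open ℚ-Solver.+-*-Solver

  majorant-nonneg : ∀ j → 0ℚ ≤ℚ majorant b j
  majorant-nonneg j = 0≤/ (b ℕ.^ j) (j !) {{j ℕₚ.!≢0}}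

  majorant-halves : ∀ j → 2 ℕ.* b ℕ.≤ suc j → (+ 2 / 1) * majorant b (suc j) ≤ℚ majorant b j
  majorant-halves j 2b≤1+j = subst (_≤ℚ majorant b j)
      (sym (/-* 2 1 (b ℕ.^ suc j) (suc j !) {{_}} {{suc j ℕₚ.!≢0}} {{nz}}))
      (/-mono-≤ (2 ℕ.* b ℕ.^ suc j) (1 ℕ.* suc j !) (b ℕ.^ j) (j !) {{nz}} {{j ℕₚ.!≢0}} (begin
        2 ℕ.* (b ℕ.* b ℕ.^ j) ℕ.* j !        ≡⟨ ℕ-Solver.solve 3 (λ b x y → κ 2 ⊗ (b ⊗ x) ⊗ y ⊜ (κ 2 ⊗ b) ⊗ (x ⊗ y)) refl b (b ℕ.^ j) (j !) ⟩
        2 ℕ.* b ℕ.* (b ℕ.^ j ℕ.* j !)        ≤⟨ ℕₚ.*-monoˡ-≤ (b ℕ.^ j ℕ.* j !) 2b≤1+j ⟩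
        suc j ℕ.* (b ℕ.^ j ℕ.* j !)          ≡⟨ ℕ-Solver.solve 3 (λ n x y → n ⊗ (x ⊗ y) ⊜ x ⊗ (κ 1 ⊗ (n ⊗ y))) refl (suc j) (b ℕ.^ j) (j !) ⟩
        b ℕ.^ j ℕ.* (1 ℕ.* (suc j ℕ.* j !))  ∎))
    where
    open ℕₚ.≤-Reasoning
    open ℕ-Solver using () renaming (_:+_ to _⊕_; _:*_ to _⊗_; _:=_ to _⊜_; con to κ)
    nz : NonZero (1 ℕ.* suc j !)
    nz = ℕₚ.m*n≢0 1 (suc j !) {{_}} {{suc j ℕₚ.!≢0}}

  majorant-decay : ∀ i → (+ suc i / 1) * majorant b (i ℕ.+ 2 ℕ.* b) ≤ℚ majorant b (2 ℕ.* b)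
  majorant-decay zero    = ℚₚ.≤-reflexive (trans (cong (_* majorant b (2 ℕ.* b)) 1/1≡1) (ℚₚ.*-identityˡ _))
  majorant-decay (suc i) = begin
    (+ suc (suc i) / 1) * x′             ≤⟨ ℚₚ.*-monoʳ-≤-nonNeg x′ {{ℚ.nonNegative (majorant-nonneg (suc i ℕ.+ 2 ℕ.* b))}}
                                              (/-mono-≤ (suc (suc i)) 1 (suc i ℕ.* 2) (1 ℕ.* 1) (ℕₚ.*-monoˡ-≤ 1 2+i≤)) ⟩
    (+ (suc i ℕ.* 2) / (1 ℕ.* 1)) * x′   ≡⟨ cong (_* x′) (/-* (suc i) 1 2 1) ⟨
    (+ suc i / 1) * (+ 2 / 1) * x′       ≡⟨ ℚₚ.*-assoc (+ suc i / 1) (+ 2 / 1) x′ ⟩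
    (+ suc i / 1) * ((+ 2 / 1) * x′)     ≤⟨ ℚₚ.*-monoˡ-≤-nonNeg (+ suc i / 1) {{ℚ.nonNegative (0≤/ (suc i) 1)}}
                                              (majorant-halves (i ℕ.+ 2 ℕ.* b) (ℕₚ.≤-trans (ℕₚ.m≤n+m (2 ℕ.* b) i) (ℕₚ.n≤1+n _))) ⟩
    (+ suc i / 1) * majorant b (i ℕ.+ 2 ℕ.* b)  ≤⟨ majorant-decay i ⟩
    majorant b (2 ℕ.* b)                 ∎
    where
    open ℚₚ.≤-Reasoning
    x′ = majorant b (suc i ℕ.+ 2 ℕ.* b)
    2+i≤ : suc (suc i) ℕ.≤ suc i ℕ.* 2
    2+i≤ = ℕ.s≤s (ℕ.s≤s (ℕₚ.m≤m*n i 2))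

  majorant-small : ∀ {ε} → 0ℚ <ℚ ε → ∃[ k ] 2 ℕ.* b ℕ.≤ k × (+ 2 / 1) * majorant b k <ℚ ε
  majorant-small {ε} 0<ε with archimedean (majorant b (2 ℕ.* b)) (0<-half 0<ε)
  ... | i , < = i ℕ.+ 2 ℕ.* b , ℕₚ.m≤n+m (2 ℕ.* b) i , (begin-strict
    (+ 2 / 1) * x              <⟨ ℚₚ.*-monoʳ-<-pos (+ 2 / 1) {{ℚ.positive (0</ 2 1)}}
                                    (ℚₚ.*-cancelˡ-<-nonNeg (+ suc i / 1) {{ℚ.nonNegative (0≤/ (suc i) 1)}}
                                      (ℚₚ.≤-<-trans (majorant-decay i) <)) ⟩
    (+ 2 / 1) * (½ * ε)        ≡⟨ ℚₚ.*-assoc (+ 2 / 1) ½ ε ⟨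
    (+ 2 / 1) * ½ * ε          ≡⟨ cong (_* ε) 2/1*½≡1 ⟩
    1ℚ * ε                     ≡⟨ ℚₚ.*-identityˡ ε ⟩
    ε                          ∎)
    where
    open ℚₚ.≤-Reasoning
    x = majorant b (i ℕ.+ 2 ℕ.* b)

  majorised-tail : (s t : ℕ → ℚ) → (∀ n → s (suc n) ≡ s n + t n) → (∀ n → ∣ t n ∣ ≤ℚ majorant b n) →
                   ∀ k → 2 ℕ.* b ℕ.≤ k → ∀ i → ∣ s (i ℕ.+ k) - s k ∣ ≤ℚ (+ 2 / 1) * majorant b k
  majorised-tail s t step t≤ k 2b≤k i = ℚₚ.≤-trans
      (subst (_≤ℚ ∣ s (i ℕ.+ k) - s k ∣ + (+ 2 / 1) * majorant b (i ℕ.+ k)) (ℚₚ.+-identityʳ _)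
        (ℚₚ.+-monoʳ-≤ ∣ s (i ℕ.+ k) - s k ∣ (0≤* (0≤/ 2 1) (majorant-nonneg (i ℕ.+ k)))))
      (go i)
    where
    open ℚₚ.≤-Reasoning
    go : ∀ i → ∣ s (i ℕ.+ k) - s k ∣ + (+ 2 / 1) * majorant b (i ℕ.+ k) ≤ℚ (+ 2 / 1) * majorant b k
    go zero = ℚₚ.≤-reflexive (trans (cong (_+ (+ 2 / 1) * majorant b k) (∣x-x∣≡0 (s k))) (ℚₚ.+-identityˡ _))
    go (suc i) = begin
      ∣ s (suc l) - s k ∣ + (+ 2 / 1) * majorant b (suc l)
        ≡⟨ cong (λ x → ∣ x ∣ + (+ 2 / 1) * majorant b (suc l))
             (trans (cong (_- s k) (step l)) (solve 3 (λ x y z → (x :+ y) :- z := (x :- z) :+ y) refl (s l) (t l) (s k))) ⟩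
      ∣ (s l - s k) + t l ∣ + (+ 2 / 1) * majorant b (suc l)
        ≤⟨ ℚₚ.+-mono-≤ (ℚₚ.≤-trans (ℚₚ.∣p+q∣≤∣p∣+∣q∣ (s l - s k) (t l)) (ℚₚ.+-monoʳ-≤ ∣ s l - s k ∣ (t≤ l)))
                       (majorant-halves l (ℕₚ.≤-trans 2b≤k (ℕₚ.≤-trans (ℕₚ.m≤n+m k i) (ℕₚ.n≤1+n l)))) ⟩
      ∣ s l - s k ∣ + majorant b l + majorant b l
        ≡⟨ trans (ℚₚ.+-assoc ∣ s l - s k ∣ (majorant b l) (majorant b l)) (cong (λ x → ∣ s l - s k ∣ + x) (sym (2/1* majorant b l))) ⟩
      ∣ s l - s k ∣ + (+ 2 / 1) * majorant b l
        ≤⟨ go i ⟩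
      (+ 2 / 1) * majorant b k ∎
      where l = i ℕ.+ k

------------------------------------------------------------------------
-- Real numbers

record ℝ : Set where
  constructor mkℝ
  field
    seq    : ℕ → ℚ
    cauchy : IsCauchy seq

open ℝ public

infix 4 _≈_ _≤_

_≈_ : ℝ → ℝ → Set
x ≈ y = ∀ ε → 0ℚ ℚ.< ε → ∃[ N ] (∀ n → N ℕ.≤ n → ℚ.∣ seq x n ℚ.- seq y n ∣ ℚ.< ε)

_≤_ : ℝ → ℝ → Set
x ≤ y = ∀ ε → 0ℚ ℚ.< ε → ∃[ N ] (∀ n → N ℕ.≤ n → seq x n ℚ.< seq y n ℚ.+ ε)

fromℚ : ℚ → ℝ
fromℚ q = mkℝ (λ _ → q) λ ε 0<ε → 0 , λ _ _ _ _ → subst (ℚ._< ε) (sym (∣x-x∣≡0 q)) 0<ε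

fromℕ : ℕ → ℝ
fromℕ n = fromℚ (+ n / 1)

0ℝ 1ℝ : ℝ
0ℝ = fromℚ 0ℚ
1ℝ = fromℚ 1ℚ

infixl 6 _+_
infixl 7 _*_
infix  8 -_
infix  9 _²

_+_ _*_ : ℝ → ℝ → ℝ
x + y = mkℝ (λ n → seq x n ℚ.+ seq y n) (+-cauchy (seq x) (seq y) (cauchy x) (cauchy y))
x * y = mkℝ (λ n → seq x n ℚ.* seq y n) (*-cauchy (seq x) (seq y) (cauchy x) (cauchy y))

-_ _² : ℝ → ℝ
- x = mkℝ (λ n → ℚ.- seq x n) (neg-cauchy (seq x) (cauchy x))
x ² = x * x

-- √ x for 0 ≤ x; the value at a negative x is 0.
√ : ℝ → ℝ
√ x = mkℝ (√-seq (seq x)) (√-cauchy (seq x) (cauchy x))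

-- π = ∫₀¹ 4/(1+t²) dt
π : ℝ
π = mkℝ πℚ πℚ-cauchy

------------------------------------------------------------------------
-- Complex numbers

record ℂ : Set where
  constructor mkℂ
  field
    re im : ℝ

open ℂ public

infix  4 _≈ᶜ_
infixl 6 _+ᶜ_
infixl 7 _*ᶜ_ _·_
infixr 8 _^ᶜ_

_≈ᶜ_ : ℂ → ℂ → Set
z ≈ᶜ w = re z ≈ re w × im z ≈ im w

0ᶜ 1ᶜ : ℂ
0ᶜ = mkℂ 0ℝ 0ℝ
1ᶜ = mkℂ 1ℝ 0ℝ

_+ᶜ_ _*ᶜ_ : ℂ → ℂ → ℂ
z +ᶜ w = mkℂ (re z + re w) (im z + im w)
z *ᶜ w = mkℂ (re z * re w + - (im z * im w)) (re z * im w + im z * re w)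

_·_ : ℝ → ℂ → ℂ
x · z = mkℂ (x * re z) (x * im z)

_^ᶜ_ : ℂ → ℕ → ℂ
z ^ᶜ zero  = 1ᶜ
z ^ᶜ suc n = z *ᶜ z ^ᶜ n

conj : ℂ → ℂ
conj z = mkℂ (re z) (- im z)

∣_∣ : ℂ → ℝ
∣ z ∣ = √ (re z ² + im z ²)

------------------------------------------------------------------------
-- The complex exponential function

expTerm : ℂ → ℕ → ℂ
expTerm z n = fromℚ ((+ 1 / n !) {{n ℕₚ.!≢0}}) · z ^ᶜ n

expSum : ℂ → ℕ → ℂ
expSum z zero    = 0ᶜ
expSum z (suc n) = expSum z n +ᶜ expTerm z n

module _ where

  open ℚ using (_-_) renaming (_+_ to _+ℚ_; _*_ to _*ℚ_; -_ to -ℚ_; _≤_ to _≤ℚ_; _<_ to _<ℚ_; ∣_∣ to ∣_∣ℚ)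
  open ℚ-Solver.+-*-Solver using (solve; _:+_; _:*_; _:-_; :-_; _:=_)

  ∥_∥ : ℂ → ℕ → ℚ
  ∥ z ∥ m = ∣ seq (re z) m ∣ℚ +ℚ ∣ seq (im z) m ∣ℚ

  ∥∥-nonneg : ∀ z m → 0ℚ ≤ℚ ∥ z ∥ m
  ∥∥-nonneg z m = ℚₚ.+-mono-≤ (ℚₚ.0≤∣p∣ (seq (re z) m)) (ℚₚ.0≤∣p∣ (seq (im z) m))

  ∥∥-* : ∀ z w m → ∥ z *ᶜ w ∥ m ≤ℚ ∥ z ∥ m *ℚ ∥ w ∥ m
  ∥∥-* z w m = begin
    ∣ x *ℚ u - y *ℚ v ∣ℚ +ℚ ∣ x *ℚ v +ℚ y *ℚ u ∣ℚ
      ≤⟨ ℚₚ.+-mono-≤ (ℚₚ.∣p-q∣≤∣p∣+∣q∣ (x *ℚ u) (y *ℚ v)) (ℚₚ.∣p+q∣≤∣p∣+∣q∣ (x *ℚ v) (y *ℚ u)) ⟩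
    (∣ x *ℚ u ∣ℚ +ℚ ∣ y *ℚ v ∣ℚ) +ℚ (∣ x *ℚ v ∣ℚ +ℚ ∣ y *ℚ u ∣ℚ)
      ≡⟨ cong₂ _+ℚ_ (cong₂ _+ℚ_ (ℚₚ.∣p*q∣≡∣p∣*∣q∣ x u) (ℚₚ.∣p*q∣≡∣p∣*∣q∣ y v))
                    (cong₂ _+ℚ_ (ℚₚ.∣p*q∣≡∣p∣*∣q∣ x v) (ℚₚ.∣p*q∣≡∣p∣*∣q∣ y u)) ⟩
    (∣ x ∣ℚ *ℚ ∣ u ∣ℚ +ℚ ∣ y ∣ℚ *ℚ ∣ v ∣ℚ) +ℚ (∣ x ∣ℚ *ℚ ∣ v ∣ℚ +ℚ ∣ y ∣ℚ *ℚ ∣ u ∣ℚ)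
      ≡⟨ solve 4 (λ x y u v → (x :* u :+ y :* v) :+ (x :* v :+ y :* u) := (x :+ y) :* (u :+ v)) refl ∣ x ∣ℚ ∣ y ∣ℚ ∣ u ∣ℚ ∣ v ∣ℚ ⟩
    ∥ z ∥ m *ℚ ∥ w ∥ m ∎
    where
    open ℚₚ.≤-Reasoning
    x = seq (re z) m
    y = seq (im z) m
    u = seq (re w) m
    v = seq (im w) m

  ∥∥-^ : ∀ {z m b} → ∥ z ∥ m ≤ℚ + b / 1 → ∀ j → ∥ z ^ᶜ j ∥ m ≤ℚ + (b ℕ.^ j) / 1
  ∥∥-^ _ zero = ℚₚ.≤-reflexive (sym 1/1≡1)
  ∥∥-^ {z} {m} {b} z≤b (suc j) = begin
    ∥ z *ᶜ z ^ᶜ j ∥ m                  ≤⟨ ∥∥-* z (z ^ᶜ j) m ⟩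
    ∥ z ∥ m *ℚ ∥ z ^ᶜ j ∥ m            ≤⟨ *-mono-≤ (∥∥-nonneg z m) (0≤/ (b ℕ.^ j) 1) z≤b (∥∥-^ {z} z≤b j) ⟩
    (+ b / 1) *ℚ (+ (b ℕ.^ j) / 1)     ≡⟨ /-* b 1 (b ℕ.^ j) 1 ⟩
    + (b ℕ.^ suc j) / 1                ∎
    where open ℚₚ.≤-Reasoning

  scaled-≤-majorant : ∀ b j x → ∣ x ∣ℚ ≤ℚ + (b ℕ.^ j) / 1 →
                      ∣ ((+ 1 / j !) {{j ℕₚ.!≢0}}) *ℚ x ∣ℚ ≤ℚ majorant b j
  scaled-≤-majorant b j x x≤ = begin
    ∣ c *ℚ x ∣ℚ                  ≡⟨ ℚₚ.∣p*q∣≡∣p∣*∣q∣ c x ⟩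
    ∣ c ∣ℚ *ℚ ∣ x ∣ℚ             ≡⟨ cong (_*ℚ ∣ x ∣ℚ) (ℚₚ.0≤p⇒∣p∣≡p 0≤c) ⟩
    c *ℚ ∣ x ∣ℚ                  ≤⟨ ℚₚ.*-monoˡ-≤-nonNeg c {{ℚ.nonNegative 0≤c}} x≤ ⟩
    c *ℚ (+ (b ℕ.^ j) / 1)       ≡⟨ /-* 1 (j !) (b ℕ.^ j) 1 {{j ℕₚ.!≢0}} {{_}} {{nz}} ⟩
    (+ (1 ℕ.* b ℕ.^ j) / (j ! ℕ.* 1)) {{nz}}
                                 ≡⟨ /-≡ (1 ℕ.* b ℕ.^ j) (j ! ℕ.* 1) (b ℕ.^ j) (j !) {{nz}} {{j ℕₚ.!≢0}}
                                      (cong₂ ℕ._*_ (ℕₚ.*-identityˡ (b ℕ.^ j)) (sym (ℕₚ.*-identityʳ (j !)))) ⟩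
    majorant b j                 ∎
    where
    open ℚₚ.≤-Reasoning
    c = (+ 1 / j !) {{j ℕₚ.!≢0}}
    0≤c = 0≤/ 1 (j !) {{j ℕₚ.!≢0}}
    nz : NonZero (j ! ℕ.* 1)
    nz = ℕₚ.m*n≢0 (j !) 1 {{j ℕₚ.!≢0}}

  ℂ-bounded : ∀ z → ∃[ b ] (∀ m → ∥ z ∥ m ≤ℚ + b / 1)
  ℂ-bounded z with bounded (seq (re z)) (cauchy (re z)) | bounded (seq (im z)) (cauchy (im z))
  ... | B , _ , re≤B | B′ , _ , im≤B′ = ceil (B +ℚ B′) , λ m →
    ℚₚ.≤-trans (ℚₚ.+-mono-≤ (re≤B m) (im≤B′ m)) (≤ceil (B +ℚ B′))

  -- The double sequence of rational approximations to the partial sums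
  -- converges jointly in both indices, so that its diagonal represents the
  -- limit of the partial sums.
  JointlyCauchy : (ℕ → ℝ) → Set
  JointlyCauchy x = ∀ ε → 0ℚ <ℚ ε →
    ∃[ N ] (∀ n n′ m m′ → N ℕ.≤ n → N ℕ.≤ n′ → N ℕ.≤ m → N ℕ.≤ m′ →
            ∣ seq (x n) m - seq (x n′) m′ ∣ℚ <ℚ ε)

  private
    0<3 : 0ℚ <ℚ 1ℚ +ℚ (1ℚ +ℚ 1ℚ)
    0<3 = ℚₚ.positive⁻¹ (1ℚ +ℚ (1ℚ +ℚ 1ℚ))

  majorised-jointlyCauchy : ∀ b (s : ℕ → ℝ) (t : ℕ → ℕ → ℚ) →
    (∀ n m → seq (s (suc n)) m ≡ seq (s n) m +ℚ t n m) →
    (∀ n m → ∣ t n m ∣ℚ ≤ℚ majorant b n) → JointlyCauchy s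
  majorised-jointlyCauchy b s t step t≤ ε 0<ε
    with divide 0<3 0<ε
  ... | δ , 0<δ , δ*3≡ε
    with majorant-small b 0<δ
  ... | k , 2b≤k , <δ
    with cauchy (s k) δ 0<δ
  ... | N , close = k ℕ.⊔ N , λ n n′ m m′ ≤n ≤n′ ≤m ≤m′ → begin-strict
    ∣ seq (s n) m - seq (s n′) m′ ∣ℚ
      ≤⟨ ∣-∣-triangle (seq (s n) m) (seq (s k) m) (seq (s n′) m′) ⟩
    ∣ seq (s n) m - seq (s k) m ∣ℚ +ℚ ∣ seq (s k) m - seq (s n′) m′ ∣ℚ
      ≤⟨ ℚₚ.+-monoʳ-≤ ∣ seq (s n) m - seq (s k) m ∣ℚ (∣-∣-triangle (seq (s k) m) (seq (s k) m′) (seq (s n′) m′)) ⟩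
    ∣ seq (s n) m - seq (s k) m ∣ℚ +ℚ (∣ seq (s k) m - seq (s k) m′ ∣ℚ +ℚ ∣ seq (s k) m′ - seq (s n′) m′ ∣ℚ)
      <⟨ ℚₚ.+-mono-< (tail m n (ℕₚ.m⊔n≤o⇒m≤o k N ≤n))
           (ℚₚ.+-mono-< (close m m′ (ℕₚ.m⊔n≤o⇒n≤o k N ≤m) (ℕₚ.m⊔n≤o⇒n≤o k N ≤m′))
             (subst (_<ℚ δ) (∣x-y∣≡∣y-x∣ (seq (s n′) m′) (seq (s k) m′)) (tail m′ n′ (ℕₚ.m⊔n≤o⇒m≤o k N ≤n′)))) ⟩
    δ +ℚ (δ +ℚ δ)
      ≡⟨ solve 1 (λ δ → δ :+ (δ :+ δ) := δ :* (κ 1ℚ :+ (κ 1ℚ :+ κ 1ℚ))) refl δ ⟩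
    δ *ℚ (1ℚ +ℚ (1ℚ +ℚ 1ℚ))
      ≡⟨ δ*3≡ε ⟩
    ε ∎
    where
    open ℚₚ.≤-Reasoning
    open ℚ-Solver.+-*-Solver using () renaming (con to κ)
    tail : ∀ m n → k ℕ.≤ n → ∣ seq (s n) m - seq (s k) m ∣ℚ <ℚ δ
    tail m n k≤n = subst (λ n → ∣ seq (s n) m - seq (s k) m ∣ℚ <ℚ δ) (ℕₚ.m∸n+n≡m k≤n)
      (ℚₚ.≤-<-trans (majorised-tail b (λ n → seq (s n) m) (λ n → t n m) (λ n → step n m) (λ n → t≤ n m) k 2b≤k (n ℕ.∸ k)) <δ)

  re-expSum-jointlyCauchy : ∀ z → JointlyCauchy (λ n → re (expSum z n))
  re-expSum-jointlyCauchy z with ℂ-bounded z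
  ... | b , z≤b = majorised-jointlyCauchy b (λ n → re (expSum z n)) (λ n m → seq (re (expTerm z n)) m)
    (λ _ _ → refl) λ n m → scaled-≤-majorant b n (seq (re (z ^ᶜ n)) m) (ℚₚ.≤-trans
      (subst (_≤ℚ ∥ z ^ᶜ n ∥ m) (ℚₚ.+-identityʳ _) (ℚₚ.+-monoʳ-≤ ∣ seq (re (z ^ᶜ n)) m ∣ℚ (ℚₚ.0≤∣p∣ (seq (im (z ^ᶜ n)) m))))
      (∥∥-^ {z} (z≤b m) n))

  im-expSum-jointlyCauchy : ∀ z → JointlyCauchy (λ n → im (expSum z n))
  im-expSum-jointlyCauchy z with ℂ-bounded z
  ... | b , z≤b = majorised-jointlyCauchy b (λ n → im (expSum z n)) (λ n m → seq (im (expTerm z n)) m)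
    (λ _ _ → refl) λ n m → scaled-≤-majorant b n (seq (im (z ^ᶜ n)) m) (ℚₚ.≤-trans
      (subst (_≤ℚ ∥ z ^ᶜ n ∥ m) (ℚₚ.+-identityˡ _) (ℚₚ.+-monoˡ-≤ ∣ seq (im (z ^ᶜ n)) m ∣ℚ (ℚₚ.0≤∣p∣ (seq (re (z ^ᶜ n)) m))))
      (∥∥-^ {z} (z≤b m) n))

  diagonal : (x : ℕ → ℝ) → JointlyCauchy x → ℝ
  diagonal x joint = mkℝ (λ n → seq (x n) n) λ ε 0<ε →
    let N , close = joint ε 0<ε in N , λ m n N≤m N≤n → close m n m n N≤m N≤n N≤m N≤n

exp : ℂ → ℂ
exp z = mkℂ (diagonal (λ n → re (expSum z n)) (re-expSum-jointlyCauchy z))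
            (diagonal (λ n → im (expSum z n)) (im-expSum-jointlyCauchy z))

-- e(x) = exp(2πix)
e : ℝ → ℂ
e x = exp (mkℂ 0ℝ (fromℕ 2 * π * x))

------------------------------------------------------------------------
-- Finite sums

∑ℝ : {A : Set} → List A → (A → ℝ) → ℝ
∑ℝ xs f = foldr (λ x s → f x + s) 0ℝ xs

∑ℂ : {A : Set} → List A → (A → ℂ) → ℂ
∑ℂ xs f = foldr (λ x s → f x +ᶜ s) 0ᶜ xs

infix 5 ∑ℝ ∑ℂ

syntax ∑ℝ xs (λ x → t) = ∑ℝ[ x ∈ xs ] t
syntax ∑ℂ xs (λ x → t) = ∑ℂ[ x ∈ xs ] t

-- The integers m with A < m ≤ A + M
interval : ℤ → ℕ → List ℤ
interval A M = map (λ j → A ℤ.+ + suc j) (upTo M)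

-- The integers h with 0 < |h| ≤ N
0<∣h∣≤_ : ℕ → List ℤ
0<∣h∣≤ N = concatMap (λ j → + suc j ∷ -[1+ j ] ∷ []) (upTo N)

-- The integers k with |k| ≤ N
∣k∣≤_ : ℕ → List ℤ
∣k∣≤ N = 0ℤ ∷ (0<∣h∣≤ N)

------------------------------------------------------------------------
-- Exponential sums

-- min(M/r, 1/|k|), where 1/0 = ∞
weight : (M r : ℕ) .{{_ : NonZero r}} → ℤ → ℚ
weight M r +0       = + M / r
weight M r +[1+ k ] = (+ M / r) ℚ.⊓ (+ 1 / suc k)
weight M r -[1+ k ] = (+ M / r) ℚ.⊓ (+ 1 / suc k)

-- B̂ r₁ s β h k = Σ_{m mod r₁} β(m + hs) conj(β(m)) e(-km/r₁), for β of period r₁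
B̂ : (r₁ s : ℕ) .{{_ : NonZero r₁}} → (ℤ → ℂ) → ℤ → ℤ → ℂ
B̂ r₁ s β h k = ∑ℂ[ m ∈ upTo r₁ ]
  β (+ m ℤ.+ h ℤ.* + s) *ᶜ conj (β (+ m)) *ᶜ e (fromℚ ((ℤ.- (k ℤ.* + m)) / r₁))

-- Put s = H r₂ and split the interval into residue classes u modulo s. On a class
-- every b₂ᵢ is constant, so Cauchy's inequality over u and i gives
-- |S|² ≤ R₂² I s ∑ᵢ ∑ᵤ |Tᵢ(u)|² with Tᵢ(u) the sum of b₁ᵢ over the class u. Expand the
-- squares. The diagonal contributes at most I M R₁². The pairs at distance h s, taken
-- over all classes and all i, form a sum over an interval of the r₁-periodic function
-- ∑ᵢ b₁ᵢ(m + h s) conj(b₁ᵢ(m)); Fourier inversion modulo r₁ bounds it by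
-- r₁⁻¹ ∑ₖ |∑ᵢ B̂ᵢ(k)| |Gₖ| with geometric sums |Gₖ| ≤ min(M, r₁/|k|). So C = 2 works.
--
-- For e(x), Euler's method applied to exp(z + t w) exp(-t w) gives the functional
-- equation, and applied to exp(2 i arctan t) (1 - i t)/(1 + i t) it gives e(1/4) = i,
-- since the Riemann sums of arctan t on [0, 1] are those which define π.

module Submission where

open import Algebra.Bundles using (CommutativeRing)
import Algebra.Solver.Ring as RingSolver
import Algebra.Solver.Ring.AlmostCommutativeRing as ACR
import Algebra.Solver.Ring.Simple as SimpleRingSolver
open import Data.Fin.Base using (Fin)
open import Data.Integer.Base as ℤ using (ℤ; +_; -[1+_])
import Data.Integer.Properties as ℤₚ
open import Data.Integer.Solver renaming (module +-*-Solver to ℤ-Solver)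
open import Data.List.Base using (List; []; _∷_; _++_; allFin; applyUpTo; concatMap; foldr; length; map; upTo)
import Data.List.Properties as Listₚ
open import Data.Maybe.Base using (Maybe; just; nothing)
open import Data.Nat.Base as ℕ using (ℕ; zero; suc; 2+; _∸_; _!; NonZero)
import Data.Nat.DivMod as ℕ
import Data.Nat.Properties as ℕₚ
open import Data.Nat.Properties using (m*n≢0)
open import Data.Nat.Solver renaming (module +-*-Solver to ℕ-Solver)
open import Data.Product.Base using (∃-syntax; _×_; _,_; proj₁; proj₂)
open import Data.Product.Properties using (≡-dec)
open import Data.Rational.Base as ℚ using (ℚ; 0ℚ; 1ℚ; ½) hiding (module ℚ)
import Data.Rational.Properties as ℚₚ
import Data.Rational.Solver as ℚ-Solver
open import Data.Rational.Unnormalised.Base as ℚᵘ using (mkℚᵘ)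
import Data.Rational.Unnormalised.Properties as ℚᵘₚ
open import Data.Sum.Base using (_⊎_; inj₁; inj₂; [_,_]′)
open import Function.Base using (_∘_)
open import Level using (0ℓ)
open import Relation.Binary.Bundles using (Preorder)
open import Relation.Binary.Core using (Rel)
open import Relation.Binary.PropositionalEquality as ≡ using (_≡_)
open import Relation.Binary.Structures using (IsPreorder)
open import Relation.Nullary using (yes; no; contradiction)

open import Defs using (_/_; weight; 0<∣h∣≤_; ∣k∣≤_; interval)
open Defs.ℚ-Lemmas using (0≤/; 0/1≡0; 1/1≡1; /-suc; /-*; /-mono-≤; /-≡)

-- The bound |Gₖ| ≤ r/|k| for a geometric sum usually rests on a lower bound for the sine. Here one
-- numerical fact serves: Re e(x) ≤ 1/2, hence |1 - e(x)| ≥ 1, for 1/4 ≤ x ≤ 1/2. If n is the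
-- integer part of r/(2|k|), then |k| n/r lies in that range, and comparing the sums of L and of n
-- terms through the factors 1 - e(kL/r) and 1 - e(kn/r) gives |Gₖ| ≤ 2n ≤ r/|k|. With L = r the
-- same comparison gives orthogonality. The numerical fact follows from e(1/4) = i, which moves x to
-- some u between 0 and 1/8, and from three terms of the power series at 2πiu, where π ≤ 4 keeps 2πu
-- ≤ 1.
--
-- Equality of reals is convergence of Cauchy sequences and `exp` is a diagonal of partial sums, so
-- no derivative is taken. The differential equations behind the two facts on e(x) are replaced by
-- Euler steps over the Gaussian rationals, with explicit errors that vanish as the number of steps
-- and the number of terms grow together.

[n/1]*[1/n]≡1 : ∀ n .{{_ : NonZero n}} → (+ n / 1) ℚ.* (+ 1 / n) ≡ 1ℚ
[n/1]*[1/n]≡1 n@(suc _) = ≡.trans (/-* n 1 1 n) (≡.trans (/-≡ (n ℕ.* 1) (1 ℕ.* n) 1 1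
  (≡.trans (ℕₚ.*-identityʳ (n ℕ.* 1)) (≡.trans (ℕₚ.*-comm n 1) (≡.sym (ℕₚ.*-identityˡ (1 ℕ.* n)))))) 1/1≡1)

module _ (R : CommutativeRing 0ℓ 0ℓ) where

  open CommutativeRing R
  open import Relation.Binary.Reasoning.Setoid setoid

  -- Serves to divide by `exp (-ᶜ w)` and by `-iᶜ`, whose inverses are explicit.
  divide-by-unit : ∀ {p q r s} → p * q ≈ r → q * s ≈ 1# → p ≈ r * s
  divide-by-unit {p} {q} {r} {s} pq≈r qs≈1 = begin
    p            ≈⟨ *-identityʳ p ⟨
    p * 1#       ≈⟨ *-congˡ qs≈1 ⟨
    p * (q * s)  ≈⟨ *-assoc p q s ⟨
    p * q * s    ≈⟨ *-congʳ pq≈r ⟩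
    r * s        ∎

-- Finite sums

module Sum (R : CommutativeRing 0ℓ 0ℓ) where

  open CommutativeRing R
  open import Relation.Binary.Reasoning.Setoid setoid
  open import Algebra.Properties.CommutativeSemigroup +-commutativeSemigroup using (interchange)

  ∑ : {A : Set} → List A → (A → Carrier) → Carrier
  ∑ xs f = foldr (λ x s → f x + s) 0# xs

  ∑-syntax = ∑
  infix 5 ∑-syntax
  syntax ∑-syntax xs (λ x → t) = ∑[ x ∈ xs ] t

  module _ {A : Set} where

    ∑-cong : ∀ (xs : List A) {f g} → (∀ x → f x ≈ g x) → ∑ xs f ≈ ∑ xs g
    ∑-cong []       f≈g = refl
    ∑-cong (x ∷ xs) f≈g = +-cong (f≈g x) (∑-cong xs f≈g)

    ∑-+ : ∀ (xs : List A) f g → ∑[ x ∈ xs ] (f x + g x) ≈ ∑ xs f + ∑ xs g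
    ∑-+ []       f g = sym (+-identityˡ 0#)
    ∑-+ (x ∷ xs) f g = trans (+-congˡ (∑-+ xs f g)) (interchange (f x) (g x) (∑ xs f) (∑ xs g))

    ∑-*ˡ : ∀ (xs : List A) c f → ∑[ x ∈ xs ] (c * f x) ≈ c * ∑ xs f
    ∑-*ˡ []       c f = sym (zeroʳ c)
    ∑-*ˡ (x ∷ xs) c f = trans (+-congˡ (∑-*ˡ xs c f)) (sym (distribˡ c (f x) (∑ xs f)))

    ∑-*ʳ : ∀ (xs : List A) c f → ∑[ x ∈ xs ] (f x * c) ≈ ∑ xs f * c
    ∑-*ʳ xs c f = trans (∑-cong xs λ x → *-comm (f x) c) (trans (∑-*ˡ xs c f) (*-comm c (∑ xs f)))

    ∑-0 : ∀ (xs : List A) → ∑[ _ ∈ xs ] 0# ≈ 0#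
    ∑-0 []       = refl
    ∑-0 (_ ∷ xs) = trans (+-identityˡ _) (∑-0 xs)

    ∑-++ : ∀ (xs ys : List A) f → ∑ (xs ++ ys) f ≈ ∑ xs f + ∑ ys f
    ∑-++ []       ys f = sym (+-identityˡ (∑ ys f))
    ∑-++ (x ∷ xs) ys f = trans (+-congˡ (∑-++ xs ys f)) (sym (+-assoc (f x) (∑ xs f) (∑ ys f)))

    ∑-map : ∀ {B : Set} (g : B → A) (xs : List B) f → ∑ (map g xs) f ≡ ∑ xs (f ∘ g)
    ∑-map g []       f = ≡.refl
    ∑-map g (x ∷ xs) f = ≡.cong (λ s → f (g x) + s) (∑-map g xs f)

    ∑-concatMap : ∀ {B : Set} (g : B → List A) (xs : List B) f → ∑ (concatMap g xs) f ≈ ∑[ x ∈ xs ] ∑ (g x) f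
    ∑-concatMap g []       f = refl
    ∑-concatMap g (x ∷ xs) f = trans (∑-++ (g x) (concatMap g xs) f) (+-congˡ (∑-concatMap g xs f))

  ∑-swap : ∀ {A B : Set} (xs : List A) (ys : List B) (f : A → B → Carrier) → ∑[ x ∈ xs ] ∑[ y ∈ ys ] f x y ≈ ∑[ y ∈ ys ] ∑[ x ∈ xs ] f x y
  ∑-swap []       ys f = sym (∑-0 ys)
  ∑-swap (x ∷ xs) ys f = trans (+-congˡ (∑-swap xs ys f)) (sym (∑-+ ys (f x) (λ y → ∑[ x ∈ xs ] f x y)))

  ∑< : ℕ → (ℕ → Carrier) → Carrier
  ∑< n = ∑ (upTo n)

  ∑<-syntax = ∑<
  infix 5 ∑<-syntax
  syntax ∑<-syntax n (λ j → t) = ∑[ j < n ] t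

  ∑-applyUpTo : ∀ {A : Set} (g : ℕ → A) n f → ∑ (applyUpTo g n) f ≡ ∑< n (f ∘ g)
  ∑-applyUpTo g zero    f = ≡.refl
  ∑-applyUpTo g (suc n) f = ≡.cong (λ s → f (g 0) + s) (≡.trans (∑-applyUpTo (g ∘ suc) n f) (≡.sym (∑-applyUpTo suc n (f ∘ g))))

  ∑<-suc : ∀ n f → ∑< (suc n) f ≡ f 0 + ∑< n (f ∘ suc)
  ∑<-suc n f = ≡.cong (λ s → f 0 + s) (∑-applyUpTo suc n f)

  ∑<-cong : ∀ n {f g} → (∀ j → j ℕ.< n → f j ≈ g j) → ∑< n f ≈ ∑< n g
  ∑<-cong zero    f≈g = refl
  ∑<-cong (suc n) {f} {g} f≈g = begin
    ∑< (suc n) f              ≡⟨ ∑<-suc n f ⟩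
    f 0 + ∑< n (f ∘ suc)      ≈⟨ +-cong (f≈g 0 (ℕ.s≤s ℕ.z≤n)) (∑<-cong n λ j j<n → f≈g (suc j) (ℕ.s≤s j<n)) ⟩
    g 0 + ∑< n (g ∘ suc)      ≡⟨ ∑<-suc n g ⟨
    ∑< (suc n) g              ∎

  ∑<-zero : ∀ n {f} → (∀ j → j ℕ.< n → f j ≈ 0#) → ∑< n f ≈ 0#
  ∑<-zero n f≈0 = trans (∑<-cong n f≈0) (∑-0 (upTo n))

  ∑<-split : ∀ m n f → ∑< (m ℕ.+ n) f ≈ ∑< m f + (∑[ j < n ] f (m ℕ.+ j))
  ∑<-split zero    n f = sym (+-identityˡ (∑< n f))
  ∑<-split (suc m) n f = begin
    ∑< (suc (m ℕ.+ n)) f                                     ≡⟨ ∑<-suc (m ℕ.+ n) f ⟩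
    f 0 + ∑< (m ℕ.+ n) (f ∘ suc)                             ≈⟨ +-congˡ (∑<-split m n (f ∘ suc)) ⟩
    f 0 + (∑< m (f ∘ suc) + (∑[ j < n ] f (suc m ℕ.+ j)))    ≈⟨ +-assoc (f 0) _ _ ⟨
    f 0 + ∑< m (f ∘ suc) + (∑[ j < n ] f (suc m ℕ.+ j)) ≡⟨ ≡.cong (λ s → s + (∑[ j < n ] f (suc m ℕ.+ j))) (∑<-suc m f) ⟨
    ∑< (suc m) f + (∑[ j < n ] f (suc m ℕ.+ j))              ∎

  ∑<-last : ∀ n f → ∑< (suc n) f ≈ ∑< n f + f n
  ∑<-last n f = begin
    ∑< (suc n) f                   ≡⟨ ≡.cong (λ k → ∑< k f) (ℕₚ.+-comm 1 n) ⟩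
    ∑< (n ℕ.+ 1) f                 ≈⟨ ∑<-split n 1 f ⟩
    ∑< n f + (f (n ℕ.+ 0) + 0#)    ≈⟨ +-congˡ (+-identityʳ _) ⟩
    ∑< n f + f (n ℕ.+ 0)           ≡⟨ ≡.cong (λ k → ∑< n f + f k) (ℕₚ.+-identityʳ n) ⟩
    ∑< n f + f n                   ∎

  -- In `inversion` orthogonality annihilates all residues but one, which is made the first.
  ∑<-first : ∀ n .{{_ : NonZero n}} f → (∀ j → 0 ℕ.< j → j ℕ.< n → f j ≈ 0#) → ∑< n f ≈ f 0
  ∑<-first (suc n) f f≈0 = begin
    ∑< (suc n) f              ≡⟨ ∑<-suc n f ⟩
    f 0 + ∑< n (f ∘ suc)      ≈⟨ +-congˡ (∑<-zero n λ j j<n → f≈0 (suc j) (ℕ.s≤s ℕ.z≤n) (ℕ.s≤s j<n)) ⟩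
    f 0 + 0#                  ≈⟨ +-identityʳ (f 0) ⟩
    f 0                       ∎

  ∑<-truncate : ∀ {m n} f → m ℕ.≤ n → (∀ j → m ℕ.≤ j → f j ≈ 0#) → ∑< n f ≈ ∑< m f
  ∑<-truncate {m} {n} f m≤n f≈0 = begin
    ∑< n f                                          ≡⟨ ≡.cong (λ k → ∑< k f) (ℕₚ.m+[n∸m]≡n m≤n) ⟨
    ∑< (m ℕ.+ (n ∸ m)) f                            ≈⟨ ∑<-split m (n ∸ m) f ⟩
    ∑< m f + (∑[ j < n ∸ m ] f (m ℕ.+ j)) ≈⟨ +-congˡ (∑<-zero (n ∸ m) λ j _ → f≈0 (m ℕ.+ j) (ℕₚ.m≤m+n m j)) ⟩
    ∑< m f + 0#                                     ≈⟨ +-identityʳ (∑< m f) ⟩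
    ∑< m f                                          ∎

  ∑<-blocks : ∀ n s f → ∑< (n ℕ.* s) f ≈ ∑[ q < n ] ∑[ u < s ] f (u ℕ.+ q ℕ.* s)
  ∑<-blocks zero    s f = refl
  ∑<-blocks (suc n) s f = begin
    ∑< (s ℕ.+ n ℕ.* s) f
      ≈⟨ ∑<-split s (n ℕ.* s) f ⟩
    ∑< s f + (∑[ j < n ℕ.* s ] f (s ℕ.+ j))
      ≈⟨ +-cong (∑-cong (upTo s) λ u → reflexive (≡.cong f (≡.sym (ℕₚ.+-identityʳ u)))) (∑<-blocks n s (λ j → f (s ℕ.+ j))) ⟩
    (∑[ u < s ] f (u ℕ.+ 0)) + (∑[ q < n ] ∑[ u < s ] f (s ℕ.+ (u ℕ.+ q ℕ.* s)))
      ≈⟨ +-congˡ (∑-cong (upTo n) λ q → ∑-cong (upTo s) λ u → reflexive (≡.cong f (x∙yz≈y∙xz s u (q ℕ.* s)))) ⟩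
    (∑[ u < s ] f (u ℕ.+ 0)) + (∑[ q < n ] ∑[ u < s ] f (u ℕ.+ suc q ℕ.* s))
      ≡⟨ ∑<-suc n (λ q → ∑[ u < s ] f (u ℕ.+ q ℕ.* s)) ⟨
    ∑[ q < suc n ] ∑[ u < s ] f (u ℕ.+ q ℕ.* s) ∎
    where open import Algebra.Properties.CommutativeSemigroup ℕₚ.+-commutativeSemigroup using (x∙yz≈y∙xz)

  Periodic : ℕ → (ℤ → Carrier) → Set
  Periodic r f = ∀ m → f (m ℤ.+ + r) ≈ f m

  module _ {r : ℕ} {f : ℤ → Carrier} (f-periodic : Periodic r f) where

    periodic-* : ∀ n m → f (m ℤ.+ + (n ℕ.* r)) ≈ f m
    periodic-* zero    m = reflexive (≡.cong f (ℤₚ.+-identityʳ m))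
    periodic-* (suc n) m = begin
      f (m ℤ.+ + (r ℕ.+ n ℕ.* r))         ≡⟨ ≡.cong f (≡.sym (ℤₚ.+-assoc m (+ r) (+ (n ℕ.* r)))) ⟩
      f (m ℤ.+ + r ℤ.+ + (n ℕ.* r))       ≈⟨ periodic-* n (m ℤ.+ + r) ⟩
      f (m ℤ.+ + r)                       ≈⟨ f-periodic m ⟩
      f m                                 ∎

    private
      window : ℤ → Carrier
      window a = ∑[ j < r ] f (a ℤ.+ + j)

    -- Moving the window by one loses f(a) and gains f(a + r), which are equal.
    window-suc : ∀ a → window (ℤ.suc a) ≈ window a
    window-suc a = begin
      ∑[ j < r ] f (ℤ.suc a ℤ.+ + j) ≈⟨ ∑-cong (upTo r) (λ j → reflexive (≡.cong f (shift j))) ⟩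
      ∑[ j < r ] f (a ℤ.+ + suc j) ≈⟨ x≈[x+y]-y (∑[ j < r ] f (a ℤ.+ + suc j)) (f a₀) ⟩
      (f a₀ + (∑[ j < r ] f (a ℤ.+ + suc j))) + - f a₀ ≡⟨ ≡.cong (λ s → s + - f a₀) (∑<-suc r (λ j → f (a ℤ.+ + j))) ⟨
      (∑[ j < suc r ] f (a ℤ.+ + j)) + - f a₀                ≈⟨ +-congʳ (∑<-last r (λ j → f (a ℤ.+ + j))) ⟩
      (window a + f (a ℤ.+ + r)) + - f a₀ ≈⟨ +-congʳ (+-congˡ (trans (f-periodic a) (reflexive (≡.cong f (≡.sym (ℤₚ.+-identityʳ a)))))) ⟩
      (window a + f a₀) + - f a₀ ≈⟨ trans (+-assoc (window a) (f a₀) (- f a₀)) (trans (+-congˡ (-‿inverseʳ (f a₀))) (+-identityʳ (window a))) ⟩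
      window a                                               ∎
      where
      a₀ = a ℤ.+ + 0
      shift : ∀ j → ℤ.suc a ℤ.+ + j ≡ a ℤ.+ + suc j
      shift j = ≡.trans (≡.cong (ℤ._+ + j) (ℤₚ.+-comm (+ 1) a)) (ℤₚ.+-assoc a (+ 1) (+ j))
      x≈[x+y]-y : ∀ x y → x ≈ (y + x) + - y
      x≈[x+y]-y x y = sym (trans (+-congʳ (+-comm y x)) (trans (+-assoc x y (- y)) (trans (+-congˡ (-‿inverseʳ y)) (+-identityʳ x))))

    window-shift : ∀ a → ∑[ j < r ] f (a ℤ.+ + j) ≈ ∑[ j < r ] f (+ j)
    window-shift (+ zero)       = ∑-cong (upTo r) λ j → reflexive (≡.cong f (ℤₚ.+-identityˡ (+ j)))
    window-shift (+ suc n)      = trans (window-suc (+ n)) (window-shift (+ n))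
    window-shift -[1+ zero ]    = trans (sym (window-suc -[1+ 0 ])) (window-shift (+ 0))
    window-shift -[1+ suc n ]   = trans (sym (window-suc -[1+ suc n ])) (window-shift -[1+ n ])

  -- Induction on q: the outermost terms are those at -(q + 1) and q + 1, and between them lies the
  -- sum for q.
  ∑-symmetric : ∀ q (f : ℤ → Carrier) → ∑[ j < suc (2 ℕ.* q) ] f (ℤ.- (+ q) ℤ.+ + j) ≈ f (+ 0) + (∑[ j < q ] (f (+ suc j) + f -[1+ j ]))
  ∑-symmetric zero    f = refl
  ∑-symmetric (suc q) f = begin
    ∑[ j < suc (2 ℕ.* suc q) ] f (-q-1 ℤ.+ + j)
      ≡⟨ ≡.cong (λ n → ∑[ j < suc n ] f (-q-1 ℤ.+ + j)) (ℕₚ.*-suc 2 q) ⟩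
    ∑[ j < suc (suc (suc (2 ℕ.* q))) ] f (-q-1 ℤ.+ + j)
      ≡⟨ ∑<-suc (suc (suc (2 ℕ.* q))) (λ j → f (-q-1 ℤ.+ + j)) ⟩
    f (-q-1 ℤ.+ + 0) + (∑[ j < suc (suc (2 ℕ.* q)) ] f (-q-1 ℤ.+ + suc j))
      ≈⟨ +-cong (reflexive (≡.cong f (ℤₚ.+-identityʳ -q-1))) (∑<-last (suc (2 ℕ.* q)) (λ j → f (-q-1 ℤ.+ + suc j))) ⟩
    f -q-1 + ((∑[ j < suc (2 ℕ.* q) ] f (-q-1 ℤ.+ + suc j)) + f (-q-1 ℤ.+ + suc (suc (2 ℕ.* q))))
      ≈⟨ +-congˡ (+-cong (trans (∑-cong (upTo (suc (2 ℕ.* q))) (λ j → reflexive (≡.cong f (shift j)))) (∑-symmetric q f)) (reflexive (≡.cong f top))) ⟩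
    f -q-1 + ((f (+ 0) + S) + f (+ suc q))
      ≈⟨ trans (+-comm (f -q-1) _) (trans (+-assoc _ (f (+ suc q)) (f -q-1)) (+-assoc (f (+ 0)) S _)) ⟩
    f (+ 0) + (S + (f (+ suc q) + f -q-1))
      ≈⟨ +-congˡ (∑<-last q (λ j → f (+ suc j) + f -[1+ j ])) ⟨
    f (+ 0) + (∑[ j < suc q ] (f (+ suc j) + f -[1+ j ])) ∎
    where
    -q-1 = -[1+ q ]
    S = ∑[ j < q ] (f (+ suc j) + f -[1+ j ])
    shift : ∀ j → -q-1 ℤ.+ + suc j ≡ ℤ.- (+ q) ℤ.+ + j
    shift j = ≡.trans (ℤₚ.[1+m]⊖[1+n]≡m⊖n j q) (≡.sym (ℤₚ.-m+n≡n⊖m q j))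
    top : -q-1 ℤ.+ + suc (suc (2 ℕ.* q)) ≡ + suc q
    top = ≡.trans (ℤₚ.⊖-≥ (ℕ.s≤s (ℕₚ.≤-trans (ℕₚ.m≤m+n q (q ℕ.+ 0)) (ℕₚ.n≤1+n _))))
      (≡.cong +_ (≡.trans (≡.cong (_∸ q) (≡.sym (ℕₚ.+-suc q (q ℕ.+ 0)))) (≡.trans (ℕₚ.m+n∸m≡n q (suc (q ℕ.+ 0))) (≡.cong suc (ℕₚ.+-identityʳ q)))))

-- Inequality

-- The inequality is proved over this signature because the operations on Cauchy
-- sequences would unfold in every unification problem.
record ComplexNumbers : Set₁ where

  field
    ℝ-ring ℂ-ring : CommutativeRing 0ℓ 0ℓ

  open CommutativeRing ℝ-ring public
  open CommutativeRing ℂ-ring public using () renaming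
    ( Carrier to ℂ; _≈_ to _≈ᶜ_; _+_ to _+ᶜ_; _*_ to _*ᶜ_; -_ to -ᶜ_; 0# to 0ᶜ; 1# to 1ᶜ )
  module ℂ = CommutativeRing ℂ-ring

  infix 4 _≤_

  field
    _≤_             : Rel Carrier 0ℓ
    ≤-isPreorder    : IsPreorder _≈_ _≤_
    +-mono-≤        : ∀ {x y u v} → x ≤ y → u ≤ v → x + u ≤ y + v
    0≤*             : ∀ {x y} → 0# ≤ x → 0# ≤ y → 0# ≤ x * y
    0≤x²            : ∀ x → 0# ≤ x * x
    square-cancel-≤ : ∀ {x y} → 0# ≤ y → x * x ≤ y * y → x ≤ y

    fromℚ         : ℚ → Carrier
    fromℚ-+       : ∀ p q → fromℚ (p ℚ.+ q) ≈ fromℚ p + fromℚ q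
    fromℚ-*       : ∀ p q → fromℚ (p ℚ.* q) ≈ fromℚ p * fromℚ q
    fromℚ-neg     : ∀ p → fromℚ (ℚ.- p) ≈ - fromℚ p
    fromℚ-0       : fromℚ 0ℚ ≈ 0#
    fromℚ-1       : fromℚ 1ℚ ≈ 1#
    fromℚ-mono-≤  : ∀ {p q} → p ℚ.≤ q → fromℚ p ≤ fromℚ q

    re         : ℂ → Carrier
    re-cong    : ∀ {z w} → z ≈ᶜ w → re z ≈ re w
    re-+       : ∀ z w → re (z +ᶜ w) ≈ re z + re w
    re-neg     : ∀ z → re (-ᶜ z) ≈ - re z
    re-0       : re 0ᶜ ≈ 0#
    re-1       : re 1ᶜ ≈ 1#
    conj       : ℂ → ℂ
    conj-cong  : ∀ {z w} → z ≈ᶜ w → conj z ≈ᶜ conj w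
    conj-+     : ∀ z w → conj (z +ᶜ w) ≈ᶜ conj z +ᶜ conj w
    conj-*     : ∀ z w → conj (z *ᶜ w) ≈ᶜ conj z *ᶜ conj w
    conj-0     : conj 0ᶜ ≈ᶜ 0ᶜ
    conj-1     : conj 1ᶜ ≈ᶜ 1ᶜ
    ∣_∣        : ℂ → Carrier
    ∣∣-cong    : ∀ {z w} → z ≈ᶜ w → ∣ z ∣ ≈ ∣ w ∣
    0≤∣∣       : ∀ z → 0# ≤ ∣ z ∣
    ∣0∣        : ∣ 0ᶜ ∣ ≈ 0#
    ∣1∣        : ∣ 1ᶜ ∣ ≈ 1#
    ∣∣≤0⇒≈0    : ∀ {z} → ∣ z ∣ ≤ 0# → z ≈ᶜ 0ᶜ
    ∣∣-*       : ∀ z w → ∣ z *ᶜ w ∣ ≈ ∣ z ∣ * ∣ w ∣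
    ∣conj∣     : ∀ z → ∣ conj z ∣ ≈ ∣ z ∣
    re≤∣∣      : ∀ z → re z ≤ ∣ z ∣
    ∣∣²-+ : ∀ z w → ∣ z +ᶜ w ∣ * ∣ z +ᶜ w ∣ ≈ ∣ z ∣ * ∣ z ∣ + ∣ w ∣ * ∣ w ∣ + (re (w *ᶜ conj z) + re (w *ᶜ conj z))

-- Ordered arithmetic, sums of reals and Cauchy's inequality

module OrderedReals (𝒞 : ComplexNumbers) where

  open ComplexNumbers 𝒞

  ≤-preorder : Preorder 0ℓ 0ℓ 0ℓ
  ≤-preorder = record { isPreorder = ≤-isPreorder }

  open IsPreorder ≤-isPreorder public using () renaming (reflexive to ≤-reflexive; refl to ≤-refl; trans to ≤-trans)

  module ≲-Reasoning where
    open import Relation.Binary.Reasoning.Preorder ≤-preorder public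

  open ≲-Reasoning

  private
    ℝ-almostCommutativeRing = ACR.fromCommutativeRing ℝ-ring

    -- Equality of reals is not decidable, so the solver normalises with rational coefficients,
    -- whose equality is; this also admits constants such as `½` in the polynomials.
    fromℚ-morphism : CommutativeRing.rawRing ℚₚ.+-*-commutativeRing ACR.-Raw-AlmostCommutative⟶ ℝ-almostCommutativeRing
    fromℚ-morphism = record
      { ⟦_⟧    = fromℚ
      ; +-homo = fromℚ-+
      ; *-homo = fromℚ-*
      ; -‿homo = fromℚ-neg
      ; 0-homo = fromℚ-0
      ; 1-homo = fromℚ-1
      }

    fromℚ-weakly-decidable : ∀ p q → Maybe (fromℚ p ≈ fromℚ q)
    fromℚ-weakly-decidable p q with p ℚₚ.≟ q
    ... | yes p≡q = just (reflexive (≡.cong fromℚ p≡q))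
    ... | no  _   = nothing

  module ℝ-Solver = RingSolver (CommutativeRing.rawRing ℚₚ.+-*-commutativeRing) ℝ-almostCommutativeRing fromℚ-morphism fromℚ-weakly-decidable

  open ℝ-Solver

  fromℕ : ℕ → Carrier
  fromℕ n = fromℚ (+ n / 1)

  0≤fromℕ : ∀ n → 0# ≤ fromℕ n
  0≤fromℕ n = ≤-trans (≤-reflexive (sym fromℚ-0)) (fromℚ-mono-≤ (0≤/ n 1))

  fromℕ-0 : fromℕ 0 ≈ 0#
  fromℕ-0 = trans (reflexive (≡.cong fromℚ 0/1≡0)) fromℚ-0

  fromℕ-1 : fromℕ 1 ≈ 1#
  fromℕ-1 = trans (reflexive (≡.cong fromℚ 1/1≡1)) fromℚ-1

  fromℕ-suc : ∀ n → fromℕ (suc n) ≈ fromℕ n + 1#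
  fromℕ-suc n = trans (reflexive (≡.cong fromℚ (/-suc n))) (trans (fromℚ-+ (+ n / 1) 1ℚ) (+-congˡ fromℚ-1))

  fromℕ-* : ∀ m n → fromℕ (m ℕ.* n) ≈ fromℕ m * fromℕ n
  fromℕ-* m n = trans (reflexive (≡.cong fromℚ (≡.sym (/-* m 1 n 1)))) (fromℚ-* (+ m / 1) (+ n / 1))

  fromℕ-mono-≤ : ∀ {m n} → m ℕ.≤ n → fromℕ m ≤ fromℕ n
  fromℕ-mono-≤ {m} {n} m≤n = fromℚ-mono-≤ (/-mono-≤ m 1 n 1 (ℕₚ.*-monoˡ-≤ 1 m≤n))

  x≤x+y : ∀ {x y} → 0# ≤ y → x ≤ x + y
  x≤x+y {x} {y} 0≤y = begin
    x       ≈⟨ +-identityʳ x ⟨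
    x + 0#  ≲⟨ +-mono-≤ ≤-refl 0≤y ⟩
    x + y   ∎

  x≤y⇒0≤y-x : ∀ {x y} → x ≤ y → 0# ≤ y + - x
  x≤y⇒0≤y-x {x} {y} x≤y = begin
    0#       ≈⟨ -‿inverseʳ x ⟨
    x + - x  ≲⟨ +-mono-≤ x≤y ≤-refl ⟩
    y + - x  ∎

  0≤y-x⇒x≤y : ∀ {x y} → 0# ≤ y + - x → x ≤ y
  0≤y-x⇒x≤y {x} {y} 0≤y-x = begin
    x              ≲⟨ x≤x+y 0≤y-x ⟩
    x + (y + - x)  ≈⟨ solve 2 (λ x y → x :+ (y :+ :- x) := y) refl x y ⟩
    y              ∎

  *-monoˡ-≤ : ∀ {x y z} → 0# ≤ x → y ≤ z → x * y ≤ x * z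
  *-monoˡ-≤ {x} {y} {z} 0≤x y≤z = 0≤y-x⇒x≤y (begin
    0#                 ≲⟨ 0≤* 0≤x (x≤y⇒0≤y-x y≤z) ⟩
    x * (z + - y)      ≈⟨ solve 3 (λ x y z → x :* (z :+ :- y) := x :* z :+ :- (x :* y)) refl x y z ⟩
    x * z + - (x * y)  ∎)

  *-monoʳ-≤ : ∀ {x y z} → 0# ≤ x → y ≤ z → y * x ≤ z * x
  *-monoʳ-≤ {x} {y} {z} 0≤x y≤z = begin
    y * x  ≈⟨ *-comm y x ⟩
    x * y  ≲⟨ *-monoˡ-≤ 0≤x y≤z ⟩
    x * z  ≈⟨ *-comm x z ⟩
    z * x  ∎

  *-mono-≤ : ∀ {x y u v} → 0# ≤ x → 0# ≤ v → x ≤ y → u ≤ v → x * u ≤ y * v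
  *-mono-≤ 0≤x 0≤v x≤y u≤v = ≤-trans (*-monoˡ-≤ 0≤x u≤v) (*-monoʳ-≤ 0≤v x≤y)

  square-mono-≤ : ∀ {x y} → 0# ≤ x → x ≤ y → x * x ≤ y * y
  square-mono-≤ 0≤x x≤y = *-mono-≤ 0≤x (≤-trans 0≤x x≤y) x≤y x≤y

  fromℕ-cancelˡ-≤ : ∀ n .{{_ : NonZero n}} {x y} → fromℕ n * x ≤ fromℕ n * y → x ≤ y
  fromℕ-cancelˡ-≤ n {x} {y} nx≤ny = begin
    x                                ≈⟨ inverse x ⟨
    fromℚ (+ 1 / n) * (fromℕ n * x) ≲⟨ *-monoˡ-≤ (≤-trans (≤-reflexive (sym fromℚ-0)) (fromℚ-mono-≤ (0≤/ 1 n))) nx≤ny ⟩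
    fromℚ (+ 1 / n) * (fromℕ n * y)  ≈⟨ inverse y ⟩
    y                                ∎
    where
    inverse : ∀ z → fromℚ (+ 1 / n) * (fromℕ n * z) ≈ z
    inverse z = trans (sym (*-assoc (fromℚ (+ 1 / n)) (fromℕ n) z)) (trans (*-congʳ (trans (*-comm _ _)
      (trans (sym (fromℚ-* (+ n / 1) (+ 1 / n))) (trans (reflexive (≡.cong fromℚ ([n/1]*[1/n]≡1 n))) fromℚ-1)))) (*-identityˡ z))

  0≤1 : 0# ≤ 1#
  0≤1 = ≤-trans (0≤x² 1#) (≤-reflexive (*-identityʳ 1#))

  open Sum ℝ-ring public renaming (∑ to ∑ʳ; ∑< to ∑ʳ<) using ()
  private module Σ = Sum ℝ-ring

  module _ {A : Set} where

    ∑-mono : ∀ (xs : List A) {f g} → (∀ x → f x ≤ g x) → ∑ʳ xs f ≤ ∑ʳ xs g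
    ∑-mono []       f≤g = ≤-refl
    ∑-mono (x ∷ xs) f≤g = +-mono-≤ (f≤g x) (∑-mono xs f≤g)

    0≤∑ : ∀ (xs : List A) {f} → (∀ x → 0# ≤ f x) → 0# ≤ ∑ʳ xs f
    0≤∑ xs 0≤f = ≤-trans (≤-reflexive (sym (Σ.∑-0 xs))) (∑-mono xs 0≤f)

    ∑-*-mono : ∀ (xs : List A) {f g c} → (∀ x → f x ≤ c * g x) → ∑ʳ xs f ≤ c * ∑ʳ xs g
    ∑-*-mono xs {f} {g} {c} f≤cg = ≤-trans (∑-mono xs f≤cg) (≤-reflexive (Σ.∑-*ˡ xs c g))

    ∑-const : ∀ (xs : List A) c → ∑ʳ xs (λ _ → c) ≈ fromℕ (length xs) * c
    ∑-const []       c = sym (trans (*-congʳ fromℕ-0) (zeroˡ c))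
    ∑-const (x ∷ xs) c = trans (+-congˡ (∑-const xs c)) (trans
      (solve 2 (λ c n → c :+ n :* c := (n :+ con 1ℚ) :* c) refl c (fromℕ (length xs)))
      (*-congʳ (trans (+-congˡ fromℚ-1) (sym (fromℕ-suc (length xs))))))

    -- The inequality 2 t f(x) ≤ t² + f(x)², that is (t - f(x))² ≥ 0, summed over the list. It
    -- controls the cross terms in `∑²≤`.
    2tf≤ : ∀ (xs : List A) t f → t * ∑ʳ xs f + t * ∑ʳ xs f ≤ fromℕ (length xs) * (t * t) + ∑ʳ xs (λ x → f x * f x)
    2tf≤ [] t f = ≤-reflexive (trans (+-cong (zeroʳ t) (zeroʳ t)) (+-congʳ (sym (trans (*-congʳ fromℕ-0) (zeroˡ (t * t))))))
    2tf≤ (x ∷ xs) t f = begin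
      t * (y + F) + t * (y + F)
        ≈⟨ solve 3 (λ t y F → t :* (y :+ F) :+ t :* (y :+ F) := (t :* F :+ t :* F) :+ (t :* y :+ t :* y)) refl t y F ⟩
      (t * F + t * F) + (t * y + t * y)
        ≲⟨ +-mono-≤ (2tf≤ xs t f) (x≤x+y (0≤x² (t + - y))) ⟩
      (n * (t * t) + Q) + ((t * y + t * y) + (t + - y) * (t + - y))
        ≈⟨ solve 4 (λ t y n Q → (n :* (t :* t) :+ Q) :+ ((t :* y :+ t :* y) :+ (t :+ :- y) :* (t :+ :- y))
                      := (n :+ con 1ℚ) :* (t :* t) :+ (y :* y :+ Q)) refl t y n Q ⟩
      (n + fromℚ 1ℚ) * (t * t) + (y * y + Q)
        ≈⟨ +-congʳ (*-congʳ (trans (+-congˡ fromℚ-1) (sym (fromℕ-suc (length xs))))) ⟩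
      fromℕ (suc (length xs)) * (t * t) + (y * y + Q) ∎
      where
      y = f x
      F = ∑ʳ xs f
      n = fromℕ (length xs)
      Q = ∑ʳ xs (λ x → f x * f x)

    -- Cauchy's inequality against the constant 1. A new entry y adds y² and the cross terms 2 y F,
    -- which `2tf≤` bounds with t = y.
    ∑²≤ : ∀ (xs : List A) f → ∑ʳ xs f * ∑ʳ xs f ≤ fromℕ (length xs) * ∑ʳ xs (λ x → f x * f x)
    ∑²≤ []       f = ≤-reflexive (trans (zeroˡ 0#) (sym (zeroʳ _)))
    ∑²≤ (x ∷ xs) f = begin
      (y + F) * (y + F)
        ≈⟨ solve 2 (λ y F → (y :+ F) :* (y :+ F) := y :* y :+ ((y :* F :+ y :* F) :+ F :* F)) refl y F ⟩
      y * y + ((y * F + y * F) + F * F)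
        ≲⟨ +-mono-≤ ≤-refl (+-mono-≤ (2tf≤ xs y f) (∑²≤ xs f)) ⟩
      y * y + ((n * (y * y) + Q) + n * Q)
        ≈⟨ solve 3 (λ y n Q → y :* y :+ ((n :* (y :* y) :+ Q) :+ n :* Q) := (n :+ con 1ℚ) :* (y :* y :+ Q)) refl y n Q ⟩
      (n + fromℚ 1ℚ) * (y * y + Q)
        ≈⟨ *-congʳ (trans (+-congˡ fromℚ-1) (sym (fromℕ-suc (length xs)))) ⟩
      fromℕ (suc (length xs)) * (y * y + Q) ∎
      where
      y = f x
      F = ∑ʳ xs f
      n = fromℕ (length xs)
      Q = ∑ʳ xs (λ x → f x * f x)

  ∑<-mono : ∀ n {f g} → (∀ j → j ℕ.< n → f j ≤ g j) → ∑ʳ< n f ≤ ∑ʳ< n g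
  ∑<-mono zero    f≤g = ≤-refl
  ∑<-mono (suc n) {f} {g} f≤g = begin
    ∑ʳ< (suc n) f            ≡⟨ Σ.∑<-suc n f ⟩
    f 0 + ∑ʳ< n (f ∘ suc)    ≲⟨ +-mono-≤ (f≤g 0 (ℕ.s≤s ℕ.z≤n)) (∑<-mono n λ j j<n → f≤g (suc j) (ℕ.s≤s j<n)) ⟩
    g 0 + ∑ʳ< n (g ∘ suc)    ≡⟨ Σ.∑<-suc n g ⟨
    ∑ʳ< (suc n) g            ∎

  ∑<-mono-range : ∀ {m n} f → m ℕ.≤ n → (∀ j → 0# ≤ f j) → ∑ʳ< m f ≤ ∑ʳ< n f
  ∑<-mono-range {m} {n} f m≤n 0≤f = begin
    ∑ʳ< m f                                            ≲⟨ x≤x+y (0≤∑ (upTo (n ∸ m)) λ j → 0≤f (m ℕ.+ j)) ⟩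
    ∑ʳ< m f + ∑ʳ< (n ∸ m) (λ j → f (m ℕ.+ j))          ≈⟨ Σ.∑<-split m (n ∸ m) f ⟨
    ∑ʳ< (m ℕ.+ (n ∸ m)) f                              ≡⟨ ≡.cong (λ k → ∑ʳ< k f) (ℕₚ.m+[n∸m]≡n m≤n) ⟩
    ∑ʳ< n f                                            ∎

  ∑-0<∣h∣≤ : ∀ N f → ∑ʳ (0<∣h∣≤ N) f ≈ ∑ʳ< N (λ j → f (+ suc j) + f -[1+ j ])
  ∑-0<∣h∣≤ N f = trans (Σ.∑-concatMap (λ j → + suc j ∷ -[1+ j ] ∷ []) (upTo N) f)
    (Σ.∑-cong (upTo N) λ j → +-congˡ (+-identityʳ (f -[1+ j ])))

  -- For even r the class of r/2 is counted twice on the right.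
  ∑-residues-≤ : ∀ r {f} → Σ.Periodic r f → (∀ k → 0# ≤ f k) → ∑ʳ< r (λ k → f (+ k)) ≤ ∑ʳ (∣k∣≤ (r ℕ./ 2)) f
  ∑-residues-≤ r {f} f-periodic 0≤f = begin
    ∑ʳ< r (λ k → f (+ k))                                      ≈⟨ Σ.window-shift f-periodic (ℤ.- (+ q)) ⟨
    ∑ʳ< r (λ j → f (ℤ.- (+ q) ℤ.+ + j)) ≲⟨ ∑<-mono-range (λ j → f (ℤ.- (+ q) ℤ.+ + j)) r≤2q+1 (λ j → 0≤f _) ⟩
    ∑ʳ< (suc (2 ℕ.* q)) (λ j → f (ℤ.- (+ q) ℤ.+ + j))          ≈⟨ Σ.∑-symmetric q f ⟩
    f (+ 0) + ∑ʳ< q (λ j → f (+ suc j) + f -[1+ j ])           ≈⟨ +-congˡ (∑-0<∣h∣≤ q f) ⟨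
    ∑ʳ (∣k∣≤ q) f                                              ∎
    where
    q = r ℕ./ 2
    r≤2q+1 : r ℕ.≤ suc (2 ℕ.* q)
    r≤2q+1 = ℕₚ.≤-trans (ℕₚ.≤-reflexive (ℕ.m≡m%n+[m/n]*n r 2))
      (ℕₚ.≤-trans (ℕₚ.+-monoˡ-≤ (q ℕ.* 2) (ℕ.s≤s⁻¹ (ℕ.m%n<n r 2))) (ℕₚ.≤-reflexive (≡.cong suc (ℕₚ.*-comm q 2))))

-- Absolute values of complex sums

module AbsoluteValue (𝒞 : ComplexNumbers) where

  open ComplexNumbers 𝒞
  open OrderedReals 𝒞
  open Sum ℂ-ring public using (Periodic) renaming (∑ to ∑ᶜ; ∑< to ∑ᶜ<)
  module Σᶜ = Sum ℂ-ring
  module Σʳ = Sum ℝ-ring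
  module ≈ᶜ-Reasoning where
    open import Relation.Binary.Reasoning.Setoid ℂ.setoid public
  open ℝ-Solver using (solve; _:+_; _:*_; _:=_; :-_; con)
  open import Algebra.Properties.Ring ℂ.ring using (-1*x≈-x; -‿distribˡ-*; -‿distribʳ-*; -‿involutive)

  ∣-z∣² : ∀ z → ∣ -ᶜ z ∣ * ∣ -ᶜ z ∣ ≈ ∣ z ∣ * ∣ z ∣
  ∣-z∣² z = trans (sym (∣∣-* (-ᶜ z) (-ᶜ z))) (trans (∣∣-cong (begin
    -ᶜ z *ᶜ -ᶜ z        ≈⟨ -‿distribˡ-* z (-ᶜ z) ⟨
    -ᶜ (z *ᶜ -ᶜ z)      ≈⟨ ℂ.-‿cong (-‿distribʳ-* z z) ⟨
    -ᶜ (-ᶜ (z *ᶜ z))    ≈⟨ -‿involutive (z *ᶜ z) ⟩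
    z *ᶜ z              ∎)) (∣∣-* z z))
    where open ≈ᶜ-Reasoning

  ∣-z∣≤∣z∣ : ∀ z → ∣ -ᶜ z ∣ ≤ ∣ z ∣
  ∣-z∣≤∣z∣ z = square-cancel-≤ (0≤∣∣ z) (≤-reflexive (∣-z∣² z))

  ∣z+w∣≤∣z∣+∣w∣ : ∀ z w → ∣ z +ᶜ w ∣ ≤ ∣ z ∣ + ∣ w ∣
  ∣z+w∣≤∣z∣+∣w∣ z w = square-cancel-≤ (≤-trans (0≤∣∣ z) (x≤x+y (0≤∣∣ w))) (begin
    ∣ z +ᶜ w ∣ * ∣ z +ᶜ w ∣                              ≈⟨ ∣∣²-+ z w ⟩
    ∣ z ∣ * ∣ z ∣ + ∣ w ∣ * ∣ w ∣ + (c + c)              ≲⟨ +-mono-≤ ≤-refl (+-mono-≤ c≤ c≤) ⟩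
    ∣ z ∣ * ∣ z ∣ + ∣ w ∣ * ∣ w ∣ + (∣ w ∣ * ∣ z ∣ + ∣ w ∣ * ∣ z ∣)
      ≈⟨ solve 2 (λ x y → x :* x :+ y :* y :+ (y :* x :+ y :* x) := (x :+ y) :* (x :+ y)) refl (∣ z ∣) (∣ w ∣) ⟩
    (∣ z ∣ + ∣ w ∣) * (∣ z ∣ + ∣ w ∣)                    ∎)
    where
    open ≲-Reasoning
    c = re (w *ᶜ conj z)
    c≤ : c ≤ ∣ w ∣ * ∣ z ∣
    c≤ = ≤-trans (re≤∣∣ (w *ᶜ conj z)) (≤-reflexive (trans (∣∣-* w (conj z)) (*-congˡ (∣conj∣ z))))

  ∣∑∣≤∑∣∣ : ∀ {A : Set} (xs : List A) f → ∣ ∑ᶜ xs f ∣ ≤ ∑ʳ xs (λ x → ∣ f x ∣)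
  ∣∑∣≤∑∣∣ []       f = ≤-reflexive ∣0∣
  ∣∑∣≤∑∣∣ (x ∷ xs) f = ≤-trans (∣z+w∣≤∣z∣+∣w∣ (f x) (∑ᶜ xs f)) (+-mono-≤ ≤-refl (∣∑∣≤∑∣∣ xs f))

  re-∑ : ∀ {A : Set} (xs : List A) f → re (∑ᶜ xs f) ≈ ∑ʳ xs (λ x → re (f x))
  re-∑ []       f = re-0
  re-∑ (x ∷ xs) f = trans (re-+ (f x) (∑ᶜ xs f)) (+-congˡ (re-∑ xs f))

  conj-∑ : ∀ {A : Set} (xs : List A) f → conj (∑ᶜ xs f) ≈ᶜ ∑ᶜ xs (λ x → conj (f x))
  conj-∑ []       f = conj-0
  conj-∑ (x ∷ xs) f = ℂ.trans (conj-+ (f x) (∑ᶜ xs f)) (ℂ.+-congˡ (conj-∑ xs f))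

  ∑-const≤ : ∀ n {f c} → (∀ j → f j ≤ c) → ∑ʳ< n f ≤ fromℕ n * c
  ∑-const≤ n {f} {c} f≤c = begin
    ∑ʳ< n f                        ≲⟨ ∑-mono (upTo n) f≤c ⟩
    ∑ʳ< n (λ _ → c)                ≈⟨ ∑-const (upTo n) c ⟩
    fromℕ (length (upTo n)) * c    ≡⟨ ≡.cong (λ k → fromℕ k * c) (Listₚ.length-upTo n) ⟩
    fromℕ n * c                    ∎
    where open ≲-Reasoning

  -- The modulus r enters ℂ only as a sum of r ones (`order`); its absolute value is bounded from
  -- below through the real part.
  n≤∣∑1∣ : ∀ n → fromℕ n ≤ ∣ ∑ᶜ< n (λ _ → 1ᶜ) ∣
  n≤∣∑1∣ n = begin
    fromℕ n                          ≈⟨ *-identityʳ (fromℕ n) ⟨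
    fromℕ n * 1#                     ≡⟨ ≡.cong (λ k → fromℕ k * 1#) (Listₚ.length-upTo n) ⟨
    fromℕ (length (upTo n)) * 1#     ≈⟨ ∑-const (upTo n) 1# ⟨
    ∑ʳ< n (λ _ → 1#)                 ≈⟨ Σʳ.∑-cong (upTo n) (λ _ → re-1) ⟨
    ∑ʳ< n (λ _ → re 1ᶜ)              ≈⟨ re-∑ (upTo n) (λ _ → 1ᶜ) ⟨
    re (∑ᶜ< n (λ _ → 1ᶜ))            ≲⟨ re≤∣∣ (∑ᶜ< n (λ _ → 1ᶜ)) ⟩
    ∣ ∑ᶜ< n (λ _ → 1ᶜ) ∣             ∎
    where open ≲-Reasoning

  ∣z∣≤∣w*z∣ : ∀ {z w} → 1# ≤ ∣ w ∣ → ∣ z ∣ ≤ ∣ w *ᶜ z ∣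
  ∣z∣≤∣w*z∣ {z} {w} 1≤∣w∣ = begin
    ∣ z ∣            ≈⟨ *-identityˡ ∣ z ∣ ⟨
    1# * ∣ z ∣       ≲⟨ *-monoʳ-≤ (0≤∣∣ z) 1≤∣w∣ ⟩
    ∣ w ∣ * ∣ z ∣    ≈⟨ ∣∣-* w z ⟨
    ∣ w *ᶜ z ∣       ∎
    where open ≲-Reasoning

  -- Roots of unity and incomplete sums

  module RootsOfUnity
    (r : ℕ) .{{_ : NonZero r}} (χ : ℤ → ℂ)
    (χ-+ : ∀ i j → χ (i ℤ.+ j) ≈ᶜ χ i *ᶜ χ j) (χ-0 : χ (+ 0) ≈ᶜ 1ᶜ) (χ-r : χ (+ r) ≈ᶜ 1ᶜ)
    (χ-conj : ∀ j → conj (χ j) ≈ᶜ χ (ℤ.- j))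
    -- The two conditions place j/r in [1/4, 1/2]. This is the one quantitative fact on e(x) behind
    -- the bounds for geometric sums.
    (re-χ≤½ : ∀ j → r ℕ.≤ 4 ℕ.* j → 2 ℕ.* j ℕ.≤ r → re (χ (+ j)) ≤ fromℚ ½)
    where

    ∣χ∣² : ∀ j → ∣ χ j ∣ * ∣ χ j ∣ ≈ 1#
    ∣χ∣² j = trans (*-congˡ (sym (∣conj∣ (χ j)))) (trans (sym (∣∣-* (χ j) (conj (χ j)))) (trans (∣∣-cong (begin
      χ j *ᶜ conj (χ j)      ≈⟨ ℂ.*-congˡ (χ-conj j) ⟩
      χ j *ᶜ χ (ℤ.- j)       ≈⟨ χ-+ j (ℤ.- j) ⟨
      χ (j ℤ.+ ℤ.- j)        ≡⟨ ≡.cong χ (ℤₚ.+-inverseʳ j) ⟩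
      χ (+ 0)                ≈⟨ χ-0 ⟩
      1ᶜ                     ∎)) ∣1∣))
      where open ≈ᶜ-Reasoning

    ∣χ∣≤1 : ∀ j → ∣ χ j ∣ ≤ 1#
    ∣χ∣≤1 j = square-cancel-≤ 0≤1 (≤-reflexive (trans (∣χ∣² j) (sym (*-identityʳ 1#))))

    infix 8 1-χ_

    1-χ_ : ℤ → ℂ
    1-χ j = 1ᶜ +ᶜ -ᶜ χ j

    ∣1-χ∣≤2 : ∀ j → ∣ 1-χ j ∣ ≤ 1# + 1#
    ∣1-χ∣≤2 j = ≤-trans (∣z+w∣≤∣z∣+∣w∣ 1ᶜ (-ᶜ χ j)) (+-mono-≤ (≤-reflexive ∣1∣) (≤-trans (∣-z∣≤∣z∣ (χ j)) (∣χ∣≤1 j)))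

    -- For |ω| = 1 the law of cosines gives |1 - ω|² = 2 - 2 Re ω, and Re ω ≤ 1/2 makes this at
    -- least 1.
    1≤∣1-χ∣ : ∀ j → r ℕ.≤ 4 ℕ.* j → 2 ℕ.* j ℕ.≤ r → 1# ≤ ∣ 1-χ (+ j) ∣
    1≤∣1-χ∣ j r≤4j 2j≤r = square-cancel-≤ (0≤∣∣ (1-χ (+ j))) (begin
      1# * 1#
        ≈⟨ *-cong fromℚ-1 fromℚ-1 ⟨
      fromℚ 1ℚ * fromℚ 1ℚ
        ≈⟨ solve 0 (con 1ℚ :* con 1ℚ := con 1ℚ :+ con 1ℚ :+ (:- con ½ :+ :- con ½)) refl ⟩
      fromℚ 1ℚ + fromℚ 1ℚ + (- fromℚ ½ + - fromℚ ½)
        ≲⟨ +-mono-≤ (≤-reflexive (+-cong (trans fromℚ-1 (sym ∣1∣²)) (trans fromℚ-1 (sym (trans (∣-z∣² ω) (∣χ∣² (+ j))))))) (+-mono-≤ -½≤ -½≤) ⟩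
      ∣ 1ᶜ ∣ * ∣ 1ᶜ ∣ + ∣ -ᶜ ω ∣ * ∣ -ᶜ ω ∣ + (re (-ᶜ ω *ᶜ conj 1ᶜ) + re (-ᶜ ω *ᶜ conj 1ᶜ))
        ≈⟨ ∣∣²-+ 1ᶜ (-ᶜ ω) ⟨
      ∣ 1-χ (+ j) ∣ * ∣ 1-χ (+ j) ∣ ∎)
      where
      open ≲-Reasoning
      ω = χ (+ j)
      ∣1∣² : ∣ 1ᶜ ∣ * ∣ 1ᶜ ∣ ≈ 1#
      ∣1∣² = trans (*-cong ∣1∣ ∣1∣) (*-identityʳ 1#)
      -½≤ : - fromℚ ½ ≤ re (-ᶜ ω *ᶜ conj 1ᶜ)
      -½≤ = 0≤y-x⇒x≤y (begin
        0#                                            ≲⟨ x≤y⇒0≤y-x (re-χ≤½ j r≤4j 2j≤r) ⟩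
        fromℚ ½ + - re ω ≈⟨ solve 2 (λ a b → a :+ :- b := :- b :+ :- (:- a)) refl (fromℚ ½) (re ω) ⟩
        - re ω + - - fromℚ ½ ≈⟨ +-congʳ (trans (re-cong (ℂ.trans (ℂ.*-congˡ conj-1) (ℂ.*-identityʳ (-ᶜ ω)))) (re-neg ω)) ⟨
        re (-ᶜ ω *ᶜ conj 1ᶜ) + - - fromℚ ½            ∎)

    χ-periodic : Periodic r χ
    χ-periodic m = ℂ.trans (χ-+ m (+ r)) (ℂ.trans (ℂ.*-congˡ χ-r) (ℂ.*-identityʳ (χ m)))

    χ-r* : ∀ n → χ (+ r ℤ.* + n) ≈ᶜ 1ᶜ
    χ-r* n = begin
      χ (+ r ℤ.* + n)           ≡⟨ ≡.cong χ (≡.trans (ℤₚ.*-comm (+ r) (+ n)) (≡.sym (ℤₚ.pos-* n r))) ⟩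
      χ (+ (n ℕ.* r))           ≡⟨ ≡.cong χ (ℤₚ.+-identityˡ (+ (n ℕ.* r))) ⟨
      χ (+ 0 ℤ.+ + (n ℕ.* r))   ≈⟨ Σᶜ.periodic-* χ-periodic n (+ 0) ⟩
      χ (+ 0)                   ≈⟨ χ-0 ⟩
      1ᶜ                        ∎
      where open ≈ᶜ-Reasoning

    χ-periodic-* : ∀ k n → χ ((k ℤ.+ + r) ℤ.* + n) ≈ᶜ χ (k ℤ.* + n)
    χ-periodic-* k n = begin
      χ ((k ℤ.+ + r) ℤ.* + n)               ≡⟨ ≡.cong χ (ℤₚ.*-distribʳ-+ (+ n) k (+ r)) ⟩
      χ (k ℤ.* + n ℤ.+ + r ℤ.* + n)         ≈⟨ χ-+ (k ℤ.* + n) (+ r ℤ.* + n) ⟩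
      χ (k ℤ.* + n) *ᶜ χ (+ r ℤ.* + n)      ≈⟨ ℂ.*-congˡ (χ-r* n) ⟩
      χ (k ℤ.* + n) *ᶜ 1ᶜ                   ≈⟨ ℂ.*-identityʳ (χ (k ℤ.* + n)) ⟩
      χ (k ℤ.* + n)                         ∎
      where open ≈ᶜ-Reasoning

    geometric : ℕ → ℤ → ℂ
    geometric L k = ∑ᶜ< L (λ j → χ (k ℤ.* + j))

    ∣geometric∣≤L : ∀ L k → ∣ geometric L k ∣ ≤ fromℕ L
    ∣geometric∣≤L L k = begin
      ∣ geometric L k ∣                        ≲⟨ ∣∑∣≤∑∣∣ (upTo L) (λ j → χ (k ℤ.* + j)) ⟩
      ∑ʳ< L (λ j → ∣ χ (k ℤ.* + j) ∣)          ≲⟨ ∑-const≤ L (λ j → ∣χ∣≤1 (k ℤ.* + j)) ⟩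
      fromℕ L * 1#                             ≈⟨ *-identityʳ (fromℕ L) ⟩
      fromℕ L                                  ∎
      where open ≲-Reasoning

    geometric-telescope : ∀ k L → 1-χ k *ᶜ geometric L k ≈ᶜ 1-χ (k ℤ.* + L)
    geometric-telescope k zero = begin
      1-χ k *ᶜ 0ᶜ             ≈⟨ ℂ.zeroʳ (1-χ k) ⟩
      0ᶜ                      ≈⟨ ℂ.-‿inverseʳ 1ᶜ ⟨
      1ᶜ +ᶜ -ᶜ 1ᶜ             ≈⟨ ℂ.+-congˡ (ℂ.-‿cong χ-0) ⟨
      1-χ (+ 0)               ≡⟨ ≡.cong 1-χ_ (ℤₚ.*-zeroʳ k) ⟨
      1-χ (k ℤ.* + 0)         ∎
      where open ≈ᶜ-Reasoning
    geometric-telescope k (suc L) = begin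
      1-χ k *ᶜ geometric (suc L) k                    ≈⟨ ℂ.*-congˡ (Σᶜ.∑<-last L (λ j → χ (k ℤ.* + j))) ⟩
      1-χ k *ᶜ (geometric L k +ᶜ χL)                  ≈⟨ ℂ.distribˡ (1-χ k) (geometric L k) χL ⟩
      1-χ k *ᶜ geometric L k +ᶜ 1-χ k *ᶜ χL           ≈⟨ ℂ.+-cong (geometric-telescope k L) expand ⟩
      (1ᶜ +ᶜ -ᶜ χL) +ᶜ (χL +ᶜ -ᶜ χ (k ℤ.* + suc L))   ≈⟨ ℂ.+-assoc 1ᶜ (-ᶜ χL) _ ⟩
      1ᶜ +ᶜ (-ᶜ χL +ᶜ (χL +ᶜ -ᶜ χ (k ℤ.* + suc L)))   ≈⟨ ℂ.+-congˡ (ℂ.sym (ℂ.+-assoc (-ᶜ χL) χL _)) ⟩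
      1ᶜ +ᶜ (-ᶜ χL +ᶜ χL +ᶜ -ᶜ χ (k ℤ.* + suc L)) ≈⟨ ℂ.+-congˡ (ℂ.trans (ℂ.+-congʳ (ℂ.-‿inverseˡ χL)) (ℂ.+-identityˡ _)) ⟩
      1-χ (k ℤ.* + suc L)                             ∎
      where
      open ≈ᶜ-Reasoning
      χL = χ (k ℤ.* + L)
      expand : 1-χ k *ᶜ χL ≈ᶜ χL +ᶜ -ᶜ χ (k ℤ.* + suc L)
      expand = begin
        (1ᶜ +ᶜ -ᶜ χ k) *ᶜ χL           ≈⟨ ℂ.distribʳ χL 1ᶜ (-ᶜ χ k) ⟩
        1ᶜ *ᶜ χL +ᶜ -ᶜ χ k *ᶜ χL       ≈⟨ ℂ.+-cong (ℂ.*-identityˡ χL) (ℂ.sym (-‿distribˡ-* (χ k) χL)) ⟩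
        χL +ᶜ -ᶜ (χ k *ᶜ χL)           ≈⟨ ℂ.+-congˡ (ℂ.-‿cong (χ-+ k (k ℤ.* + L))) ⟨
        χL +ᶜ -ᶜ χ (k ℤ.+ k ℤ.* + L)   ≡⟨ ≡.cong (λ m → χL +ᶜ -ᶜ χ m) (≡.sym (ℤₚ.*-suc k (+ L))) ⟩
        χL +ᶜ -ᶜ χ (k ℤ.* + suc L)     ∎

    -- Used with n such that k n / r lies in [1/4, 1/2], because then |1 - χ (k n)| ≥ 1.
    geometric-multiple : ∀ k n L → 1-χ (k ℤ.* + n) *ᶜ geometric L k ≈ᶜ geometric n k *ᶜ 1-χ (k ℤ.* + L)
    geometric-multiple k n L = begin
      1-χ (k ℤ.* + n) *ᶜ geometric L k             ≈⟨ ℂ.*-congʳ (geometric-telescope k n) ⟨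
      1-χ k *ᶜ geometric n k *ᶜ geometric L k      ≈⟨ ℂ.*-congʳ (ℂ.*-comm (1-χ k) (geometric n k)) ⟩
      geometric n k *ᶜ 1-χ k *ᶜ geometric L k      ≈⟨ ℂ.*-assoc (geometric n k) (1-χ k) (geometric L k) ⟩
      geometric n k *ᶜ (1-χ k *ᶜ geometric L k)    ≈⟨ ℂ.*-congˡ (geometric-telescope k L) ⟩
      geometric n k *ᶜ 1-χ (k ℤ.* + L)             ∎
      where open ≈ᶜ-Reasoning

    -- In `geometric-multiple` the sum of n terms is at most n and the last factor at most 2, while
    -- the factor 1 - χ(k n) only enlarges the left side. This takes the place of a lower bound for
    -- the sine.
    ∣geometric∣≤2n : ∀ k n L → 1# ≤ ∣ 1-χ (k ℤ.* + n) ∣ → ∣ geometric L k ∣ ≤ fromℕ n * (1# + 1#)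
    ∣geometric∣≤2n k n L 1≤ = begin
      ∣ geometric L k ∣                                 ≲⟨ ∣z∣≤∣w*z∣ 1≤ ⟩
      ∣ 1-χ (k ℤ.* + n) *ᶜ geometric L k ∣              ≈⟨ ∣∣-cong (geometric-multiple k n L) ⟩
      ∣ geometric n k *ᶜ 1-χ (k ℤ.* + L) ∣              ≈⟨ ∣∣-* (geometric n k) (1-χ (k ℤ.* + L)) ⟩
      ∣ geometric n k ∣ * ∣ 1-χ (k ℤ.* + L) ∣ ≲⟨ *-mono-≤ (0≤∣∣ (geometric n k)) (≤-trans 0≤1 (x≤x+y 0≤1)) (∣geometric∣≤L n k) (∣1-χ∣≤2 (k ℤ.* + L)) ⟩
      fromℕ n * (1# + 1#)                               ∎
      where open ≲-Reasoning

    -- For L = r the right side of `geometric-multiple` vanishes, and the factor 1 - χ(l n) on the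
    -- left can be cancelled because its absolute value is at least 1.
    geometric-r≈0 : ∀ l n → 1# ≤ ∣ 1-χ (+ l ℤ.* + n) ∣ → geometric r (+ l) ≈ᶜ 0ᶜ
    geometric-r≈0 l n 1≤ = ∣∣≤0⇒≈0 (begin
      ∣ geometric r (+ l) ∣                                  ≲⟨ ∣z∣≤∣w*z∣ 1≤ ⟩
      ∣ 1-χ (+ l ℤ.* + n) *ᶜ geometric r (+ l) ∣             ≈⟨ ∣∣-cong (geometric-multiple (+ l) n r) ⟩
      ∣ geometric n (+ l) *ᶜ 1-χ (+ l ℤ.* + r) ∣ ≈⟨ ∣∣-cong (ℂ.trans (ℂ.*-congˡ (ℂ.trans (ℂ.+-congˡ (ℂ.-‿cong χ-l*r)) (ℂ.-‿inverseʳ 1ᶜ))) (ℂ.zeroʳ (geometric n (+ l)))) ⟩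
      ∣ 0ᶜ ∣                                                 ≈⟨ ∣0∣ ⟩
      0#                                                     ∎)
      where
      open ≲-Reasoning
      χ-l*r : χ (+ l ℤ.* + r) ≈ᶜ 1ᶜ
      χ-l*r = ℂ.trans (ℂ.reflexive (≡.cong χ (ℤₚ.*-comm (+ l) (+ r)))) (χ-r* l)

    module _ (l : ℕ) .{{_ : NonZero l}} (2l≤r : 2 ℕ.* l ℕ.≤ r) where

      private
        instance
          2l≢0 : NonZero (2 ℕ.* l)
          2l≢0 = ℕₚ.m*n≢0 2 l
        -- The largest n with l n/r ≤ 1/2. As n ≥ 1, the remainder of r modulo 2 l is below 2 l n,
        -- so r ≤ 4 l n and l n/r ≥ 1/4.
        n = r ℕ./ (2 ℕ.* l)
        n*2l≤r : n ℕ.* (2 ℕ.* l) ℕ.≤ r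
        n*2l≤r = ℕ.m/n*n≤m r (2 ℕ.* l)
        1≤n : 1 ℕ.≤ n
        1≤n = ℕ.m≥n⇒m/n>0 2l≤r
        r≤2n*2l : r ℕ.≤ 2 ℕ.* (n ℕ.* (2 ℕ.* l))
        r≤2n*2l = begin
          r                                                  ≡⟨ ℕ.m≡m%n+[m/n]*n r (2 ℕ.* l) ⟩
          r ℕ.% (2 ℕ.* l) ℕ.+ n ℕ.* (2 ℕ.* l) ≤⟨ ℕₚ.+-monoˡ-≤ (n ℕ.* (2 ℕ.* l)) (ℕₚ.≤-trans (ℕₚ.<⇒≤ (ℕ.m%n<n r (2 ℕ.* l)))
                                                                  (ℕₚ.≤-trans (ℕₚ.≤-reflexive (≡.sym (ℕₚ.*-identityˡ (2 ℕ.* l)))) (ℕₚ.*-monoˡ-≤ (2 ℕ.* l) 1≤n))) ⟩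
          n ℕ.* (2 ℕ.* l) ℕ.+ n ℕ.* (2 ℕ.* l) ≡⟨ ≡.cong (n ℕ.* (2 ℕ.* l) ℕ.+_) (≡.sym (ℕₚ.+-identityʳ _)) ⟩
          2 ℕ.* (n ℕ.* (2 ℕ.* l))                            ∎
          where open ℕₚ.≤-Reasoning

        4*[l*n]≡ : 4 ℕ.* (l ℕ.* n) ≡ 2 ℕ.* (n ℕ.* (2 ℕ.* l))
        4*[l*n]≡ = ≡.trans (ℕₚ.*-assoc 2 2 (l ℕ.* n)) (≡.cong (2 ℕ.*_) 2*[l*n]≡)
          where
          2*[l*n]≡ : 2 ℕ.* (l ℕ.* n) ≡ n ℕ.* (2 ℕ.* l)
          2*[l*n]≡ = ≡.trans (≡.sym (ℕₚ.*-assoc 2 l n)) (ℕₚ.*-comm (2 ℕ.* l) n)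
        1≤∣1-χln∣ : 1# ≤ ∣ 1-χ (+ l ℤ.* + n) ∣
        1≤∣1-χln∣ = ≡.subst (λ m → 1# ≤ ∣ 1-χ m ∣) (ℤₚ.pos-* l n) (1≤∣1-χ∣ (l ℕ.* n)
          (ℕₚ.≤-trans r≤2n*2l (ℕₚ.≤-reflexive (≡.sym 4*[l*n]≡)))
          (ℕₚ.≤-trans (ℕₚ.≤-reflexive (≡.trans (≡.sym (ℕₚ.*-assoc 2 l n)) (ℕₚ.*-comm (2 ℕ.* l) n))) n*2l≤r))

      geometric-r-pos : geometric r (+ l) ≈ᶜ 0ᶜ
      geometric-r-pos = geometric-r≈0 l n 1≤∣1-χln∣

      -- The choice of n gives 2 n ≤ r/l. The bound is written as r times 1/l so as to match r times
      -- `weight`.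
      ∣geometric∣≤r/l : ∀ L → ∣ geometric L (+ l) ∣ ≤ fromℚ ((+ r / 1) ℚ.* (+ 1 / l))
      ∣geometric∣≤r/l L = begin
        ∣ geometric L (+ l) ∣                  ≲⟨ ∣geometric∣≤2n (+ l) n L 1≤∣1-χln∣ ⟩
        fromℕ n * (1# + 1#)                    ≈⟨ *-congˡ (trans (fromℕ-suc 1) (+-congʳ fromℕ-1)) ⟨
        fromℕ n * fromℕ 2                      ≈⟨ fromℕ-* n 2 ⟨
        fromℕ (n ℕ.* 2) ≲⟨ fromℚ-mono-≤ (≡.subst (+ (n ℕ.* 2) / 1 ℚ.≤_) (≡.sym (/-* r 1 1 l {{_}} {{_}} {{1*l≢0}}))
                                                    (/-mono-≤ (n ℕ.* 2) 1 (r ℕ.* 1) (1 ℕ.* l) {{_}} {{1*l≢0}} n2l≤)) ⟩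
        fromℚ ((+ r / 1) ℚ.* (+ 1 / l))        ∎
        where
        open ≲-Reasoning
        1*l≢0 : NonZero (1 ℕ.* l)
        1*l≢0 = ℕₚ.m*n≢0 1 l
        n2l≤ : n ℕ.* 2 ℕ.* (1 ℕ.* l) ℕ.≤ r ℕ.* 1 ℕ.* 1
        n2l≤ = ℕₚ.≤-trans (ℕₚ.≤-reflexive (≡.trans (≡.cong (n ℕ.* 2 ℕ.*_) (ℕₚ.*-identityˡ l)) (ℕₚ.*-assoc n 2 l)))
          (ℕₚ.≤-trans n*2l≤r (ℕₚ.≤-reflexive (≡.sym (≡.trans (ℕₚ.*-identityʳ (r ℕ.* 1)) (ℕₚ.*-identityʳ r)))))

    geometric-neg : ∀ L k → geometric L (ℤ.- k) ≈ᶜ conj (geometric L k)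
    geometric-neg L k = ℂ.sym (ℂ.trans (conj-∑ (upTo L) (λ j → χ (k ℤ.* + j))) (Σᶜ.∑-cong (upTo L) λ j →
      ℂ.trans (χ-conj (k ℤ.* + j)) (ℂ.reflexive (≡.cong χ (ℤₚ.neg-distribˡ-* k (+ j))))))

    -- `geometric-r-pos` covers 0 < l ≤ r/2. Conjugation turns -l into such an l; if l ≥ r/2, the
    -- period r turns -l into r - l.
    geometric-r-neg : ∀ l → 0 ℕ.< l → l ℕ.< r → geometric r (ℤ.- (+ l)) ≈ᶜ 0ᶜ
    geometric-r-neg l 0<l l<r = [ small , large ]′ (ℕₚ.≤-total (2 ℕ.* l) r)
      where
      small : 2 ℕ.* l ℕ.≤ r → geometric r (ℤ.- (+ l)) ≈ᶜ 0ᶜ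
      small 2l≤r = ℂ.trans (geometric-neg r (+ l)) (ℂ.trans (conj-cong (geometric-r-pos l {{ℕ.>-nonZero 0<l}} 2l≤r)) conj-0)
      -l+r≡ : ℤ.- (+ l) ℤ.+ + r ≡ + (r ∸ l)
      -l+r≡ = ≡.trans (ℤₚ.-m+n≡n⊖m l r) (ℤₚ.⊖-≥ (ℕₚ.<⇒≤ l<r))
      large : r ℕ.≤ 2 ℕ.* l → geometric r (ℤ.- (+ l)) ≈ᶜ 0ᶜ
      large r≤2l = begin
        geometric r (ℤ.- (+ l))             ≈⟨ Σᶜ.∑-cong (upTo r) (χ-periodic-* (ℤ.- (+ l))) ⟨
        geometric r (ℤ.- (+ l) ℤ.+ + r)     ≡⟨ ≡.cong (geometric r) -l+r≡ ⟩
        geometric r (+ (r ∸ l)) ≈⟨ geometric-r-pos (r ∸ l) {{ℕ.>-nonZero (ℕₚ.m<n⇒0<n∸m l<r)}} 2[r-l]≤r ⟩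
        0ᶜ                                  ∎
        where
        open ≈ᶜ-Reasoning
        2[r-l]≤r : 2 ℕ.* (r ∸ l) ℕ.≤ r
        2[r-l]≤r = ℕₚ.≤-trans (ℕₚ.≤-reflexive (ℕₚ.*-distribˡ-∸ 2 r l)) (ℕₚ.≤-trans (ℕₚ.∸-monoʳ-≤ (2 ℕ.* r) r≤2l)
          (ℕₚ.≤-reflexive (≡.trans (≡.cong (_∸ r) (≡.cong (r ℕ.+_) (ℕₚ.+-identityʳ r))) (ℕₚ.m+n∸m≡n r r))))

    -- Fourier inversion and completion of sums

    transform : (ℤ → ℂ) → ℤ → ℂ
    transform g k = ∑ᶜ< r (λ l → g (+ l) *ᶜ χ (ℤ.- (k ℤ.* + l)))

    order : ℂ
    order = ∑ᶜ< r (λ _ → 1ᶜ)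

    module _ {g : ℤ → ℂ} (g-periodic : Periodic r g) where

      transform-periodic : Periodic r (transform g)
      transform-periodic k = Σᶜ.∑-cong (upTo r) λ l → ℂ.*-congˡ (begin
        χ (ℤ.- ((k ℤ.+ + r) ℤ.* + l))          ≈⟨ χ-conj _ ⟨
        conj (χ ((k ℤ.+ + r) ℤ.* + l))         ≈⟨ conj-cong (χ-periodic-* k l) ⟩
        conj (χ (k ℤ.* + l))                   ≈⟨ χ-conj _ ⟩
        χ (ℤ.- (k ℤ.* + l))                    ∎)
        where open ≈ᶜ-Reasoning

      -- After the sums are exchanged, the summand P(l) = g(l) ∑ₖ χ((m - l) k) is periodic in l, so
      -- the summation may start at l = m. There the first term is r g(m), and orthogonality removes
      -- the others.
      inversion : ∀ m → ∑ᶜ< r (λ k → transform g (+ k) *ᶜ χ (+ k ℤ.* m)) ≈ᶜ order *ᶜ g m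
      inversion m = begin
        ∑ᶜ< r (λ k → transform g (+ k) *ᶜ χ (+ k ℤ.* m))
          ≈⟨ Σᶜ.∑-cong (upTo r) (λ k → ℂ.trans (ℂ.sym (Σᶜ.∑-*ʳ (upTo r) (χ (+ k ℤ.* m)) (λ l → g (+ l) *ᶜ χ (ℤ.- (+ k ℤ.* + l)))))
               (Σᶜ.∑-cong (upTo r) λ l → ℂ.trans (ℂ.*-assoc _ _ _) (ℂ.*-congˡ (combine k l)))) ⟩
        ∑ᶜ< r (λ k → ∑ᶜ< r (λ l → g (+ l) *ᶜ χ ((m ℤ.+ ℤ.- (+ l)) ℤ.* + k)))
          ≈⟨ Σᶜ.∑-swap (upTo r) (upTo r) (λ k l → g (+ l) *ᶜ χ ((m ℤ.+ ℤ.- (+ l)) ℤ.* + k)) ⟩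
        ∑ᶜ< r (λ l → ∑ᶜ< r (λ k → g (+ l) *ᶜ χ ((m ℤ.+ ℤ.- (+ l)) ℤ.* + k)))
          ≈⟨ Σᶜ.∑-cong (upTo r) (λ l → Σᶜ.∑-*ˡ (upTo r) (g (+ l)) (λ k → χ ((m ℤ.+ ℤ.- (+ l)) ℤ.* + k))) ⟩
        ∑ᶜ< r (λ l → P (+ l))
          ≈⟨ Σᶜ.window-shift P-periodic m ⟨
        ∑ᶜ< r (λ l → P (m ℤ.+ + l))
          ≈⟨ Σᶜ.∑<-first r (λ l → P (m ℤ.+ + l)) (λ l 0<l l<r → ℂ.trans (ℂ.*-congˡ (ℂ.trans
               (ℂ.reflexive (≡.cong (geometric r) (m-[m+l] (+ l)))) (geometric-r-neg l 0<l l<r))) (ℂ.zeroʳ (g (m ℤ.+ + l)))) ⟩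
        P (m ℤ.+ + 0)
          ≈⟨ ℂ.*-cong (ℂ.reflexive (≡.cong g (ℤₚ.+-identityʳ m))) (ℂ.trans (ℂ.reflexive (≡.cong (geometric r) (m-[m+l] (+ 0))))
               (Σᶜ.∑-cong (upTo r) λ j → ℂ.trans (ℂ.reflexive (≡.cong χ (ℤₚ.*-zeroˡ (+ j)))) χ-0)) ⟩
        g m *ᶜ order
          ≈⟨ ℂ.*-comm (g m) order ⟩
        order *ᶜ g m ∎
        where
        open ≈ᶜ-Reasoning
        P : ℤ → ℂ
        P x = g x *ᶜ geometric r (m ℤ.+ ℤ.- x)
        combine : ∀ k l → χ (ℤ.- (+ k ℤ.* + l)) *ᶜ χ (+ k ℤ.* m) ≈ᶜ χ ((m ℤ.+ ℤ.- (+ l)) ℤ.* + k)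
        combine k l = ℂ.trans (ℂ.sym (χ-+ _ _)) (ℂ.reflexive (≡.cong χ (solveℤ 3 (λ k l m →
          (⊝ (k ⊗ l)) ⊕ (k ⊗ m) ⊜ (m ⊕ (⊝ l)) ⊗ k) ≡.refl (+ k) (+ l) m)))
          where open ℤ-Solver using () renaming (solve to solveℤ; _:+_ to _⊕_; _:*_ to _⊗_; _:=_ to _⊜_; :-_ to ⊝_)
        m-[m+l] : ∀ l → m ℤ.+ ℤ.- (m ℤ.+ l) ≡ ℤ.- l
        m-[m+l] l = ≡.trans (≡.cong (λ x → m ℤ.+ x) (ℤₚ.neg-distrib-+ m l)) (≡.trans (≡.sym (ℤₚ.+-assoc m (ℤ.- m) (ℤ.- l)))
          (≡.trans (≡.cong (ℤ._+ ℤ.- l) (ℤₚ.+-inverseʳ m)) (ℤₚ.+-identityˡ (ℤ.- l))))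
        P-periodic : Periodic r P
        P-periodic x = ℂ.*-cong (g-periodic x) (ℂ.trans (ℂ.sym (Σᶜ.∑-cong (upTo r) (χ-periodic-* (m ℤ.+ ℤ.- (x ℤ.+ + r)))))
          (ℂ.reflexive (≡.cong (geometric r) shift)))
          where
          shift : m ℤ.+ ℤ.- (x ℤ.+ + r) ℤ.+ + r ≡ m ℤ.+ ℤ.- x
          shift = solveℤ 3 (λ m x r → m ⊕ (⊝ (x ⊕ r)) ⊕ r ⊜ m ⊕ (⊝ x)) ≡.refl m x (+ r)
            where open ℤ-Solver using () renaming (solve to solveℤ; _:+_ to _⊕_; _:=_ to _⊜_; :-_ to ⊝_)

      module _ (a : ℤ) {L M : ℕ} (L≤M : L ℕ.≤ M) where

        private
          X = ∑ᶜ< L (λ j → g (a ℤ.+ + j))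
          F : ℤ → Carrier
          F k = ∣ transform g k ∣ * ∣ geometric L k ∣
          W : ℤ → Carrier
          W k = ∣ transform g k ∣ * fromℚ (weight M r k)

        completion : order *ᶜ X ≈ᶜ ∑ᶜ< r (λ k → transform g (+ k) *ᶜ χ (+ k ℤ.* a) *ᶜ geometric L (+ k))
        completion = begin
          order *ᶜ X
            ≈⟨ Σᶜ.∑-*ˡ (upTo L) order (λ j → g (a ℤ.+ + j)) ⟨
          ∑ᶜ< L (λ j → order *ᶜ g (a ℤ.+ + j))
            ≈⟨ Σᶜ.∑-cong (upTo L) (λ j → inversion (a ℤ.+ + j)) ⟨
          ∑ᶜ< L (λ j → ∑ᶜ< r (λ k → transform g (+ k) *ᶜ χ (+ k ℤ.* (a ℤ.+ + j))))
            ≈⟨ Σᶜ.∑-swap (upTo L) (upTo r) (λ j k → transform g (+ k) *ᶜ χ (+ k ℤ.* (a ℤ.+ + j))) ⟩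
          ∑ᶜ< r (λ k → ∑ᶜ< L (λ j → transform g (+ k) *ᶜ χ (+ k ℤ.* (a ℤ.+ + j))))
            ≈⟨ Σᶜ.∑-cong (upTo r) (λ k → ℂ.trans (Σᶜ.∑-cong (upTo L) (λ j → ℂ.trans (ℂ.*-congˡ (ℂ.trans
                 (ℂ.reflexive (≡.cong χ (ℤₚ.*-distribˡ-+ (+ k) a (+ j)))) (χ-+ (+ k ℤ.* a) (+ k ℤ.* + j)))) (ℂ.sym (ℂ.*-assoc _ _ _))))
                 (Σᶜ.∑-*ˡ (upTo L) (transform g (+ k) *ᶜ χ (+ k ℤ.* a)) (λ j → χ (+ k ℤ.* + j)))) ⟩
          ∑ᶜ< r (λ k → transform g (+ k) *ᶜ χ (+ k ℤ.* a) *ᶜ geometric L (+ k)) ∎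
          where open ≈ᶜ-Reasoning

        private
          fromℚ-⊓ : ∀ {x} c p q → x ≤ fromℚ (c ℚ.* p) → x ≤ fromℚ (c ℚ.* q) → x ≤ fromℚ (c ℚ.* (p ℚ.⊓ q))
          fromℚ-⊓ {x} c p q x≤p x≤q = [ (λ p≤q → ≡.subst (λ s → x ≤ fromℚ (c ℚ.* s)) (≡.sym (ℚₚ.p≤q⇒p⊓q≡p p≤q)) x≤p)
                                      , (λ q≤p → ≡.subst (λ s → x ≤ fromℚ (c ℚ.* s)) (≡.sym (ℚₚ.p≥q⇒p⊓q≡q q≤p)) x≤q) ]′ (ℚₚ.≤-total p q)

          ∣geometric∣≤M : ∀ k → ∣ geometric L k ∣ ≤ fromℚ ((+ r / 1) ℚ.* (+ M / r))
          ∣geometric∣≤M k = begin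
            ∣ geometric L k ∣                     ≲⟨ ∣geometric∣≤L L k ⟩
            fromℕ L                               ≲⟨ fromℕ-mono-≤ L≤M ⟩
            fromℕ M ≡⟨ ≡.cong fromℚ (≡.trans (/-≡ M 1 (r ℕ.* M) (1 ℕ.* r) {{_}} {{1*r≢0}} M*[1*r]≡)
                                                       (≡.sym (/-* r 1 M r {{_}} {{_}} {{1*r≢0}}))) ⟩
            fromℚ ((+ r / 1) ℚ.* (+ M / r))       ∎
            where
            open ≲-Reasoning
            1*r≢0 : NonZero (1 ℕ.* r)
            1*r≢0 = ℕₚ.m*n≢0 1 r
            M*[1*r]≡ : M ℕ.* (1 ℕ.* r) ≡ r ℕ.* M ℕ.* 1
            M*[1*r]≡ = ≡.trans (≡.cong (M ℕ.*_) (ℕₚ.*-identityˡ r)) (≡.trans (ℕₚ.*-comm M r) (≡.sym (ℕₚ.*-identityʳ (r ℕ.* M))))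

          2*suc≤r : ∀ {j} → j ℕ.< r ℕ./ 2 → 2 ℕ.* suc j ℕ.≤ r
          2*suc≤r {j} j<r/2 = ℕₚ.≤-trans (ℕₚ.*-monoʳ-≤ 2 j<r/2) (ℕₚ.≤-trans (ℕₚ.≤-reflexive (ℕₚ.*-comm 2 (r ℕ./ 2))) (ℕ.m/n*n≤m r 2))

          ∣geometric∣≤weight⁺ : ∀ j → j ℕ.< r ℕ./ 2 → ∣ geometric L (+ suc j) ∣ ≤ fromℚ ((+ r / 1) ℚ.* weight M r (+ suc j))
          ∣geometric∣≤weight⁺ j j<r/2 = fromℚ-⊓ (+ r / 1) (+ M / r) (+ 1 / suc j) (∣geometric∣≤M (+ suc j)) (∣geometric∣≤r/l (suc j) (2*suc≤r j<r/2) L)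

          ∣geometric∣≤weight⁻ : ∀ j → j ℕ.< r ℕ./ 2 → ∣ geometric L -[1+ j ] ∣ ≤ fromℚ ((+ r / 1) ℚ.* weight M r -[1+ j ])
          ∣geometric∣≤weight⁻ j j<r/2 = ≤-trans (≤-reflexive (trans (∣∣-cong (geometric-neg L (+ suc j))) (∣conj∣ (geometric L (+ suc j)))))
            (∣geometric∣≤weight⁺ j j<r/2)

          F≤rW : ∀ k → ∣ geometric L k ∣ ≤ fromℚ ((+ r / 1) ℚ.* weight M r k) → F k ≤ fromℕ r * W k
          F≤rW k geo≤ = begin
            ∣ transform g k ∣ * ∣ geometric L k ∣ ≲⟨ *-monoˡ-≤ (0≤∣∣ (transform g k)) geo≤ ⟩
            ∣ transform g k ∣ * fromℚ ((+ r / 1) ℚ.* weight M r k) ≈⟨ *-congˡ (fromℚ-* (+ r / 1) (weight M r k)) ⟩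
            ∣ transform g k ∣ * (fromℕ r * fromℚ (weight M r k)) ≈⟨ solve 3 (λ x y z → x :* (y :* z) := y :* (x :* z)) refl
                                                                                (∣ transform g k ∣) (fromℕ r) (fromℚ (weight M r k)) ⟩
            fromℕ r * W k                                                   ∎
            where open ≲-Reasoning

          ∑F≤r∑W : ∑ʳ (∣k∣≤ (r ℕ./ 2)) F ≤ fromℕ r * ∑ʳ (∣k∣≤ (r ℕ./ 2)) W
          ∑F≤r∑W = begin
            F (+ 0) + ∑ʳ (0<∣h∣≤ q) F
              ≈⟨ +-congˡ (∑-0<∣h∣≤ q F) ⟩
            F (+ 0) + ∑ʳ< q (λ j → F (+ suc j) + F -[1+ j ])
              ≲⟨ +-mono-≤ (F≤rW (+ 0) (∣geometric∣≤M (+ 0))) (∑<-mono q λ j j<q →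
                   +-mono-≤ (F≤rW (+ suc j) (∣geometric∣≤weight⁺ j j<q)) (F≤rW -[1+ j ] (∣geometric∣≤weight⁻ j j<q))) ⟩
            fromℕ r * W (+ 0) + ∑ʳ< q (λ j → fromℕ r * W (+ suc j) + fromℕ r * W -[1+ j ])
              ≈⟨ +-congˡ (∑-0<∣h∣≤ q (λ k → fromℕ r * W k)) ⟨
            fromℕ r * W (+ 0) + ∑ʳ (0<∣h∣≤ q) (λ k → fromℕ r * W k)
              ≈⟨ Σʳ.∑-*ˡ (∣k∣≤ q) (fromℕ r) W ⟩
            fromℕ r * ∑ʳ (∣k∣≤ q) W ∎
            where
            open ≲-Reasoning
            q = r ℕ./ 2

        -- Completion: the factor r from `order` cancels the r in the bounds for the geometric sums.
        -- The length L of the sum varies with the shift, so the weights are taken for a common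
        -- bound M.
        incomplete-sum : ∣ X ∣ ≤ ∑ʳ (∣k∣≤ (r ℕ./ 2)) W
        incomplete-sum = fromℕ-cancelˡ-≤ r (begin
          fromℕ r * ∣ X ∣
            ≲⟨ *-monoʳ-≤ (0≤∣∣ X) (n≤∣∑1∣ r) ⟩
          ∣ order ∣ * ∣ X ∣
            ≈⟨ ∣∣-* order X ⟨
          ∣ order *ᶜ X ∣
            ≈⟨ ∣∣-cong completion ⟩
          ∣ ∑ᶜ< r (λ k → transform g (+ k) *ᶜ χ (+ k ℤ.* a) *ᶜ geometric L (+ k)) ∣
            ≲⟨ ∣∑∣≤∑∣∣ (upTo r) (λ k → transform g (+ k) *ᶜ χ (+ k ℤ.* a) *ᶜ geometric L (+ k)) ⟩
          ∑ʳ< r (λ k → ∣ transform g (+ k) *ᶜ χ (+ k ℤ.* a) *ᶜ geometric L (+ k) ∣)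
            ≲⟨ ∑-mono (upTo r) (λ k → drop-χ k) ⟩
          ∑ʳ< r (λ k → F (+ k))
            ≲⟨ ∑-residues-≤ r F-periodic (λ k → 0≤* (0≤∣∣ (transform g k)) (0≤∣∣ (geometric L k))) ⟩
          ∑ʳ (∣k∣≤ (r ℕ./ 2)) F
            ≲⟨ ∑F≤r∑W ⟩
          fromℕ r * ∑ʳ (∣k∣≤ (r ℕ./ 2)) W ∎)
          where
          open ≲-Reasoning
          F-periodic : Σʳ.Periodic r F
          F-periodic k = *-cong (∣∣-cong (transform-periodic k)) (∣∣-cong (Σᶜ.∑-cong (upTo L) (χ-periodic-* k)))
          drop-χ : ∀ k → ∣ transform g (+ k) *ᶜ χ (+ k ℤ.* a) *ᶜ geometric L (+ k) ∣ ≤ F (+ k)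
          drop-χ k = begin
            ∣ transform g (+ k) *ᶜ χ (+ k ℤ.* a) *ᶜ geometric L (+ k) ∣ ≈⟨ trans (∣∣-* _ (geometric L (+ k))) (*-congʳ (∣∣-* (transform g (+ k)) (χ (+ k ℤ.* a)))) ⟩
            ∣ transform g (+ k) ∣ * ∣ χ (+ k ℤ.* a) ∣ * ∣ geometric L (+ k) ∣ ≲⟨ *-monoʳ-≤ (0≤∣∣ (geometric L (+ k))) (*-monoˡ-≤ (0≤∣∣ (transform g (+ k))) (∣χ∣≤1 (+ k ℤ.* a))) ⟩
            ∣ transform g (+ k) ∣ * 1# * ∣ geometric L (+ k) ∣ ≈⟨ *-congʳ (*-identityʳ ∣ transform g (+ k) ∣) ⟩
            F (+ k)                                                            ∎

-- Differencing along residue classes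

module Differencing (𝒞 : ComplexNumbers) where

  open ComplexNumbers 𝒞
  open OrderedReals 𝒞
  open AbsoluteValue 𝒞
  open ℝ-Solver using (solve; _:+_; _:*_; _:=_; :-_; con)

  correlation : (ℕ → ℂ) → ℕ → ℕ → Carrier
  correlation x h q = re (x (q ℕ.+ suc h) *ᶜ conj (x q))

  -- Pairs are grouped by their distance h + 1, and each unordered pair contributes twice a real
  -- part. The induction splits off `x 0`, whose products with the later terms are the correlations
  -- at q = 0.
  ∣∑∣² : ∀ n x → ∣ ∑ᶜ< n x ∣ * ∣ ∑ᶜ< n x ∣ ≈
         ∑ʳ< n (λ q → ∣ x q ∣ * ∣ x q ∣) + fromℕ 2 * ∑ʳ< n (λ h → ∑ʳ< (n ∸ suc h) (correlation x h))
  ∣∑∣² zero    x = trans (*-cong ∣0∣ ∣0∣) (trans (zeroˡ 0#) (sym (trans (+-identityˡ _) (zeroʳ _))))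
  ∣∑∣² (suc n) x = begin
    ∣ ∑ᶜ< (suc n) x ∣ * ∣ ∑ᶜ< (suc n) x ∣
      ≡⟨ ≡.cong (λ z → ∣ z ∣ * ∣ z ∣) (Σᶜ.∑<-suc n x) ⟩
    ∣ x 0 +ᶜ Y ∣ * ∣ x 0 +ᶜ Y ∣
      ≈⟨ ∣∣²-+ (x 0) Y ⟩
    ∣ x 0 ∣ * ∣ x 0 ∣ + ∣ Y ∣ * ∣ Y ∣ + (re (Y *ᶜ conj (x 0)) + re (Y *ᶜ conj (x 0)))
      ≈⟨ +-cong (+-congˡ (∣∑∣² n (x ∘ suc))) (+-cong re≈c re≈c) ⟩
    ∣ x 0 ∣ * ∣ x 0 ∣ + (S + fromℕ 2 * D) + (c + c)
      ≈⟨ trans (+-congʳ (+-congˡ (+-congˡ (*-congʳ 2≈)))) (solve 4 (λ a S D c → let two = con 1ℚ :+ con 1ℚ in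
           a :+ (S :+ two :* D) :+ (c :+ c) := (a :+ S) :+ two :* (c :+ D)) refl (∣ x 0 ∣ * ∣ x 0 ∣) S D c) ⟩
    (∣ x 0 ∣ * ∣ x 0 ∣ + S) + (fromℚ 1ℚ + fromℚ 1ℚ) * (c + D)
      ≈⟨ +-cong (reflexive (≡.sym (Σʳ.∑<-suc n (λ q → ∣ x q ∣ * ∣ x q ∣)))) (*-cong (sym 2≈) c+D) ⟩
    ∑ʳ< (suc n) (λ q → ∣ x q ∣ * ∣ x q ∣) + fromℕ 2 * ∑ʳ< (suc n) (λ h → ∑ʳ< (suc n ∸ suc h) (correlation x h)) ∎
    where
    open import Relation.Binary.Reasoning.Setoid setoid
    Y = ∑ᶜ< n (x ∘ suc)
    S = ∑ʳ< n (λ q → ∣ x (suc q) ∣ * ∣ x (suc q) ∣)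
    D = ∑ʳ< n (λ h → ∑ʳ< (n ∸ suc h) (correlation (x ∘ suc) h))
    c = ∑ʳ< n (λ h → re (x (suc h) *ᶜ conj (x 0)))
    2≈ : fromℕ 2 ≈ fromℚ 1ℚ + fromℚ 1ℚ
    2≈ = trans (fromℕ-suc 1) (+-cong (trans fromℕ-1 (sym fromℚ-1)) (sym fromℚ-1))
    re≈c : re (Y *ᶜ conj (x 0)) ≈ c
    re≈c = trans (re-cong (ℂ.sym (Σᶜ.∑-*ʳ (upTo n) (conj (x 0)) (x ∘ suc)))) (re-∑ (upTo n) (λ h → x (suc h) *ᶜ conj (x 0)))
    -- The inner sum for h = n is empty and merely completes the outer range. For h < n the term q =
    -- 0 goes into c and the others, shifted by one, into D.
    c+D : c + D ≈ ∑ʳ< (suc n) (λ h → ∑ʳ< (n ∸ h) (correlation x h))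
    c+D = sym (begin
      ∑ʳ< (suc n) (λ h → ∑ʳ< (n ∸ h) (correlation x h))
        ≈⟨ Σʳ.∑<-last n (λ h → ∑ʳ< (n ∸ h) (correlation x h)) ⟩
      ∑ʳ< n (λ h → ∑ʳ< (n ∸ h) (correlation x h)) + ∑ʳ< (n ∸ n) (correlation x n)
        ≈⟨ +-cong (Σʳ.∑<-cong n (λ h h<n → reflexive (≡.trans (≡.cong (λ m → ∑ʳ< m (correlation x h)) (ℕₚ.+-∸-assoc 1 h<n)) (Σʳ.∑<-suc (n ∸ suc h) (correlation x h)))))
                  (reflexive (≡.cong (λ m → ∑ʳ< m (correlation x n)) (ℕₚ.n∸n≡0 n))) ⟩
      ∑ʳ< n (λ h → correlation x h 0 + ∑ʳ< (n ∸ suc h) (correlation (x ∘ suc) h)) + 0#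
        ≈⟨ trans (+-identityʳ _) (Σʳ.∑-+ (upTo n) (λ h → correlation x h 0) (λ h → ∑ʳ< (n ∸ suc h) (correlation (x ∘ suc) h))) ⟩
      c + D ∎)

  module Inequality
    {r : ℕ} .{{_ : NonZero r}} {χ : ℤ → ℂ}
    (χ-+ : ∀ i j → χ (i ℤ.+ j) ≈ᶜ χ i *ᶜ χ j) (χ-0 : χ (+ 0) ≈ᶜ 1ᶜ) (χ-r : χ (+ r) ≈ᶜ 1ᶜ)
    (χ-conj : ∀ j → conj (χ j) ≈ᶜ χ (ℤ.- j))
    (re-χ≤½ : ∀ j → r ℕ.≤ 4 ℕ.* j → 2 ℕ.* j ℕ.≤ r → re (χ (+ j)) ≤ fromℚ ½)
    {J : Set} (is : List J) {r₂ : ℕ} (b : ℤ → ℂ) (b₁ b₂ : J → ℤ → ℂ) (R₁ R₂ : Carrier)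
    {p : J → ℤ → ℂ} (b≈ : ∀ m → b m ≈ᶜ ∑ᶜ is (λ i → p i m)) (p≈ : ∀ i m → p i m ≈ᶜ b₁ i m *ᶜ b₂ i m)
    (b₁-periodic : ∀ i → Periodic r (b₁ i)) (b₁≤R₁ : ∀ i m → ∣ b₁ i m ∣ ≤ R₁)
    (b₂-periodic : ∀ i → Periodic r₂ (b₂ i)) (b₂≤R₂ : ∀ i m → ∣ b₂ i m ∣ ≤ R₂)
    (H : ℕ) (A : ℤ) (M : ℕ) .{{s≢0 : NonZero (H ℕ.* r₂)}}
    where

    open RootsOfUnity r χ χ-+ χ-0 χ-r χ-conj re-χ≤½

    s Q n I : ℕ
    s = H ℕ.* r₂
    Q = M ℕ./ s
    -- Rounded up past M/s, so that n blocks of length s cover the whole interval.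
    n = suc Q
    I = length is

    a₀ : ℤ
    a₀ = A ℤ.+ + 1

    M≤n*s : M ℕ.≤ n ℕ.* s
    M≤n*s = ℕₚ.≤-trans (ℕₚ.≤-reflexive (ℕ.m≡m%n+[m/n]*n M s)) (ℕₚ.+-monoˡ-≤ (Q ℕ.* s) (ℕₚ.<⇒≤ (ℕ.m%n<n M s)))

    -- Extension by zero beyond the interval: every class u then has the same number n of terms,
    -- although s need not divide M.
    a : J → ℕ → ℂ
    a i j with j ℕₚ.<? M
    ... | yes _ = b₁ i (a₀ ℤ.+ + j)
    ... | no  _ = 0ᶜ

    a-inside : ∀ i {j} → j ℕ.< M → a i j ≡ b₁ i (a₀ ℤ.+ + j)
    a-inside i {j} j<M with j ℕₚ.<? M
    ... | yes _   = ≡.refl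
    ... | no  j≮M = contradiction j<M j≮M

    a-outside : ∀ i {j} → M ℕ.≤ j → a i j ≡ 0ᶜ
    a-outside i {j} M≤j with j ℕₚ.<? M
    ... | yes j<M = contradiction j<M (ℕₚ.≤⇒≯ M≤j)
    ... | no  _   = ≡.refl

    x : J → ℕ → ℕ → ℂ
    x i u q = a i (u ℕ.+ q ℕ.* s)

    T : J → ℕ → ℂ
    T i u = ∑ᶜ< n (x i u)

    c : J → ℕ → ℂ
    c i u = b₂ i (a₀ ℤ.+ + u)

    c-periodic : ∀ i u q → c i (u ℕ.+ q ℕ.* s) ≈ᶜ c i u
    c-periodic i u q = ℂ.trans (ℂ.reflexive (≡.cong (b₂ i) (≡.trans (≡.sym (ℤₚ.+-assoc a₀ (+ u) (+ (q ℕ.* s))))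
        (≡.cong (λ m → a₀ ℤ.+ + u ℤ.+ + m) (≡.sym (ℕₚ.*-assoc q H r₂))))))
      (Σᶜ.periodic-* (b₂-periodic i) (q ℕ.* H) (a₀ ℤ.+ + u))

    S : ℂ
    S = ∑ᶜ (interval A M) b

    S≈ : S ≈ᶜ ∑ᶜ is (λ i → ∑ᶜ< s (λ u → c i u *ᶜ T i u))
    S≈ = begin
      ∑ᶜ (interval A M) b
        ≡⟨ Σᶜ.∑-map (λ j → A ℤ.+ + suc j) (upTo M) b ⟩
      ∑ᶜ< M (λ j → b (A ℤ.+ + suc j))
        ≈⟨ Σᶜ.∑-cong (upTo M) (λ j → ℂ.trans (ℂ.reflexive (≡.cong b (≡.sym (ℤₚ.+-assoc A (+ 1) (+ j)))))
             (ℂ.trans (b≈ (a₀ ℤ.+ + j)) (Σᶜ.∑-cong is λ i → p≈ i (a₀ ℤ.+ + j)))) ⟩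
      ∑ᶜ< M (λ j → ∑ᶜ is (λ i → b₁ i (a₀ ℤ.+ + j) *ᶜ c i j))
        ≈⟨ Σᶜ.∑-swap (upTo M) is (λ j i → b₁ i (a₀ ℤ.+ + j) *ᶜ c i j) ⟩
      ∑ᶜ is (λ i → ∑ᶜ< M (λ j → b₁ i (a₀ ℤ.+ + j) *ᶜ c i j))
        ≈⟨ Σᶜ.∑-cong is blocks ⟩
      ∑ᶜ is (λ i → ∑ᶜ< s (λ u → c i u *ᶜ T i u)) ∎
      where
      open ≈ᶜ-Reasoning
      blocks : ∀ i → ∑ᶜ< M (λ j → b₁ i (a₀ ℤ.+ + j) *ᶜ c i j) ≈ᶜ ∑ᶜ< s (λ u → c i u *ᶜ T i u)
      blocks i = begin
        ∑ᶜ< M (λ j → b₁ i (a₀ ℤ.+ + j) *ᶜ c i j)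
          ≈⟨ Σᶜ.∑<-cong M (λ j j<M → ℂ.*-congʳ (ℂ.reflexive (a-inside i j<M))) ⟨
        ∑ᶜ< M (λ j → a i j *ᶜ c i j)
          ≈⟨ Σᶜ.∑<-truncate (λ j → a i j *ᶜ c i j) M≤n*s (λ j M≤j → ℂ.trans (ℂ.*-congʳ (ℂ.reflexive (a-outside i M≤j))) (ℂ.zeroˡ (c i j))) ⟨
        ∑ᶜ< (n ℕ.* s) (λ j → a i j *ᶜ c i j)
          ≈⟨ Σᶜ.∑<-blocks n s (λ j → a i j *ᶜ c i j) ⟩
        ∑ᶜ< n (λ q → ∑ᶜ< s (λ u → x i u q *ᶜ c i (u ℕ.+ q ℕ.* s)))
          ≈⟨ Σᶜ.∑-swap (upTo n) (upTo s) (λ q u → x i u q *ᶜ c i (u ℕ.+ q ℕ.* s)) ⟩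
        ∑ᶜ< s (λ u → ∑ᶜ< n (λ q → x i u q *ᶜ c i (u ℕ.+ q ℕ.* s)))
          ≈⟨ Σᶜ.∑-cong (upTo s) (λ u → ℂ.trans (Σᶜ.∑-cong (upTo n) λ q → ℂ.trans (ℂ.*-congˡ (c-periodic i u q)) (ℂ.*-comm (x i u q) (c i u)))
               (Σᶜ.∑-*ˡ (upTo n) (c i u) (x i u))) ⟩
        ∑ᶜ< s (λ u → c i u *ᶜ T i u) ∎

    ∑∣T∣ V : Carrier
    ∑∣T∣ = ∑ʳ is (λ i → ∑ʳ< s (λ u → ∣ T i u ∣))
    V = ∑ʳ is (λ i → ∑ʳ< s (λ u → ∣ T i u ∣ * ∣ T i u ∣))

    ∣S∣≤ : ∣ S ∣ ≤ R₂ * ∑∣T∣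
    ∣S∣≤ = begin
      ∣ S ∣                                                        ≈⟨ ∣∣-cong S≈ ⟩
      ∣ ∑ᶜ is (λ i → ∑ᶜ< s (λ u → c i u *ᶜ T i u)) ∣               ≲⟨ ∣∑∣≤∑∣∣ is _ ⟩
      ∑ʳ is (λ i → ∣ ∑ᶜ< s (λ u → c i u *ᶜ T i u) ∣) ≲⟨ ∑-mono is (λ i → ∣∑∣≤∑∣∣ (upTo s) (λ u → c i u *ᶜ T i u)) ⟩
      ∑ʳ is (λ i → ∑ʳ< s (λ u → ∣ c i u *ᶜ T i u ∣)) ≲⟨ ∑-*-mono is (λ i → ∑-*-mono (upTo s) λ u →
                                                                       ≤-trans (≤-reflexive (∣∣-* (c i u) (T i u))) (*-monoʳ-≤ (0≤∣∣ (T i u)) (b₂≤R₂ i (a₀ ℤ.+ + u)))) ⟩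
      R₂ * ∑∣T∣                                                    ∎
      where open ≲-Reasoning

    ∣S∣²≤V : ∣ S ∣ * ∣ S ∣ ≤ R₂ * R₂ * (fromℕ I * (fromℕ s * V))
    ∣S∣²≤V = begin
      ∣ S ∣ * ∣ S ∣                          ≲⟨ square-mono-≤ (0≤∣∣ S) ∣S∣≤ ⟩
      R₂ * ∑∣T∣ * (R₂ * ∑∣T∣) ≈⟨ solve 2 (λ x y → x :* y :* (x :* y) := x :* x :* (y :* y)) refl R₂ ∑∣T∣ ⟩
      R₂ * R₂ * (∑∣T∣ * ∑∣T∣) ≲⟨ *-monoˡ-≤ (0≤x² R₂) (≤-trans (∑²≤ is (λ i → ∑ʳ< s (λ u → ∣ T i u ∣))) (*-monoˡ-≤ (0≤fromℕ I) (∑-*-mono is λ i →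
                                                  ≤-trans (∑²≤ (upTo s) (λ u → ∣ T i u ∣)) (≤-reflexive (*-congʳ (reflexive (≡.cong fromℕ (Listₚ.length-upTo s)))))))) ⟩
      R₂ * R₂ * (fromℕ I * (fromℕ s * V))    ∎
      where open ≲-Reasoning

    diagonal off-diagonal : Carrier
    diagonal = ∑ʳ is (λ i → ∑ʳ< s (λ u → ∑ʳ< n (λ q → ∣ x i u q ∣ * ∣ x i u q ∣)))
    off-diagonal = ∑ʳ is (λ i → ∑ʳ< s (λ u → ∑ʳ< n (λ h → ∑ʳ< (n ∸ suc h) (correlation (x i u) h))))

    V≈ : V ≈ diagonal + fromℕ 2 * off-diagonal
    V≈ = begin
      V
        ≈⟨ Σʳ.∑-cong is (λ i → trans (Σʳ.∑-cong (upTo s) λ u → ∣∑∣² n (x i u))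
             (trans (Σʳ.∑-+ (upTo s) (λ u → ∑ʳ< n (λ q → ∣ x i u q ∣ * ∣ x i u q ∣)) _) (+-congˡ (Σʳ.∑-*ˡ (upTo s) (fromℕ 2) _)))) ⟩
      ∑ʳ is (λ i → ∑ʳ< s (λ u → ∑ʳ< n (λ q → ∣ x i u q ∣ * ∣ x i u q ∣)) +
                   fromℕ 2 * ∑ʳ< s (λ u → ∑ʳ< n (λ h → ∑ʳ< (n ∸ suc h) (correlation (x i u) h))))
        ≈⟨ trans (Σʳ.∑-+ is _ _) (+-congˡ (Σʳ.∑-*ˡ is (fromℕ 2) _)) ⟩
      diagonal + fromℕ 2 * off-diagonal ∎
      where open import Relation.Binary.Reasoning.Setoid setoid

    diagonal≤ : diagonal ≤ fromℕ I * (fromℕ M * (R₁ * R₁))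
    diagonal≤ = ≤-trans (∑-mono is λ i → begin
        ∑ʳ< s (λ u → ∑ʳ< n (λ q → ∣ x i u q ∣ * ∣ x i u q ∣)) ≈⟨ Σʳ.∑-swap (upTo s) (upTo n) (λ u q → ∣ x i u q ∣ * ∣ x i u q ∣) ⟩
        ∑ʳ< n (λ q → ∑ʳ< s (λ u → ∣ x i u q ∣ * ∣ x i u q ∣)) ≈⟨ Σʳ.∑<-blocks n s (λ j → ∣ a i j ∣ * ∣ a i j ∣) ⟨
        ∑ʳ< (n ℕ.* s) (λ j → ∣ a i j ∣ * ∣ a i j ∣) ≈⟨ Σʳ.∑<-truncate (λ j → ∣ a i j ∣ * ∣ a i j ∣) M≤n*s (λ j M≤j →
                                                                     trans (*-congʳ (trans (reflexive (≡.cong ∣_∣ (a-outside i M≤j))) ∣0∣)) (zeroˡ _)) ⟩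
        ∑ʳ< M (λ j → ∣ a i j ∣ * ∣ a i j ∣) ≈⟨ Σʳ.∑<-cong M (λ j j<M → reflexive (≡.cong (λ z → ∣ z ∣ * ∣ z ∣) (a-inside i j<M))) ⟩
        ∑ʳ< M (λ j → ∣ b₁ i (a₀ ℤ.+ + j) ∣ * ∣ b₁ i (a₀ ℤ.+ + j) ∣)
          ≲⟨ ∑-const≤ M (λ j → square-mono-≤ (0≤∣∣ (b₁ i (a₀ ℤ.+ + j))) (b₁≤R₁ i (a₀ ℤ.+ + j))) ⟩
        fromℕ M * (R₁ * R₁)                                      ∎)
      (≤-reflexive (∑-const is (fromℕ M * (R₁ * R₁))))
      where open ≲-Reasoning

    β : ℤ → J → ℤ → ℂ
    β h i m = b₁ i (m ℤ.+ h ℤ.* + s) *ᶜ conj (b₁ i m)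

    g : ℤ → ℤ → ℂ
    g h m = ∑ᶜ is (λ i → β h i m)

    g-periodic : ∀ h → Periodic r (g h)
    g-periodic h m = Σᶜ.∑-cong is λ i → ℂ.*-cong
      (ℂ.trans (ℂ.reflexive (≡.cong (b₁ i) (xy∙z≈xz∙y m (+ r) (h ℤ.* + s)))) (b₁-periodic i (m ℤ.+ h ℤ.* + s)))
      (conj-cong (b₁-periodic i m))
      where open import Algebra.Properties.CommutativeSemigroup ℤₚ.+-commutativeSemigroup using (xy∙z≈xz∙y)

    B̂ : J → ℤ → ℤ → ℂ
    B̂ i h k = ∑ᶜ< r (λ m → b₁ i (+ m ℤ.+ h ℤ.* + s) *ᶜ conj (b₁ i (+ m)) *ᶜ χ (ℤ.- (k ℤ.* + m)))

    transform-g : ∀ h k → transform (g h) k ≈ᶜ ∑ᶜ is (λ i → B̂ i h k)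
    transform-g h k = ℂ.trans (Σᶜ.∑-cong (upTo r) λ m → ℂ.sym (Σᶜ.∑-*ʳ is (χ (ℤ.- (k ℤ.* + m))) (λ i → β h i (+ m))))
      (Σᶜ.∑-swap (upTo r) is (λ m i → β h i (+ m) *ᶜ χ (ℤ.- (k ℤ.* + m))))

    Z : ℤ → Carrier
    Z h = ∑ʳ (∣k∣≤ (r ℕ./ 2)) (λ k → ∣ ∑ᶜ is (λ i → B̂ i h k) ∣ * fromℚ (weight M r k))

    -- Counts the j for which j and j + (h + 1) s both lie below M; truncated subtraction makes this
    -- 0 for larger shifts.
    L : ℕ → ℕ
    L h = M ∸ suc h ℕ.* s

    autocorrelation : ℕ → ℂ
    autocorrelation h = ∑ᶜ< (L h) (λ j → g (+ suc h) (a₀ ℤ.+ + j))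

    -- For a fixed shift the classes u reassemble into one interval of j = u + q s. The sum over i
    -- is moved inside before any absolute value is taken, which is why the final bound contains |∑ᵢ
    -- B̂ᵢ| and not ∑ᵢ |B̂ᵢ|.
    off-diagonal≈ : off-diagonal ≈ ∑ʳ< n (λ h → re (autocorrelation h))
    off-diagonal≈ = begin
      off-diagonal
        ≈⟨ Σʳ.∑-cong is (λ i → Σʳ.∑-swap (upTo s) (upTo n) (λ u h → ∑ʳ< (n ∸ suc h) (correlation (x i u) h))) ⟩
      ∑ʳ is (λ i → ∑ʳ< n (λ h → ∑ʳ< s (λ u → ∑ʳ< (n ∸ suc h) (correlation (x i u) h))))
        ≈⟨ Σʳ.∑-swap is (upTo n) (λ i h → ∑ʳ< s (λ u → ∑ʳ< (n ∸ suc h) (correlation (x i u) h))) ⟩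
      ∑ʳ< n (λ h → ∑ʳ is (λ i → ∑ʳ< s (λ u → ∑ʳ< (n ∸ suc h) (correlation (x i u) h))))
        ≈⟨ Σʳ.∑-cong (upTo n) (λ h → trans (Σʳ.∑-cong is (λ i → shifted h i)) (trans (sym (re-∑ is (λ i → ∑ᶜ< (L h) (λ j → β (+ suc h) i (a₀ ℤ.+ + j)))))
             (re-cong (Σᶜ.∑-swap is (upTo (L h)) (λ i j → β (+ suc h) i (a₀ ℤ.+ + j)))))) ⟩
      ∑ʳ< n (λ h → re (autocorrelation h)) ∎
      where
      open import Relation.Binary.Reasoning.Setoid setoid
      shifted : ∀ h i → ∑ʳ< s (λ u → ∑ʳ< (n ∸ suc h) (correlation (x i u) h)) ≈ re (∑ᶜ< (L h) (λ j → β (+ suc h) i (a₀ ℤ.+ + j)))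
      shifted h i = begin
        ∑ʳ< s (λ u → ∑ʳ< (n ∸ suc h) (correlation (x i u) h))
          ≈⟨ Σʳ.∑-swap (upTo s) (upTo (n ∸ suc h)) (λ u → correlation (x i u) h) ⟩
        ∑ʳ< (n ∸ suc h) (λ q → ∑ʳ< s (λ u → correlation (x i u) h q))
          ≈⟨ Σʳ.∑-cong (upTo (n ∸ suc h)) (λ q → Σʳ.∑-cong (upTo s) λ u → reflexive (≡.cong (λ j → re (a i j *ᶜ conj (x i u q))) (index u q))) ⟩
        ∑ʳ< (n ∸ suc h) (λ q → ∑ʳ< s (λ u → F (u ℕ.+ q ℕ.* s)))
          ≈⟨ Σʳ.∑<-blocks (n ∸ suc h) s F ⟨
        ∑ʳ< ((n ∸ suc h) ℕ.* s) F
          -- The blocks reach at least to L h since n s ≥ M. From L h on, the shifted factor lies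
          -- outside the interval and is 0.
          ≈⟨ Σʳ.∑<-truncate F L≤ (λ j L≤j → trans (re-cong (ℂ.trans (ℂ.*-congʳ (ℂ.reflexive (a-outside i (ℕₚ.≤-trans (ℕₚ.m≤n+m∸n M (suc h ℕ.* s))
               (ℕₚ.≤-trans (ℕₚ.+-monoʳ-≤ (suc h ℕ.* s) L≤j) (ℕₚ.≤-reflexive (ℕₚ.+-comm (suc h ℕ.* s) j))))))) (ℂ.zeroˡ _))) re-0) ⟩
        ∑ʳ< (L h) F
          ≈⟨ Σʳ.∑<-cong (L h) (λ j j<L → re-cong (ℂ.*-cong
               (ℂ.reflexive (≡.trans (a-inside i (j+<M j<L)) (≡.cong (b₁ i) (position j))))
               (conj-cong (ℂ.reflexive (a-inside i (ℕₚ.<-≤-trans j<L (ℕₚ.m∸n≤m M (suc h ℕ.* s)))))))) ⟩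
        ∑ʳ< (L h) (λ j → re (β (+ suc h) i (a₀ ℤ.+ + j)))
          ≈⟨ re-∑ (upTo (L h)) (λ j → β (+ suc h) i (a₀ ℤ.+ + j)) ⟨
        re (∑ᶜ< (L h) (λ j → β (+ suc h) i (a₀ ℤ.+ + j))) ∎
        where
        F : ℕ → Carrier
        F j = re (a i (j ℕ.+ suc h ℕ.* s) *ᶜ conj (a i j))
        index : ∀ u q → u ℕ.+ (q ℕ.+ suc h) ℕ.* s ≡ u ℕ.+ q ℕ.* s ℕ.+ suc h ℕ.* s
        index u q = ≡.trans (≡.cong (u ℕ.+_) (ℕₚ.*-distribʳ-+ s q (suc h))) (≡.sym (ℕₚ.+-assoc u (q ℕ.* s) (suc h ℕ.* s)))
        L≤ : L h ℕ.≤ (n ∸ suc h) ℕ.* s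
        L≤ = ℕₚ.≤-trans (ℕₚ.∸-monoˡ-≤ (suc h ℕ.* s) M≤n*s) (ℕₚ.≤-reflexive (≡.sym (ℕₚ.*-distribʳ-∸ s n (suc h))))
        j+<M : ∀ {j} → j ℕ.< L h → j ℕ.+ suc h ℕ.* s ℕ.< M
        j+<M {j} j<L = ℕₚ.m≤o∸n⇒m+n≤o (suc j) (ℕₚ.<⇒≤ (ℕₚ.m∸n≢0⇒n<m (ℕₚ.m<n⇒n≢0 j<L))) j<L
        position : ∀ j → a₀ ℤ.+ + (j ℕ.+ suc h ℕ.* s) ≡ a₀ ℤ.+ + j ℤ.+ + suc h ℤ.* + s
        position j = ≡.trans (≡.sym (ℤₚ.+-assoc a₀ (+ j) (+ (suc h ℕ.* s)))) (≡.cong (λ m → a₀ ℤ.+ + j ℤ.+ m) (ℤₚ.pos-* (suc h) s))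

    re-autocorrelation≤Z : ∀ h → re (autocorrelation h) ≤ Z (+ suc h)
    re-autocorrelation≤Z h = begin
      re (autocorrelation h)     ≲⟨ re≤∣∣ (autocorrelation h) ⟩
      ∣ autocorrelation h ∣      ≲⟨ incomplete-sum (g-periodic (+ suc h)) a₀ (ℕₚ.m∸n≤m M (suc h ℕ.* s)) ⟩
      ∑ʳ (∣k∣≤ (r ℕ./ 2)) (λ k → ∣ transform (g (+ suc h)) k ∣ * fromℚ (weight M r k))
                         ≈⟨ Σʳ.∑-cong (∣k∣≤ (r ℕ./ 2)) (λ k → *-congʳ (∣∣-cong (transform-g (+ suc h) k))) ⟩
      Z (+ suc h)        ∎
      where open ≲-Reasoning

    0≤weight : ∀ k → 0ℚ ℚ.≤ weight M r k
    0≤weight (+ zero)    = 0≤/ M r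
    0≤weight (+ suc k)   = ℚₚ.⊓-glb (0≤/ M r) (0≤/ 1 (suc k))
    0≤weight -[1+ k ]    = ℚₚ.⊓-glb (0≤/ M r) (0≤/ 1 (suc k))

    0≤Z : ∀ h → 0# ≤ Z h
    0≤Z h = 0≤∑ (∣k∣≤ (r ℕ./ 2)) λ k → 0≤* (0≤∣∣ _) (≤-trans (≤-reflexive (sym fromℚ-0)) (fromℚ-mono-≤ (0≤weight k)))

    ∑Z : Carrier
    ∑Z = ∑ʳ (0<∣h∣≤ Q) Z

    -- The last shift, (Q + 1) s = n s, is at least M, so its sum is empty and only h ≤ M/s remain.
    -- Only positive shifts occur; the terms for negative h are nonnegative and are added for free.
    off-diagonal≤ : off-diagonal ≤ ∑Z
    off-diagonal≤ = begin
      off-diagonal                                     ≈⟨ off-diagonal≈ ⟩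
      ∑ʳ< n (λ h → re (autocorrelation h)) ≈⟨ Σʳ.∑<-last Q (λ h → re (autocorrelation h)) ⟩
      ∑ʳ< Q (λ h → re (autocorrelation h)) + re (autocorrelation Q) ≈⟨ trans (+-congˡ (trans (reflexive (≡.cong (λ l → re (∑ᶜ< l (λ j → g (+ suc Q) (a₀ ℤ.+ + j)))) (ℕₚ.m≤n⇒m∸n≡0 M≤n*s))) re-0)) (+-identityʳ _) ⟩
      ∑ʳ< Q (λ h → re (autocorrelation h)) ≲⟨ ∑-mono (upTo Q) (λ h → ≤-trans (re-autocorrelation≤Z h) (x≤x+y (0≤Z -[1+ h ]))) ⟩
      ∑ʳ< Q (λ h → Z (+ suc h) + Z -[1+ h ])           ≈⟨ ∑-0<∣h∣≤ Q Z ⟨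
      ∑Z                                               ∎
      where open ≲-Reasoning

    -- The constant 2 comes from the two orders of each pair. The diagonal is doubled to share this
    -- factor, and M s is enlarged to (M + s) s.
    inequality : ∣ S ∣ * ∣ S ∣ ≤ fromℕ 2 * (fromℕ ((M ℕ.+ s) ℕ.* s) * (R₁ * R₂ * (R₁ * R₂)) * (fromℕ I * fromℕ I)
                                             + fromℕ s * (R₂ * R₂) * fromℕ I * ∑Z)
    inequality = begin
      ∣ S ∣ * ∣ S ∣
        ≲⟨ ∣S∣²≤V ⟩
      R₂ * R₂ * (fromℕ I * (fromℕ s * V))
        ≲⟨ *-monoˡ-≤ (0≤x² R₂) (*-monoˡ-≤ (0≤fromℕ I) (*-monoˡ-≤ (0≤fromℕ s) V≤)) ⟩
      R₂ * R₂ * (fromℕ I * (fromℕ s * (fromℕ 2 * (fromℕ I * (fromℕ M * (R₁ * R₁))) + fromℕ 2 * ∑Z)))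
        ≈⟨ solve 7 (λ R₁ R₂ I s two M Z → R₂ :* R₂ :* (I :* (s :* (two :* (I :* (M :* (R₁ :* R₁))) :+ two :* Z)))
             := two :* (M :* s :* (R₁ :* R₂ :* (R₁ :* R₂) :* (I :* I)) :+ s :* (R₂ :* R₂) :* I :* Z)) refl R₁ R₂ (fromℕ I) (fromℕ s) (fromℕ 2) (fromℕ M) ∑Z ⟩
      fromℕ 2 * (fromℕ M * fromℕ s * (R₁ * R₂ * (R₁ * R₂) * (fromℕ I * fromℕ I)) + rest)
        ≲⟨ *-monoˡ-≤ (0≤fromℕ 2) (+-mono-≤ (*-monoʳ-≤ (0≤* (0≤x² (R₁ * R₂)) (0≤x² (fromℕ I))) (≤-trans (≤-reflexive (sym (fromℕ-* M s)))
             (fromℕ-mono-≤ (ℕₚ.*-monoˡ-≤ s (ℕₚ.m≤m+n M s))))) ≤-refl) ⟩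
      fromℕ 2 * (fromℕ ((M ℕ.+ s) ℕ.* s) * (R₁ * R₂ * (R₁ * R₂) * (fromℕ I * fromℕ I)) + rest)
        ≈⟨ *-congˡ (+-congʳ (sym (*-assoc _ _ _))) ⟩
      fromℕ 2 * (fromℕ ((M ℕ.+ s) ℕ.* s) * (R₁ * R₂ * (R₁ * R₂)) * (fromℕ I * fromℕ I) + rest) ∎
      where
      open ≲-Reasoning
      rest = fromℕ s * (R₂ * R₂) * fromℕ I * ∑Z
      D = fromℕ I * (fromℕ M * (R₁ * R₁))
      0≤D : 0# ≤ D
      0≤D = 0≤* (0≤fromℕ I) (0≤* (0≤fromℕ M) (0≤x² R₁))
      V≤ : V ≤ fromℕ 2 * D + fromℕ 2 * ∑Z
      V≤ = begin
        V                                     ≈⟨ V≈ ⟩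
        diagonal + fromℕ 2 * off-diagonal     ≲⟨ +-mono-≤ diagonal≤ (*-monoˡ-≤ (0≤fromℕ 2) off-diagonal≤) ⟩
        D + fromℕ 2 * ∑Z                      ≲⟨ +-mono-≤ (≤-trans (x≤x+y 0≤D) (≤-reflexive D+D≈2D)) ≤-refl ⟩
        fromℕ 2 * D + fromℕ 2 * ∑Z            ∎
        where
        D+D≈2D : D + D ≈ fromℕ 2 * D
        D+D≈2D = trans (+-cong (sym (*-identityˡ D)) (sym (*-identityˡ D))) (trans (sym (distribʳ D 1# 1#))
          (*-congʳ (sym (trans (fromℕ-suc 1) (+-congʳ fromℕ-1)))))

    -- The sums are replaced one layer at a time, so that no deep conversion problem
    -- between nested sums of real numbers arises when ℝ and ℂ are substituted.
    inequality-≈ : ∀ {S′ Z″ N} {Z′ : ℤ → Carrier} {t : ℤ → ℤ → Carrier} {v : ℤ → ℤ → ℂ} {B̂′ : J → ℤ → ℤ → ℂ} {w : J → ℤ → ℤ → ℕ → ℂ} →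
      length is ≡ N → S′ ≈ᶜ S → ∑ʳ (0<∣h∣≤ Q) Z′ ≈ Z″ →
      (∀ h → ∑ʳ (∣k∣≤ (r ℕ./ 2)) (t h) ≈ Z′ h) →
      (∀ h k → ∣ v h k ∣ * fromℚ (weight M r k) ≈ t h k) →
      (∀ h k → ∑ᶜ is (λ i → B̂′ i h k) ≈ᶜ v h k) →
      (∀ i h k → ∑ᶜ< r (w i h k) ≈ᶜ B̂′ i h k) →
      (∀ i h k m → b₁ i (+ m ℤ.+ h ℤ.* + s) *ᶜ conj (b₁ i (+ m)) *ᶜ χ (ℤ.- (k ℤ.* + m)) ≈ᶜ w i h k m) →
      ∣ S′ ∣ * ∣ S′ ∣ ≤ fromℕ 2 * (fromℕ ((M ℕ.+ s) ℕ.* s) * (R₁ * R₂ * (R₁ * R₂)) * (fromℕ N * fromℕ N)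
                                   + fromℕ s * (R₂ * R₂) * fromℕ N * Z″)
    inequality-≈ ≡.refl S′≈S Z″≈ Z′≈ t≈ v≈ B̂′≈ w≈ = ≤-trans (≤-reflexive (*-cong (∣∣-cong S′≈S) (∣∣-cong S′≈S)))
      (≤-trans inequality (≤-reflexive (*-congˡ (+-congˡ (*-congˡ (trans
        (Σʳ.∑-cong (0<∣h∣≤ Q) λ h → trans (Σʳ.∑-cong (∣k∣≤ (r ℕ./ 2)) λ k → trans (*-congʳ (∣∣-cong (ℂ.trans
          (Σᶜ.∑-cong is λ i → ℂ.trans (Σᶜ.∑-cong (upTo r) (w≈ i h k)) (B̂′≈ i h k)) (v≈ h k)))) (t≈ h k)) (Z′≈ h)) Z″≈))))))

open import Defs hiding (_+_; _*_; -_; ∣_∣)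
open Defs.ℚ-Lemmas
open import Relation.Binary.PropositionalEquality using (refl; sym; trans; cong; cong₂; subst; subst₂; isEquivalence; module ≡-Reasoning)

open ℚ-Solver.+-*-Solver using (solve; con; _:+_; _:*_; _:-_; :-_; _:=_)

-- Real numbers

Eventually : (ℕ → Set) → Set
Eventually P = ∃[ N ] (∀ n → N ℕ.≤ n → P n)

always : ∀ {P} → (∀ n → P n) → Eventually P
always p = 0 , λ n _ → p n

eventually : ∀ {P Q} → (∀ n → P n → Q n) → Eventually P → Eventually Q
eventually f (N , p) = N , λ n N≤n → f n (p n N≤n)

eventually₂ : ∀ {P Q R} → (∀ n → P n → Q n → R n) → Eventually P → Eventually Q → Eventually R
eventually₂ f (N , p) (N′ , q) = N ℕ.⊔ N′ , λ n ≤n →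
  f n (p n (ℕₚ.m⊔n≤o⇒m≤o N N′ ≤n)) (q n (ℕₚ.m⊔n≤o⇒n≤o N N′ ≤n))

module _ where

  open ℚ using (_+_; _*_; _-_; -_; ∣_∣) renaming (_≤_ to _≤ℚ_; _<_ to _<ℚ_)

  p≤p+q : ∀ {p q} → 0ℚ ≤ℚ q → p ≤ℚ p + q
  p≤p+q {p} {q} 0≤q = subst (_≤ℚ p + q) (ℚₚ.+-identityʳ p) (ℚₚ.+-monoʳ-≤ p 0≤q)

  q≤p+q : ∀ {p q} → 0ℚ ≤ℚ p → q ≤ℚ p + q
  q≤p+q {p} {q} 0≤p = subst (_≤ℚ p + q) (ℚₚ.+-identityˡ q) (ℚₚ.+-monoˡ-≤ q 0≤p)

  p<p+q : ∀ {p q} → 0ℚ <ℚ q → p <ℚ p + q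
  p<p+q {p} {q} 0<q = subst (_<ℚ p + q) (ℚₚ.+-identityʳ p) (ℚₚ.+-monoʳ-< p 0<q)

  p-q≤r⇒p≤q+r : ∀ {p q r} → p - q ≤ℚ r → p ≤ℚ q + r
  p-q≤r⇒p≤q+r {p} {q} {r} h = subst (_≤ℚ q + r) (solve 2 (λ p q → q :+ (p :- q) := p) refl p q) (ℚₚ.+-monoʳ-≤ q h)

  p-q<r⇒p<q+r : ∀ {p q r} → p - q <ℚ r → p <ℚ q + r
  p-q<r⇒p<q+r {p} {q} {r} h = subst (_<ℚ q + r) (solve 2 (λ p q → q :+ (p :- q) := p) refl p q) (ℚₚ.+-monoʳ-< q h)

  p<q+r⇒p-q<r : ∀ {p q r} → p <ℚ q + r → p - q <ℚ r
  p<q+r⇒p-q<r {p} {q} {r} h = subst (p - q <ℚ_) ([x+y]-x≡y q r) (ℚₚ.+-monoˡ-< (- q) h)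

  0≤p² : ∀ p → 0ℚ ≤ℚ p * p
  0≤p² p with ℚₚ.∣p∣≡p∨∣p∣≡-p p
  ... | inj₁ eq = 0≤* 0≤p 0≤p
    where 0≤p = subst (0ℚ ≤ℚ_) eq (ℚₚ.0≤∣p∣ p)
  ... | inj₂ eq = subst (0ℚ ≤ℚ_) (solve 1 (λ p → :- p :* :- p := p :* p) refl p) (0≤* 0≤-p 0≤-p)
    where 0≤-p = subst (0ℚ ≤ℚ_) eq (ℚₚ.0≤∣p∣ p)

  -- The division is by 1 + c, which is positive also for c = 0.
  divideBy : ∀ {c ε} → 0ℚ ≤ℚ c → 0ℚ <ℚ ε → ∃[ δ ] 0ℚ <ℚ δ × δ * c ≤ℚ ε
  divideBy {c} 0≤c 0<ε =
    let δ , 0<δ , eq = divide (0<+ 0<1 0≤c) 0<ε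
    in δ , 0<δ , subst (δ * c ≤ℚ_) eq
    (ℚₚ.*-monoˡ-≤-nonNeg δ {{ℚ.nonNegative (ℚₚ.<⇒≤ 0<δ)}} (q≤p+q (ℚₚ.<⇒≤ 0<1)))

  -- `x ≈ y` unfolds to `Null` of the difference of the two sequences, so closure properties of null
  -- sequences are congruence laws for the reals.
  Null : (ℕ → ℚ) → Set
  Null u = ∀ ε → 0ℚ <ℚ ε → Eventually λ n → ∣ u n ∣ <ℚ ε

  Null-≤ : ∀ {u v} → (∀ n → ∣ u n ∣ ≤ℚ ∣ v n ∣) → Null v → Null u
  Null-≤ u≤v nv ε 0<ε = eventually (λ n → ℚₚ.≤-<-trans (u≤v n)) (nv ε 0<ε)

  Null-≡ : ∀ {u v} → (∀ n → u n ≡ v n) → Null v → Null u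
  Null-≡ u≡v = Null-≤ λ n → ℚₚ.≤-reflexive (cong ∣_∣ (u≡v n))

  Null-+ : ∀ {u v} → Null u → Null v → Null (λ n → u n + v n)
  Null-+ {u} {v} nu nv ε 0<ε = eventually₂
    (λ n u< v< → ℚₚ.≤-<-trans (ℚₚ.∣p+q∣≤∣p∣+∣q∣ (u n) (v n)) (subst (_ <ℚ_) (halves ε) (ℚₚ.+-mono-< u< v<)))
    (nu (½ * ε) (0<-half 0<ε)) (nv (½ * ε) (0<-half 0<ε))

  Null-bounded* : ∀ (u : ℕ → ℚ) {v B} → (∀ n → ∣ u n ∣ ≤ℚ B) → Null v → Null (λ n → u n * v n)
  Null-bounded* u {v} {B} u≤B nv ε 0<ε =
    let δ , 0<δ , δB≤ = divideBy (ℚₚ.≤-trans (ℚₚ.0≤∣p∣ (u 0)) (u≤B 0)) (0<-half 0<ε)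
    in eventually (λ n v<δ → begin-strict
      ∣ u n * v n ∣       ≡⟨ ℚₚ.∣p*q∣≡∣p∣*∣q∣ (u n) (v n) ⟩
      ∣ u n ∣ * ∣ v n ∣   ≤⟨ *-mono-≤ (ℚₚ.0≤∣p∣ (u n)) (ℚₚ.<⇒≤ 0<δ) (u≤B n) (ℚₚ.<⇒≤ v<δ) ⟩
      B * δ               ≡⟨ ℚₚ.*-comm B δ ⟩
      δ * B               ≤⟨ δB≤ ⟩
      ½ * ε               <⟨ p<p+q (0<-half 0<ε) ⟩
      ½ * ε + ½ * ε       ≡⟨ halves ε ⟩
      ε                   ∎) (nv δ 0<δ)
    where open ℚₚ.≤-Reasoning

  pointwise-≈ : ∀ {x y} → (∀ n → seq x n ≡ seq y n) → x ≈ y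
  pointwise-≈ {x} {y} x≡y = λ ε 0<ε → always λ n →
    subst (_<ℚ ε) (sym (trans (cong (λ a → ∣ a - seq y n ∣) (x≡y n)) (∣x-x∣≡0 (seq y n)))) 0<ε

  pointwise-≤ : ∀ {x y} → (∀ n → seq x n ≤ℚ seq y n) → x ≤ y
  pointwise-≤ {x} {y} x≤y = λ ε 0<ε → always λ n → ℚₚ.≤-<-trans (x≤y n) (p<p+q 0<ε)

  ≈-refl : ∀ {x} → x ≈ x
  ≈-refl {x} = pointwise-≈ {x} {x} λ _ → refl

  ≈-sym : ∀ {x y} → x ≈ y → y ≈ x
  ≈-sym {x} {y} x≈y = Null-≤ (λ n → ℚₚ.≤-reflexive (∣x-y∣≡∣y-x∣ (seq y n) (seq x n))) x≈y

  ≈-trans : ∀ {x y z} → x ≈ y → y ≈ z → x ≈ z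
  ≈-trans {x} {y} {z} x≈y y≈z = Null-≡
    (λ n → solve 3 (λ x y z → x :- z := (x :- y) :+ (y :- z)) refl (seq x n) (seq y n) (seq z n)) (Null-+ x≈y y≈z)

  +ℝ-cong : ∀ {x x′ y y′} → x ≈ x′ → y ≈ y′ → (x Defs.+ y) ≈ (x′ Defs.+ y′)
  +ℝ-cong {x} {x′} {y} {y′} x≈ y≈ = Null-≡
    (λ n → solve 4 (λ x x′ y y′ → (x :+ y) :- (x′ :+ y′) := (x :- x′) :+ (y :- y′)) refl (seq x n) (seq x′ n) (seq y n) (seq y′ n))
    (Null-+ x≈ y≈)

  *ℝ-cong : ∀ {x x′ y y′} → x ≈ x′ → y ≈ y′ → (x Defs.* y) ≈ (x′ Defs.* y′)
  *ℝ-cong {x} {x′} {y} {y′} x≈ y≈ = Null-≡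
    (λ n → solve 4 (λ x x′ y y′ → (x :* y) :- (x′ :* y′) := x :* (y :- y′) :+ y′ :* (x :- x′)) refl (seq x n) (seq x′ n) (seq y n) (seq y′ n))
    (Null-+ {λ n → seq x n * (seq y n - seq y′ n)} {λ n → seq y′ n * (seq x n - seq x′ n)}
      (Null-bounded* (seq x) (proj₂ (proj₂ (bounded (seq x) (cauchy x)))) y≈)
      (Null-bounded* (seq y′) (proj₂ (proj₂ (bounded (seq y′) (cauchy y′)))) x≈))

  -ℝ-cong : ∀ {x x′} → x ≈ x′ → (Defs.- x) ≈ (Defs.- x′)
  -ℝ-cong {x} {x′} x≈ = Null-≤ (λ n → ℚₚ.≤-reflexive (trans
    (cong ∣_∣ (solve 2 (λ x x′ → (:- x) :- (:- x′) := :- (x :- x′)) refl (seq x n) (seq x′ n))) (ℚₚ.∣-p∣≡∣p∣ _))) x≈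

  ≤-reflexive : ∀ {x y} → x ≈ y → x ≤ y
  ≤-reflexive {x} {y} x≈y ε 0<ε = eventually (λ n h → p-q<r⇒p<q+r (ℚₚ.≤-<-trans (p≤∣p∣ (seq x n - seq y n)) h)) (x≈y ε 0<ε)

  ≤-trans : ∀ {x y z} → x ≤ y → y ≤ z → x ≤ z
  ≤-trans {x} {y} {z} x≤y y≤z ε 0<ε = eventually₂
    (λ n h h′ → begin-strict
      seq x n                          <⟨ h ⟩
      seq y n + ½ * ε                  <⟨ ℚₚ.+-monoˡ-< (½ * ε) h′ ⟩
      seq z n + ½ * ε + ½ * ε ≡⟨ trans (ℚₚ.+-assoc (seq z n) _ _) (cong (λ a → seq z n + a) (halves ε)) ⟩
      seq z n + ε                      ∎)
    (x≤y (½ * ε) (0<-half 0<ε)) (y≤z (½ * ε) (0<-half 0<ε))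
    where open ℚₚ.≤-Reasoning

  ≤-antisym : ∀ {x y} → x ≤ y → y ≤ x → x ≈ y
  ≤-antisym {x} {y} x≤y y≤x ε 0<ε = eventually₂
    (λ n h h′ → ∣∣< (p<q+r⇒p-q<r h) (subst (_<ℚ ε) (neg-difference (seq x n) (seq y n)) (p<q+r⇒p-q<r h′)))
    (x≤y ε 0<ε) (y≤x ε 0<ε)

  +ℝ-mono-≤ : ∀ {x x′ y y′} → x ≤ x′ → y ≤ y′ → (x Defs.+ y) ≤ (x′ Defs.+ y′)
  +ℝ-mono-≤ {x} {x′} {y} {y′} x≤ y≤ ε 0<ε = eventually₂
    (λ n h h′ → subst (_ <ℚ_) (trans
       (solve 3 (λ x y e → (x :+ e) :+ (y :+ e) := (x :+ y) :+ (e :+ e)) refl (seq x′ n) (seq y′ n) (½ * ε))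
       (cong (λ a → (seq x′ n + seq y′ n) + a) (halves ε))) (ℚₚ.+-mono-< h h′))
    (x≤ (½ * ε) (0<-half 0<ε)) (y≤ (½ * ε) (0<-half 0<ε))

  -- If one of the factors is negative then it is small.
  0≤ℝ* : ∀ {x y} → 0ℝ ≤ x → 0ℝ ≤ y → 0ℝ ≤ (x Defs.* y)
  0≤ℝ* {x} {y} 0≤x 0≤y ε 0<ε
    with bounded (seq x) (cauchy x) | bounded (seq y) (cauchy y)
  ... | B , 0<B , x≤B | B′ , 0<B′ , y≤B′ with divide (0<+ 0<B (ℚₚ.<⇒≤ 0<B′)) 0<ε
  ... | δ , 0<δ , δ[B+B′]≡ε = eventually₂ positive (0≤x δ 0<δ) (0≤y δ 0<δ)
    where
    0≤δ = ℚₚ.<⇒≤ 0<δ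
    instance _ = ℚ.positive 0<δ
    open ℚₚ.≤-Reasoning
    bound : ∀ {p q b} → 0ℚ <ℚ b → 0ℚ <ℚ p + δ → p ≤ℚ 0ℚ → ∣ q ∣ ≤ℚ b → δ * b ≤ℚ ε → 0ℚ <ℚ p * q + ε
    bound {p} {q} {b} 0<b 0<p+δ p≤0 q≤b δb≤ε = begin-strict
      0ℚ                       ≡⟨ ℚₚ.*-zeroˡ b ⟨
      0ℚ * b                   <⟨ ℚₚ.*-monoˡ-<-pos b {{ℚ.positive 0<b}} 0<p+δ ⟩
      (p + δ) * b              ≡⟨ ℚₚ.*-distribʳ-+ b p δ ⟩
      p * b + δ * b ≤⟨ ℚₚ.+-mono-≤ (ℚₚ.*-monoˡ-≤-nonPos p {{ℚ.nonPositive p≤0}} (ℚₚ.≤-trans (p≤∣p∣ q) q≤b)) δb≤ε ⟩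
      p * q + ε                ∎
    δB≤ε : δ * B ≤ℚ ε
    δB≤ε = subst (δ * B ≤ℚ_) δ[B+B′]≡ε (ℚₚ.*-monoˡ-≤-nonNeg δ {{ℚ.nonNegative 0≤δ}} (p≤p+q (ℚₚ.<⇒≤ 0<B′)))
    δB′≤ε : δ * B′ ≤ℚ ε
    δB′≤ε = subst (δ * B′ ≤ℚ_) δ[B+B′]≡ε (ℚₚ.*-monoˡ-≤-nonNeg δ {{ℚ.nonNegative 0≤δ}} (q≤p+q (ℚₚ.<⇒≤ 0<B)))
    positive : ∀ n → 0ℚ <ℚ seq x n + δ → 0ℚ <ℚ seq y n + δ → 0ℚ <ℚ seq x n * seq y n + ε
    positive n h h′ with ℚₚ.≤-total 0ℚ (seq x n) | ℚₚ.≤-total 0ℚ (seq y n)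
    ... | inj₂ x≤0 | _        = bound 0<B′ h x≤0 (y≤B′ n) δB′≤ε
    ... | inj₁ _ | inj₂ y≤0 = subst (λ a → 0ℚ <ℚ a + ε) (ℚₚ.*-comm (seq y n) (seq x n)) (bound 0<B h′ y≤0 (x≤B n) δB≤ε)
    ... | inj₁ 0≤a | inj₁ 0≤b = ℚₚ.+-mono-≤-< (0≤* 0≤a 0≤b) 0<ε

  0≤x²ℝ : ∀ x → 0ℝ ≤ x ²
  0≤x²ℝ x = pointwise-≤ {0ℝ} {x ²} λ n → 0≤p² (seq x n)

  -- Let a and b approximate x and y, and put δ = ε/4, with b > -δ. If a ≥ b + 4δ, then a² ≥ b² +
  -- 8δ(b + δ) + 8δ², which contradicts a² < b² + δ².
  square-cancel-≤ : ∀ {x y} → 0ℝ ≤ y → x ² ≤ y ² → x ≤ y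
  square-cancel-≤ {x} {y} 0≤y x²≤y² ε 0<ε = eventually₂ below (0≤y δ 0<δ) (x²≤y² (δ * δ) (0<* 0<δ 0<δ))
    where
    open ℚₚ.≤-Reasoning
    δ = ½ * (½ * ε)
    0<δ : 0ℚ <ℚ δ
    0<δ = 0<-half (0<-half 0<ε)
    0≤δ = ℚₚ.<⇒≤ 0<δ
    ε≡4δ : ε ≡ (δ + δ) + (δ + δ)
    ε≡4δ = sym (trans (cong₂ _+_ (halves (½ * ε)) (halves (½ * ε))) (halves ε))
    below : ∀ n → 0ℚ <ℚ seq y n + δ → seq x n * seq x n <ℚ seq y n * seq y n + δ * δ → seq x n <ℚ seq y n + ε
    below n 0<u a²< = ℚₚ.≰⇒> λ b+ε≤a → ℚₚ.<-irrefl refl (begin-strict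
      a * a                                  <⟨ a²< ⟩
      b * b + δ * δ ≤⟨ p≤p+q (ℚₚ.+-mono-≤ (0≤* 0≤4δ (ℚₚ.+-mono-≤ 0≤u 0≤u)) (0≤* 0≤4δ 0≤δ)) ⟩
      b * b + δ * δ + (4δ * (u + u) + 4δ * δ)
        ≤⟨ p≤p+q (0≤* (ℚₚ.+-mono-≤ 0≤δ (ℚₚ.+-mono-≤ 0≤δ 0≤δ)) 0≤δ) ⟩
      b * b + δ * δ + (4δ * (u + u) + 4δ * δ) + (δ + (δ + δ)) * δ
        ≡⟨ solve 2 (λ b δ → let 4δ = (δ :+ δ) :+ (δ :+ δ) ; u = b :+ δ in
             b :* b :+ δ :* δ :+ (4δ :* (u :+ u) :+ 4δ :* δ) :+ (δ :+ (δ :+ δ)) :* δ := (b :+ 4δ) :* (b :+ 4δ)) refl b δ ⟩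
      (b + 4δ) * (b + 4δ) ≤⟨ *-mono-≤ 0≤b+4δ (ℚₚ.≤-trans 0≤b+4δ (b+4δ≤a b+ε≤a)) (b+4δ≤a b+ε≤a) (b+4δ≤a b+ε≤a) ⟩
      a * a                                  ∎)
      where
      a = seq x n
      b = seq y n
      u = b + δ
      4δ = (δ + δ) + (δ + δ)
      0≤u = ℚₚ.<⇒≤ 0<u
      0≤4δ : 0ℚ ≤ℚ 4δ
      0≤4δ = ℚₚ.+-mono-≤ (ℚₚ.+-mono-≤ 0≤δ 0≤δ) (ℚₚ.+-mono-≤ 0≤δ 0≤δ)
      b+4δ≤a : b + ε ≤ℚ a → b + 4δ ≤ℚ a
      b+4δ≤a = subst (λ e → b + e ≤ℚ a) ε≡4δ
      0≤b+4δ : 0ℚ ≤ℚ b + 4δ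
      0≤b+4δ = ℚₚ.≤-trans 0≤u (ℚₚ.+-monoʳ-≤ b (ℚₚ.≤-trans (p≤p+q 0≤δ) (p≤p+q (ℚₚ.+-mono-≤ 0≤δ 0≤δ))))

ℝ-commutativeRing : CommutativeRing 0ℓ 0ℓ
ℝ-commutativeRing = record
  { Carrier = ℝ
  ; _≈_ = _≈_
  ; _+_ = Defs._+_
  ; _*_ = Defs._*_
  ; -_ = Defs.-_
  ; 0# = 0ℝ
  ; 1# = 1ℝ
  ; isCommutativeRing = record
    { isRing = record
      { +-isAbelianGroup = record
        { isGroup = record
          { isMonoid = record
            { isSemigroup = record
              { isMagma = record
                { isEquivalence = record
                  { refl  = λ {x} → ≈-refl {x}
                  ; sym   = λ {x} {y} → ≈-sym {x} {y}
                  ; trans = λ {x} {y} {z} → ≈-trans {x} {y} {z}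
                  }
                ; ∙-cong = λ {x} {x′} {y} {y′} → +ℝ-cong {x} {x′} {y} {y′}
                }
              ; assoc = λ x y z → pointwise-≈ {(x Defs.+ y) Defs.+ z} {x Defs.+ (y Defs.+ z)}
                  λ n → ℚₚ.+-assoc (seq x n) (seq y n) (seq z n)
              }
            ; identity = (λ x → pointwise-≈ {0ℝ Defs.+ x} {x} λ n → ℚₚ.+-identityˡ (seq x n))
                       , (λ x → pointwise-≈ {x Defs.+ 0ℝ} {x} λ n → ℚₚ.+-identityʳ (seq x n))
            }
          ; inverse = (λ x → pointwise-≈ {(Defs.- x) Defs.+ x} {0ℝ} λ n → ℚₚ.+-inverseˡ (seq x n))
                    , (λ x → pointwise-≈ {x Defs.+ (Defs.- x)} {0ℝ} λ n → ℚₚ.+-inverseʳ (seq x n))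
          ; ⁻¹-cong = λ {x} {x′} → -ℝ-cong {x} {x′}
          }
        ; comm = λ x y → pointwise-≈ {x Defs.+ y} {y Defs.+ x} λ n → ℚₚ.+-comm (seq x n) (seq y n)
        }
      ; *-cong = λ {x} {x′} {y} {y′} → *ℝ-cong {x} {x′} {y} {y′}
      ; *-assoc = λ x y z → pointwise-≈ {(x Defs.* y) Defs.* z} {x Defs.* (y Defs.* z)}
          λ n → ℚₚ.*-assoc (seq x n) (seq y n) (seq z n)
      ; *-identity = (λ x → pointwise-≈ {1ℝ Defs.* x} {x} λ n → ℚₚ.*-identityˡ (seq x n))
                   , (λ x → pointwise-≈ {x Defs.* 1ℝ} {x} λ n → ℚₚ.*-identityʳ (seq x n))
      ; distrib = (λ x y z → pointwise-≈ {x Defs.* (y Defs.+ z)} {x Defs.* y Defs.+ x Defs.* z}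
                     λ n → ℚₚ.*-distribˡ-+ (seq x n) (seq y n) (seq z n))
                , (λ x y z → pointwise-≈ {(y Defs.+ z) Defs.* x} {y Defs.* x Defs.+ z Defs.* x}
                     λ n → ℚₚ.*-distribʳ-+ (seq x n) (seq y n) (seq z n))
      }
    ; *-comm = λ x y → pointwise-≈ {x Defs.* y} {y Defs.* x} λ n → ℚₚ.*-comm (seq x n) (seq y n)
    }
  }

-- Square roots

module _ where

  open ℚ using (_+_; _*_; _-_; -_; ∣_∣) renaming (_≤_ to _≤ℚ_; _<_ to _<ℚ_)

  0≤√ : ∀ x → 0ℝ ≤ √ x
  0≤√ x = pointwise-≤ {0ℝ} {√ x} λ n → √-Approx.nonneg (proj₂ (√-approx (seq x n) (+ 1 / suc n) (0</ 1 (suc n))))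

  -- On one side q < (s + δ)² = s² + δ(2s + δ), and the last term is at most η(2B + 1) ≤ ε. On the
  -- other side `lower` gives s² ≤ q unless s = 0.
  √-Approx-close : ∀ {q δ s B ε η} → √-Approx q δ s → 0ℚ <ℚ ε → 0ℚ ≤ℚ δ → δ ≤ℚ 1ℚ → δ ≤ℚ η → s ≤ℚ B →
                   η * ((B + B) + 1ℚ) ≤ℚ ε → 0ℚ <ℚ q + ε → ∣ s * s - q ∣ <ℚ ε
  √-Approx-close {q} {δ} {s} {B} {ε} {η} (mk√ 0≤s lower upper) 0<ε 0≤δ δ≤1 δ≤η s≤B η[2B+1]≤ε 0<q+ε =
    ∣∣< (s²-q<ε lower) (subst (_<ℚ ε) (neg-difference (s * s) q) (p<q+r⇒p-q<r (begin-strict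
      q                                  <⟨ upper ⟩
      (s + δ) * (s + δ) ≡⟨ solve 2 (λ s δ → (s :+ δ) :* (s :+ δ) := s :* s :+ δ :* ((s :+ s) :+ δ)) refl s δ ⟩
      s * s + δ * ((s + s) + δ)          ≤⟨ ℚₚ.+-monoʳ-≤ (s * s) (*-mono-≤ 0≤δ
                                              (ℚₚ.≤-trans (ℚₚ.+-mono-≤ (ℚₚ.+-mono-≤ 0≤s 0≤s) 0≤δ) 2s+δ≤) δ≤η 2s+δ≤) ⟩
      s * s + η * ((B + B) + 1ℚ)         ≤⟨ ℚₚ.+-monoʳ-≤ (s * s) η[2B+1]≤ε ⟩
      s * s + ε                          ∎)))
    where
    open ℚₚ.≤-Reasoning
    -- The approximation s overshoots only if it is 0, and then q is almost nonnegative.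
    s²-q<ε : s ≡ 0ℚ ⊎ s * s ≤ℚ q → s * s - q <ℚ ε
    s²-q<ε (inj₁ s≡0)  = p<q+r⇒p-q<r (subst (_<ℚ q + ε) (sym (trans (cong (_* s) s≡0) (ℚₚ.*-zeroˡ s))) 0<q+ε)
    s²-q<ε (inj₂ s²≤q) = p<q+r⇒p-q<r (ℚₚ.≤-<-trans s²≤q (p<p+q 0<ε))
    2s+δ≤ : (s + s) + δ ≤ℚ (B + B) + 1ℚ
    2s+δ≤ = ℚₚ.+-mono-≤ (ℚₚ.+-mono-≤ s≤B s≤B) δ≤1

  √-Approx-converges : ∀ (q s : ℕ → ℚ) → IsCauchy s → (∀ n → √-Approx (q n) (+ 1 / suc n) (s n)) →
    (∀ ε → 0ℚ <ℚ ε → Eventually λ n → 0ℚ <ℚ q n + ε) → Null (λ n → s n * s n - q n)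
  √-Approx-converges q s cs approx 0≤q ε 0<ε =
    let B , 0<B , s≤B = bounded s cs
        η , 0<η , η[2B+1]≤ε = divideBy (ℚₚ.+-mono-≤ (ℚₚ.+-mono-≤ (ℚₚ.<⇒≤ 0<B) (ℚₚ.<⇒≤ 0<B)) (ℚₚ.<⇒≤ 0<1)) 0<ε
    in eventually₂
      (λ n 0<q+ε δ≤η → √-Approx-close (approx n) 0<ε (0≤/ 1 (suc n))
        (subst (+ 1 / suc n ≤ℚ_) 1/1≡1 (/-mono-≤ 1 (suc n) 1 1 (ℕ.s≤s ℕ.z≤n)))
        δ≤η (ℚₚ.≤-trans (p≤∣p∣ (s n)) (s≤B n)) η[2B+1]≤ε 0<q+ε)
      (0≤q ε 0<ε) (1/-small 0<η)

  √² : ∀ {x} → 0ℝ ≤ x → √ x ² ≈ x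
  √² {x} = √-Approx-converges (seq x) (seq (√ x)) (cauchy (√ x)) λ n → proj₂ (√-approx (seq x n) (+ 1 / suc n) (0</ 1 (suc n)))

-- Gaussian rationals, the values of the approximations to complex numbers

ℚ[i] : Set
ℚ[i] = ℚ × ℚ

infixl 6 _+ᵍ_
infixl 7 _*ᵍ_
infix  8 -ᵍ_

_+ᵍ_ _*ᵍ_ : ℚ[i] → ℚ[i] → ℚ[i]
(x , y) +ᵍ (u , v) = x ℚ.+ u , y ℚ.+ v
(x , y) *ᵍ (u , v) = x ℚ.* u ℚ.+ ℚ.- (y ℚ.* v) , x ℚ.* v ℚ.+ y ℚ.* u

-ᵍ_ : ℚ[i] → ℚ[i]
-ᵍ (x , y) = ℚ.- x , ℚ.- y

0ᵍ 1ᵍ iᵍ : ℚ[i]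
0ᵍ = 0ℚ , 0ℚ
1ᵍ = 1ℚ , 0ℚ
iᵍ = 0ℚ , 1ℚ

module _ where

  ℚ[i]-commutativeRing : CommutativeRing 0ℓ 0ℓ
  ℚ[i]-commutativeRing = record
    { Carrier = ℚ[i]
    ; _≈_ = _≡_
    ; _+_ = _+ᵍ_
    ; _*_ = _*ᵍ_
    ; -_ = -ᵍ_
    ; 0# = 0ᵍ
    ; 1# = 1ᵍ
    ; isCommutativeRing = record
      { isRing = record
        { +-isAbelianGroup = record
          { isGroup = record
            { isMonoid = record
              { isSemigroup = record
                { isMagma = record { isEquivalence = isEquivalence ; ∙-cong = cong₂ _+ᵍ_ }
                ; assoc = λ (x , y) (u , v) (a , b) → cong₂ _,_ (ℚₚ.+-assoc x u a) (ℚₚ.+-assoc y v b)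
                }
              ; identity = (λ (x , y) → cong₂ _,_ (ℚₚ.+-identityˡ x) (ℚₚ.+-identityˡ y))
                         , (λ (x , y) → cong₂ _,_ (ℚₚ.+-identityʳ x) (ℚₚ.+-identityʳ y))
              }
            ; inverse = (λ (x , y) → cong₂ _,_ (ℚₚ.+-inverseˡ x) (ℚₚ.+-inverseˡ y))
                      , (λ (x , y) → cong₂ _,_ (ℚₚ.+-inverseʳ x) (ℚₚ.+-inverseʳ y))
            ; ⁻¹-cong = cong -ᵍ_
            }
          ; comm = λ (x , y) (u , v) → cong₂ _,_ (ℚₚ.+-comm x u) (ℚₚ.+-comm y v)
          }
        ; *-cong = cong₂ _*ᵍ_
        ; *-assoc = λ (x , y) (u , v) (a , b) → cong₂ _,_
            (solve 6 (λ x y u v a b → (x :* u :+ :- (y :* v)) :* a :+ :- ((x :* v :+ y :* u) :* b)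
                                   := x :* (u :* a :+ :- (v :* b)) :+ :- (y :* (u :* b :+ v :* a))) refl x y u v a b)
            (solve 6 (λ x y u v a b → (x :* u :+ :- (y :* v)) :* b :+ (x :* v :+ y :* u) :* a
                                   := x :* (u :* b :+ v :* a) :+ y :* (u :* a :+ :- (v :* b))) refl x y u v a b)
        ; *-identity = (λ (x , y) → cong₂ _,_
              (solve 2 (λ x y → con 1ℚ :* x :+ :- (con 0ℚ :* y) := x) refl x y)
              (solve 2 (λ x y → con 1ℚ :* y :+ con 0ℚ :* x := y) refl x y))
          , (λ (x , y) → cong₂ _,_
              (solve 2 (λ x y → x :* con 1ℚ :+ :- (y :* con 0ℚ) := x) refl x y)
              (solve 2 (λ x y → x :* con 0ℚ :+ y :* con 1ℚ := y) refl x y))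
        ; distrib = (λ (x , y) (u , v) (a , b) → cong₂ _,_
              (solve 6 (λ x y u v a b → x :* (u :+ a) :+ :- (y :* (v :+ b))
                                     := (x :* u :+ :- (y :* v)) :+ (x :* a :+ :- (y :* b))) refl x y u v a b)
              (solve 6 (λ x y u v a b → x :* (v :+ b) :+ y :* (u :+ a)
                                     := (x :* v :+ y :* u) :+ (x :* b :+ y :* a)) refl x y u v a b))
          , (λ (x , y) (u , v) (a , b) → cong₂ _,_
              (solve 6 (λ x y u v a b → (u :+ a) :* x :+ :- ((v :+ b) :* y)
                                     := (u :* x :+ :- (v :* y)) :+ (a :* x :+ :- (b :* y))) refl x y u v a b)
              (solve 6 (λ x y u v a b → (u :+ a) :* y :+ (v :+ b) :* x
                                     := (u :* y :+ v :* x) :+ (a :* y :+ b :* x)) refl x y u v a b))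
        }
      ; *-comm = λ (x , y) (u , v) → cong₂ _,_
          (solve 4 (λ x y u v → x :* u :+ :- (y :* v) := u :* x :+ :- (v :* y)) refl x y u v)
          (solve 4 (λ x y u v → x :* v :+ y :* u := u :* y :+ v :* x) refl x y u v)
      }
    }

module ℚ[i] = CommutativeRing ℚ[i]-commutativeRing

module ℚ[i]-Solver = SimpleRingSolver (ACR.fromCommutativeRing ℚ[i]-commutativeRing) (≡-dec ℚₚ._≟_ ℚₚ._≟_)

private
  module G = ℚ[i]-Solver

infix 9 _at_

-- The operations on ℂ commute with `_at_` by computation, so that a ring identity in ℂ reduces to
-- the same identity in ℚ[i] at every index.
_at_ : ℂ → ℕ → ℚ[i]
z at n = seq (re z) n , seq (im z) n

pointwise-≈ᶜ : ∀ {z w} → (∀ n → z at n ≡ w at n) → z ≈ᶜ w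
pointwise-≈ᶜ {z} {w} z≡w = pointwise-≈ {re z} {re w} (λ n → cong proj₁ (z≡w n))
                         , pointwise-≈ {im z} {im w} (λ n → cong proj₂ (z≡w n))

-ᶜ_ : ℂ → ℂ
-ᶜ z = mkℂ (Defs.- re z) (Defs.- im z)

module Rℝ = CommutativeRing ℝ-commutativeRing

ℂ-commutativeRing : CommutativeRing 0ℓ 0ℓ
ℂ-commutativeRing = record
  { Carrier = ℂ
  ; _≈_ = _≈ᶜ_
  ; _+_ = _+ᶜ_
  ; _*_ = _*ᶜ_
  ; -_ = -ᶜ_
  ; 0# = 0ᶜ
  ; 1# = 1ᶜ
  ; isCommutativeRing = record
    { isRing = record
      { +-isAbelianGroup = record
        { isGroup = record
          { isMonoid = record
            { isSemigroup = record
              { isMagma = record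
                { isEquivalence = record
                  { refl  = λ {z} → ≈-refl {re z} , ≈-refl {im z}
                  ; sym   = λ {z} {w} (p , q) → ≈-sym {re z} {re w} p , ≈-sym {im z} {im w} q
                  ; trans = λ {z} {w} {v} (p , q) (p′ , q′) →
                      ≈-trans {re z} {re w} {re v} p p′ , ≈-trans {im z} {im w} {im v} q q′
                  }
                ; ∙-cong = λ {z} {z′} {w} {w′} (p , q) (p′ , q′) →
                    +ℝ-cong {re z} {re z′} {re w} {re w′} p p′ , +ℝ-cong {im z} {im z′} {im w} {im w′} q q′
                }
              ; assoc = λ z w v → pointwise-≈ᶜ {(z +ᶜ w) +ᶜ v} {z +ᶜ (w +ᶜ v)} λ n → ℚ[i].+-assoc (z at n) (w at n) (v at n)
              }
            ; identity = (λ z → pointwise-≈ᶜ {0ᶜ +ᶜ z} {z} λ n → ℚ[i].+-identityˡ (z at n))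
                       , (λ z → pointwise-≈ᶜ {z +ᶜ 0ᶜ} {z} λ n → ℚ[i].+-identityʳ (z at n))
            }
          ; inverse = (λ z → pointwise-≈ᶜ {(-ᶜ z) +ᶜ z} {0ᶜ} λ n → ℚ[i].-‿inverseˡ (z at n))
                    , (λ z → pointwise-≈ᶜ {z +ᶜ (-ᶜ z)} {0ᶜ} λ n → ℚ[i].-‿inverseʳ (z at n))
          ; ⁻¹-cong = λ {z} {w} (p , q) → -ℝ-cong {re z} {re w} p , -ℝ-cong {im z} {im w} q
          }
        ; comm = λ z w → pointwise-≈ᶜ {z +ᶜ w} {w +ᶜ z} λ n → ℚ[i].+-comm (z at n) (w at n)
        }
      ; *-cong = λ {z} {z′} {w} {w′} (p , q) (p′ , q′) →
          Rℝ.+-cong {re z Defs.* re w} {re z′ Defs.* re w′} {Defs.- (im z Defs.* im w)} {Defs.- (im z′ Defs.* im w′)}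
            (Rℝ.*-cong {re z} {re z′} {re w} {re w′} p p′)
            (Rℝ.-‿cong {im z Defs.* im w} {im z′ Defs.* im w′} (Rℝ.*-cong {im z} {im z′} {im w} {im w′} q q′))
        , Rℝ.+-cong {re z Defs.* im w} {re z′ Defs.* im w′} {im z Defs.* re w} {im z′ Defs.* re w′}
            (Rℝ.*-cong {re z} {re z′} {im w} {im w′} p q′)
            (Rℝ.*-cong {im z} {im z′} {re w} {re w′} q p′)
      ; *-assoc = λ z w v → pointwise-≈ᶜ {(z *ᶜ w) *ᶜ v} {z *ᶜ (w *ᶜ v)} λ n → ℚ[i].*-assoc (z at n) (w at n) (v at n)
      ; *-identity = (λ z → pointwise-≈ᶜ {1ᶜ *ᶜ z} {z} λ n → ℚ[i].*-identityˡ (z at n))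
                   , (λ z → pointwise-≈ᶜ {z *ᶜ 1ᶜ} {z} λ n → ℚ[i].*-identityʳ (z at n))
      ; distrib = (λ z w v → pointwise-≈ᶜ {z *ᶜ (w +ᶜ v)} {z *ᶜ w +ᶜ z *ᶜ v} λ n → ℚ[i].distribˡ (z at n) (w at n) (v at n))
                , (λ z w v → pointwise-≈ᶜ {(w +ᶜ v) *ᶜ z} {w *ᶜ z +ᶜ v *ᶜ z} λ n → ℚ[i].distribʳ (z at n) (w at n) (v at n))
      }
    ; *-comm = λ z w → pointwise-≈ᶜ {z *ᶜ w} {w *ᶜ z} λ n → ℚ[i].*-comm (z at n) (w at n)
    }
  }

-- The absolute value on ℂ

module _ where

  open Defs using (_+_; _*_; -_; ∣_∣)

  norm : ℂ → ℝ
  norm z = re z ² + im z ²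

  0≤norm : ∀ z → 0ℝ ≤ norm z
  0≤norm z = pointwise-≤ {0ℝ} {norm z} λ n → ℚₚ.+-mono-≤ (0≤p² (seq (re z) n)) (0≤p² (seq (im z) n))

  0≤∣_∣ : ∀ z → 0ℝ ≤ ∣ z ∣
  0≤∣ z ∣ = 0≤√ (norm z)

  ∣_∣² : ∀ z → ∣ z ∣ ² ≈ norm z
  ∣ z ∣² = √² {norm z} (0≤norm z)

  -- Identities between absolute values are checked on the squares, where `∣_∣²` removes the root.
  square-injective : ∀ {x y} → 0ℝ ≤ x → 0ℝ ≤ y → x ² ≈ y ² → x ≈ y
  square-injective {x} {y} 0≤x 0≤y x²≈y² = ≤-antisym {x} {y}
    (square-cancel-≤ {x} {y} 0≤y (≤-reflexive {x ²} {y ²} x²≈y²))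
    (square-cancel-≤ {y} {x} 0≤x (≤-reflexive {y ²} {x ²} (≈-sym {x ²} {y ²} x²≈y²)))

  ∣∣-cong-norm : ∀ z w → norm z ≈ norm w → ∣ z ∣ ≈ ∣ w ∣
  ∣∣-cong-norm z w eq = square-injective {∣ z ∣} {∣ w ∣} 0≤∣ z ∣ 0≤∣ w ∣
    (≈-trans {∣ z ∣ ²} {norm z} {∣ w ∣ ²} ∣ z ∣²
      (≈-trans {norm z} {norm w} {∣ w ∣ ²} eq (≈-sym {∣ w ∣ ²} {norm w} ∣ w ∣²)))

  ∣∣-cong : ∀ {z w} → z ≈ᶜ w → ∣ z ∣ ≈ ∣ w ∣
  ∣∣-cong {z} {w} (p , q) = ∣∣-cong-norm z w (+ℝ-cong {re z ²} {re w ²} {im z ²} {im w ²}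
    (*ℝ-cong {re z} {re w} {re z} {re w} p p) (*ℝ-cong {im z} {im w} {im z} {im w} q q))

  ∣conj∣ : ∀ z → ∣ conj z ∣ ≈ ∣ z ∣
  ∣conj∣ z = ∣∣-cong-norm (conj z) z (pointwise-≈ {norm (conj z)} {norm z} λ n →
    solve 2 (λ x y → x :* x :+ (:- y) :* (:- y) := x :* x :+ y :* y) refl (seq (re z) n) (seq (im z) n))

  ∣∣-* : ∀ z w → ∣ z *ᶜ w ∣ ≈ ∣ z ∣ * ∣ w ∣
  ∣∣-* z w = square-injective {∣ z *ᶜ w ∣} {∣ z ∣ * ∣ w ∣} 0≤∣ z *ᶜ w ∣ (0≤ℝ* {∣ z ∣} {∣ w ∣} 0≤∣ z ∣ 0≤∣ w ∣) (begin
    ∣ z *ᶜ w ∣ ²             ≈⟨ ∣ z *ᶜ w ∣² ⟩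
    norm (z *ᶜ w)            ≈⟨ pointwise-≈ {norm (z *ᶜ w)} {norm z * norm w} (λ n →
                                  solve 4 (λ x y u v → (x :* u :+ :- (y :* v)) :* (x :* u :+ :- (y :* v)) :+ (x :* v :+ y :* u) :* (x :* v :+ y :* u)
                                                    := (x :* x :+ y :* y) :* (u :* u :+ v :* v)) refl
                                    (seq (re z) n) (seq (im z) n) (seq (re w) n) (seq (im w) n)) ⟩
    norm z * norm w          ≈⟨ *ℝ-cong {∣ z ∣ ²} {norm z} {∣ w ∣ ²} {norm w} ∣ z ∣² ∣ w ∣² ⟨
    ∣ z ∣ ² * ∣ w ∣ ²        ≈⟨ pointwise-≈ {∣ z ∣ ² * ∣ w ∣ ²} {(∣ z ∣ * ∣ w ∣) ²} (λ n →
                                  solve 2 (λ x y → (x :* x) :* (y :* y) := (x :* y) :* (x :* y)) refl (seq ∣ z ∣ n) (seq ∣ w ∣ n)) ⟩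
    (∣ z ∣ * ∣ w ∣) ²        ∎)
    where open import Relation.Binary.Reasoning.Setoid (CommutativeRing.setoid ℝ-commutativeRing)

  re≤∣_∣ : ∀ z → re z ≤ ∣ z ∣
  re≤∣ z ∣ = square-cancel-≤ {re z} {∣ z ∣} 0≤∣ z ∣ (≤-trans {re z ²} {norm z} {∣ z ∣ ²}
    (pointwise-≤ {re z ²} {norm z} λ n → p≤p+q (0≤p² (seq (im z) n)))
    (≤-reflexive {norm z} {∣ z ∣ ²} (≈-sym {∣ z ∣ ²} {norm z} ∣ z ∣²)))

  ∣∣²-+ : ∀ z w → ∣ z +ᶜ w ∣ ² ≈ ∣ z ∣ ² + ∣ w ∣ ² + (re (w *ᶜ conj z) + re (w *ᶜ conj z))
  ∣∣²-+ z w = begin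
    ∣ z +ᶜ w ∣ ²                 ≈⟨ ∣ z +ᶜ w ∣² ⟩
    norm (z +ᶜ w)                ≈⟨ pointwise-≈ {norm (z +ᶜ w)} {norm z + norm w + (c + c)} (λ n →
        solve 4 (λ x y u v → (x :+ u) :* (x :+ u) :+ (y :+ v) :* (y :+ v)
                          := (x :* x :+ y :* y) :+ (u :* u :+ v :* v) :+
                             ((u :* x :+ :- (v :* :- y)) :+ (u :* x :+ :- (v :* :- y)))) refl
          (seq (re z) n) (seq (im z) n) (seq (re w) n) (seq (im w) n)) ⟩
    norm z + norm w + (c + c)    ≈⟨ +ℝ-cong {∣ z ∣ ² + ∣ w ∣ ²} {norm z + norm w} {c + c} {c + c}
                                     (+ℝ-cong {∣ z ∣ ²} {norm z} {∣ w ∣ ²} {norm w} ∣ z ∣² ∣ w ∣²) (≈-refl {c + c}) ⟨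
    ∣ z ∣ ² + ∣ w ∣ ² + (c + c)  ∎
    where
    open import Relation.Binary.Reasoning.Setoid (CommutativeRing.setoid ℝ-commutativeRing)
    c = re (w *ᶜ conj z)

module _ where

  open ℚ using (_+_; _*_; _-_; -_; ∣_∣) renaming (_≤_ to _≤ℚ_; _<_ to _<ℚ_)

  -- The exponential function

  -- The ℓ¹ norm: it is submultiplicative like the Euclidean one, but has rational values.
  ‖_‖ : ℚ[i] → ℚ
  ‖ x , y ‖ = ∣ x ∣ + ∣ y ∣

  ι : ℚ → ℚ[i]
  ι q = q , 0ℚ

  0≤‖_‖ : ∀ z → 0ℚ ≤ℚ ‖ z ‖
  0≤‖ x , y ‖ = ℚₚ.+-mono-≤ (ℚₚ.0≤∣p∣ x) (ℚₚ.0≤∣p∣ y)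

  ‖+‖ : ∀ z w → ‖ z +ᵍ w ‖ ≤ℚ ‖ z ‖ + ‖ w ‖
  ‖+‖ (x , y) (u , v) = begin
    ∣ x + u ∣ + ∣ y + v ∣                  ≤⟨ ℚₚ.+-mono-≤ (ℚₚ.∣p+q∣≤∣p∣+∣q∣ x u) (ℚₚ.∣p+q∣≤∣p∣+∣q∣ y v) ⟩
    (∣ x ∣ + ∣ u ∣) + (∣ y ∣ + ∣ v ∣) ≡⟨ solve 4 (λ x y u v → (x :+ u) :+ (y :+ v) := (x :+ y) :+ (u :+ v)) refl (∣ x ∣) (∣ y ∣) (∣ u ∣) (∣ v ∣) ⟩
    (∣ x ∣ + ∣ y ∣) + (∣ u ∣ + ∣ v ∣)      ∎
    where open ℚₚ.≤-Reasoning

  ‖*‖ : ∀ z w → ‖ z *ᵍ w ‖ ≤ℚ ‖ z ‖ * ‖ w ‖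
  ‖*‖ (x , y) (u , v) = ∥∥-* (mkℂ (fromℚ x) (fromℚ y)) (mkℂ (fromℚ u) (fromℚ v)) 0

  ‖*‖-mono : ∀ {z w a b} → ‖ z ‖ ≤ℚ a → ‖ w ‖ ≤ℚ b → ‖ z *ᵍ w ‖ ≤ℚ a * b
  ‖*‖-mono {z} {w} z≤ w≤ = ℚₚ.≤-trans (‖*‖ z w) (*-mono-≤ 0≤‖ z ‖ (ℚₚ.≤-trans 0≤‖ w ‖ w≤) z≤ w≤)

  ‖+‖-mono : ∀ {z w a b} → ‖ z ‖ ≤ℚ a → ‖ w ‖ ≤ℚ b → ‖ z +ᵍ w ‖ ≤ℚ a + b
  ‖+‖-mono {z} {w} z≤ w≤ = ℚₚ.≤-trans (‖+‖ z w) (ℚₚ.+-mono-≤ z≤ w≤)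

  ‖-_‖ : ∀ z → ‖ -ᵍ z ‖ ≡ ‖ z ‖
  ‖- x , y ‖ = cong₂ _+_ (ℚₚ.∣-p∣≡∣p∣ x) (ℚₚ.∣-p∣≡∣p∣ y)

  ‖ι‖ : ∀ {q} → 0ℚ ≤ℚ q → ‖ ι q ‖ ≡ q
  ‖ι‖ {q} 0≤q = trans (ℚₚ.+-identityʳ ∣ q ∣) (ℚₚ.0≤p⇒∣p∣≡p 0≤q)

  ι-* : ∀ q x y → ι q *ᵍ (x , y) ≡ (q * x , q * y)
  ι-* q x y = cong₂ _,_ (solve 3 (λ q x y → q :* x :+ :- (con 0ℚ :* y) := q :* x) refl q x y)
                        (solve 3 (λ q x y → q :* y :+ con 0ℚ :* x := q :* y) refl q x y)

  ‖ι*‖ : ∀ {q} z → 0ℚ ≤ℚ q → ‖ ι q *ᵍ z ‖ ≡ q * ‖ z ‖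
  ‖ι*‖ {q} (x , y) 0≤q = trans (cong ‖_‖ (ι-* q x y)) (trans
    (cong₂ _+_ (abs x) (abs y)) (sym (ℚₚ.*-distribˡ-+ q ∣ x ∣ ∣ y ∣)))
    where
    abs : ∀ x → ∣ q * x ∣ ≡ q * ∣ x ∣
    abs x = trans (ℚₚ.∣p*q∣≡∣p∣*∣q∣ q x) (cong (_* ∣ x ∣) (ℚₚ.0≤p⇒∣p∣≡p 0≤q))

  ι-+-homo : ∀ p q → ι (p + q) ≡ ι p +ᵍ ι q
  ι-+-homo p q = cong (p + q ,_) (sym (ℚₚ.+-identityʳ 0ℚ))

  ι-*-homo : ∀ p q → ι (p * q) ≡ ι p *ᵍ ι q
  ι-*-homo p q = sym (trans (ι-* p q 0ℚ) (cong (p * q ,_) (ℚₚ.*-zeroʳ p)))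

  infixr 8 _^ᵍ_

  _^ᵍ_ : ℚ[i] → ℕ → ℚ[i]
  z ^ᵍ zero  = 1ᵍ
  z ^ᵍ suc n = z *ᵍ z ^ᵍ n

  1/_! : ℕ → ℚ
  1/ n ! = (+ 1 / n !) {{n ℕₚ.!≢0}}

  term : ℚ[i] → ℕ → ℚ[i]
  term z n = ι 1/ n ! *ᵍ z ^ᵍ n

  partial : ℚ[i] → ℕ → ℚ[i]
  partial z zero    = 0ᵍ
  partial z (suc n) = partial z n +ᵍ term z n

  ^-at : ∀ z n m → (z ^ᶜ n) at m ≡ (z at m) ^ᵍ n
  ^-at z zero    m = refl
  ^-at z (suc n) m = cong ((z at m) *ᵍ_) (^-at z n m)

  expTerm-at : ∀ z n m → expTerm z n at m ≡ term (z at m) n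
  expTerm-at z n m = trans (sym (ι-* 1/ n ! (seq (re (z ^ᶜ n)) m) (seq (im (z ^ᶜ n)) m))) (cong (ι 1/ n ! *ᵍ_) (^-at z n m))

  expSum-at : ∀ z n m → expSum z n at m ≡ partial (z at m) n
  expSum-at z zero    m = refl
  expSum-at z (suc n) m = cong₂ _+ᵍ_ (expSum-at z n m) (expTerm-at z n m)

  -- Through this equation statements on `exp` become estimates for finite sums of Gaussian
  -- rationals, with errors that tend to 0 in n.
  exp-at : ∀ z n → exp z at n ≡ partial (z at n) n
  exp-at z n = expSum-at z n n

  -- The recurrence of the series, free of division: estimates are made after multiplication by the
  -- index, which is cancelled at the end.
  term-suc : ∀ z n → ι (+ suc n / 1) *ᵍ term z (suc n) ≡ z *ᵍ term z n
  term-suc z n = begin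
    ι (+ suc n / 1) *ᵍ (ι 1/ suc n ! *ᵍ (z *ᵍ z ^ᵍ n)) ≡⟨ G.solve 4 (λ a b z p → a G.:* (b G.:* (z G.:* p)) G.:= (a G.:* b) G.:* (z G.:* p)) refl (ι (+ suc n / 1)) (ι 1/ suc n !) z (z ^ᵍ n) ⟩
    (ι (+ suc n / 1) *ᵍ ι 1/ suc n !) *ᵍ (z *ᵍ z ^ᵍ n) ≡⟨ cong (_*ᵍ (z *ᵍ z ^ᵍ n)) (trans (sym (ι-*-homo (+ suc n / 1) 1/ suc n !)) (cong ι coeff)) ⟩
    ι 1/ n ! *ᵍ (z *ᵍ z ^ᵍ n) ≡⟨ G.solve 3 (λ b z p → b G.:* (z G.:* p) G.:= z G.:* (b G.:* p)) refl (ι 1/ n !) z (z ^ᵍ n) ⟩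
    z *ᵍ (ι 1/ n ! *ᵍ z ^ᵍ n)                            ∎
    where
    open ≡-Reasoning
    nz : NonZero (1 ℕ.* suc n !)
    nz = ℕₚ.m*n≢0 1 (suc n !) {{_}} {{suc n ℕₚ.!≢0}}
    coeff : (+ suc n / 1) * 1/ suc n ! ≡ 1/ n !
    coeff = trans (/-* (suc n) 1 1 (suc n !) {{_}} {{suc n ℕₚ.!≢0}} {{nz}})
      (/-≡ (suc n ℕ.* 1) (1 ℕ.* suc n !) 1 (n !) {{nz}} {{n ℕₚ.!≢0}}
        (trans (cong (ℕ._* n !) (ℕₚ.*-identityʳ (suc n))) (sym (trans (ℕₚ.*-identityˡ (1 ℕ.* suc n !)) (ℕₚ.*-identityˡ (suc n !))))))

  term-zero : ∀ z → term z 0 ≡ 1ᵍ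
  term-zero z = trans (cong (λ c → ι c *ᵍ 1ᵍ) 1/1≡1) (ℚ[i].*-identityʳ 1ᵍ)

  term-one : ∀ z → term z 1 ≡ z
  term-one z = trans (cong (λ c → ι c *ᵍ (z *ᵍ 1ᵍ)) 1/1≡1) (trans (ℚ[i].*-identityˡ (z *ᵍ 1ᵍ)) (ℚ[i].*-identityʳ z))

  majorant-suc : ∀ b n → (+ suc n / 1) * majorant b (suc n) ≡ (+ b / 1) * majorant b n
  majorant-suc b n = trans (/-* (suc n) 1 (b ℕ.^ suc n) (suc n !) {{_}} {{suc n ℕₚ.!≢0}} {{nz}})
    (trans (/-≡ (suc n ℕ.* b ℕ.^ suc n) (1 ℕ.* suc n !) (b ℕ.* b ℕ.^ n) (1 ℕ.* n !) {{nz}} {{nz′}} eq)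
      (sym (/-* b 1 (b ℕ.^ n) (n !) {{_}} {{n ℕₚ.!≢0}} {{nz′}})))
    where
    nz : NonZero (1 ℕ.* suc n !)
    nz = ℕₚ.m*n≢0 1 (suc n !) {{_}} {{suc n ℕₚ.!≢0}}
    nz′ : NonZero (1 ℕ.* n !)
    nz′ = ℕₚ.m*n≢0 1 (n !) {{_}} {{n ℕₚ.!≢0}}
    eq : suc n ℕ.* b ℕ.^ suc n ℕ.* (1 ℕ.* n !) ≡ b ℕ.* b ℕ.^ n ℕ.* (1 ℕ.* suc n !)
    eq = trans (cong (suc n ℕ.* b ℕ.^ suc n ℕ.*_) (ℕₚ.*-identityˡ (n !)))
        (trans (cong (ℕ._* n !) (ℕₚ.*-comm (suc n) (b ℕ.^ suc n)))
        (trans (ℕₚ.*-assoc (b ℕ.^ suc n) (suc n) (n !))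
               (cong (b ℕ.^ suc n ℕ.*_) (sym (ℕₚ.*-identityˡ (suc n !))))))

  ‖^‖ : ∀ {z b} → ‖ z ‖ ≤ℚ + b / 1 → ∀ n → ‖ z ^ᵍ n ‖ ≤ℚ + (b ℕ.^ n) / 1
  ‖^‖ {z} z≤b zero = ℚₚ.≤-reflexive (trans (‖ι‖ (ℚₚ.<⇒≤ 0<1)) (sym 1/1≡1))
  ‖^‖ {z} {b} z≤b (suc n) = subst (‖ z ^ᵍ suc n ‖ ≤ℚ_) (/-* b 1 (b ℕ.^ n) 1) (‖*‖-mono {z} {z ^ᵍ n} z≤b (‖^‖ {z} z≤b n))

  ‖term‖ : ∀ {z b} → ‖ z ‖ ≤ℚ + b / 1 → ∀ n → ‖ term z n ‖ ≤ℚ majorant b n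
  ‖term‖ {z} {b} z≤b n = begin
    ‖ term z n ‖                 ≡⟨ ‖ι*‖ {1/ n !} (z ^ᵍ n) (0≤/ 1 (n !) {{n ℕₚ.!≢0}}) ⟩
    1/ n ! * ‖ z ^ᵍ n ‖          ≤⟨ p≤∣p∣ (1/ n ! * ‖ z ^ᵍ n ‖) ⟩
    ∣ 1/ n ! * ‖ z ^ᵍ n ‖ ∣      ≤⟨ scaled-≤-majorant b n ‖ z ^ᵍ n ‖ (subst (_≤ℚ + (b ℕ.^ n) / 1)
                                      (sym (ℚₚ.0≤p⇒∣p∣≡p 0≤‖ z ^ᵍ n ‖)) (‖^‖ {z} z≤b n)) ⟩
    majorant b n                 ∎
    where open ℚₚ.≤-Reasoning

  ‖partial‖ : ∀ {z b} → ‖ z ‖ ≤ℚ + b / 1 → ∀ n → ‖ partial z n ‖ ≤ℚ ∑ℚ n (majorant b)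
  ‖partial‖ z≤b zero = ℚₚ.≤-refl
  ‖partial‖ {z} z≤b (suc n) = ‖+‖-mono {partial z n} {term z n} (‖partial‖ {z} z≤b n) (‖term‖ {z} z≤b n)

-- Taylor estimates for the partial sums of the exponential series

module _ where

  open ℚ using (_+_; _*_; _-_; -_; ∣_∣) renaming (_≤_ to _≤ℚ_; _<_ to _<ℚ_)

  module _ (z h : ℚ[i]) where

    -- The second-order Taylor remainder of the term of index k + 2.
    remainder : ℕ → ℚ[i]
    remainder k = term (z +ᵍ h) (suc (suc k)) +ᵍ -ᵍ term z (suc (suc k)) +ᵍ -ᵍ (h *ᵍ term z (suc k))

    -- Comes from `term-suc` at z and at z + h. The recurrence stands in for the binomial expansion
    -- of (z + h)ⁿ in the bound for the remainder.
    remainder-suc : ∀ k → ι (+ suc (suc (suc k)) / 1) *ᵍ remainder (suc k) ≡ (z +ᵍ h) *ᵍ remainder k +ᵍ h *ᵍ h *ᵍ term z (suc k)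
    remainder-suc k = begin
      N₃ *ᵍ (T₃ +ᵍ -ᵍ t₃ +ᵍ -ᵍ (h *ᵍ t₂))
        ≡⟨ G.solve 5 (λ N T t h t′ → N G.:* (T G.:- t G.:- h G.:* t′) G.:= N G.:* T G.:- N G.:* t G.:- h G.:* (N G.:* t′)) refl N₃ T₃ t₃ h t₂ ⟩
      N₃ *ᵍ T₃ +ᵍ -ᵍ (N₃ *ᵍ t₃) +ᵍ -ᵍ (h *ᵍ (N₃ *ᵍ t₂))
        ≡⟨ cong₂ _+ᵍ_ (cong₂ (λ a b → a +ᵍ -ᵍ b) (term-suc (z +ᵍ h) (suc (suc k))) (term-suc z (suc (suc k))))
                      (cong (λ a → -ᵍ (h *ᵍ (a *ᵍ t₂))) (trans (cong ι (/-suc (suc (suc k)))) (ι-+-homo (+ suc (suc k) / 1) 1ℚ))) ⟩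
      (z +ᵍ h) *ᵍ T₂ +ᵍ -ᵍ (z *ᵍ t₂) +ᵍ -ᵍ (h *ᵍ ((N₂ +ᵍ 1ᵍ) *ᵍ t₂))
        ≡⟨ G.solve 5 (λ z h T t N → (z G.:+ h) G.:* T G.:- z G.:* t G.:- h G.:* ((N G.:+ G.con 1ᵍ) G.:* t)
                               G.:= (z G.:+ h) G.:* (T G.:- t) G.:- h G.:* (N G.:* t)) refl z h T₂ t₂ N₂ ⟩
      (z +ᵍ h) *ᵍ (T₂ +ᵍ -ᵍ t₂) +ᵍ -ᵍ (h *ᵍ (N₂ *ᵍ t₂))
        ≡⟨ cong (λ a → (z +ᵍ h) *ᵍ (T₂ +ᵍ -ᵍ t₂) +ᵍ -ᵍ (h *ᵍ a)) (term-suc z (suc k)) ⟩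
      (z +ᵍ h) *ᵍ (T₂ +ᵍ -ᵍ t₂) +ᵍ -ᵍ (h *ᵍ (z *ᵍ t₁))
        ≡⟨ G.solve 5 (λ z h T t t′ → (z G.:+ h) G.:* (T G.:- t) G.:- h G.:* (z G.:* t′)
                                G.:= (z G.:+ h) G.:* (T G.:- t G.:- h G.:* t′) G.:+ h G.:* h G.:* t′) refl z h T₂ t₂ t₁ ⟩
      (z +ᵍ h) *ᵍ (T₂ +ᵍ -ᵍ t₂ +ᵍ -ᵍ (h *ᵍ t₁)) +ᵍ h *ᵍ h *ᵍ t₁ ∎
      where
      open ≡-Reasoning
      N₂ = ι (+ suc (suc k) / 1)
      N₃ = ι (+ suc (suc (suc k)) / 1)
      T₂ = term (z +ᵍ h) (suc (suc k))
      T₃ = term (z +ᵍ h) (suc (suc (suc k)))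
      t₁ = term z (suc k)
      t₂ = term z (suc (suc k))
      t₃ = term z (suc (suc (suc k)))

    remainder-zero : ι (+ 2 / 1) *ᵍ remainder 0 ≡ h *ᵍ h
    remainder-zero = begin
      N₂ *ᵍ (T₂ +ᵍ -ᵍ t₂ +ᵍ -ᵍ (h *ᵍ term z 1))
        ≡⟨ G.solve 5 (λ N T t h t′ → N G.:* (T G.:- t G.:- h G.:* t′) G.:= N G.:* T G.:- N G.:* t G.:- N G.:* (h G.:* t′)) refl N₂ T₂ t₂ h (term z 1) ⟩
      N₂ *ᵍ T₂ +ᵍ -ᵍ (N₂ *ᵍ t₂) +ᵍ -ᵍ (N₂ *ᵍ (h *ᵍ term z 1))
        ≡⟨ cong₂ _+ᵍ_ (cong₂ (λ a b → a +ᵍ -ᵍ b)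
             (trans (term-suc (z +ᵍ h) 1) (cong ((z +ᵍ h) *ᵍ_) (term-one (z +ᵍ h))))
             (trans (term-suc z 1) (cong (z *ᵍ_) (term-one z))))
             (cong₂ (λ a b → -ᵍ (a *ᵍ (h *ᵍ b)))
               (trans (cong ι (trans (/-suc 1) (cong (_+ 1ℚ) 1/1≡1))) (ι-+-homo 1ℚ 1ℚ)) (term-one z)) ⟩
      (z +ᵍ h) *ᵍ (z +ᵍ h) +ᵍ -ᵍ (z *ᵍ z) +ᵍ -ᵍ ((1ᵍ +ᵍ 1ᵍ) *ᵍ (h *ᵍ z))
        ≡⟨ G.solve 2 (λ z h → (z G.:+ h) G.:* (z G.:+ h) G.:- z G.:* z G.:- (G.con 1ᵍ G.:+ G.con 1ᵍ) G.:* (h G.:* z) G.:= h G.:* h) refl z h ⟩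
      h *ᵍ h ∎
      where
      open ≡-Reasoning
      N₂ = ι (+ 2 / 1)
      T₂ = term (z +ᵍ h) 2
      t₂ = term z 2

    module _ {b : ℕ} (z≤b : ‖ z ‖ ≤ℚ + b / 1) (z+h≤b : ‖ z +ᵍ h ‖ ≤ℚ + b / 1) where

      private
        H = ‖ h ‖ * ‖ h ‖
        0≤H : 0ℚ ≤ℚ H
        0≤H = 0≤* 0≤‖ h ‖ 0≤‖ h ‖

      -- Put m(k) = bᵏ/k!. Since b m(k) = (k + 1) m(k + 1), the recurrence bounds k + 3 times the
      -- next remainder by (k + 2) |h|² m(k + 1), so there is room to divide by k + 3.
      ‖remainder‖ : ∀ k → ‖ remainder k ‖ ≤ℚ H * majorant b k
      ‖remainder‖ zero = ℚₚ.*-cancelˡ-≤-pos (+ 2 / 1) {{ℚ.positive (0</ 2 1)}} (begin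
        (+ 2 / 1) * ‖ remainder 0 ‖            ≡⟨ ‖ι*‖ (remainder 0) (0≤/ 2 1) ⟨
        ‖ ι (+ 2 / 1) *ᵍ remainder 0 ‖         ≡⟨ cong ‖_‖ remainder-zero ⟩
        ‖ h *ᵍ h ‖                             ≤⟨ ‖*‖ h h ⟩
        H                                      ≤⟨ p≤p+q 0≤H ⟩
        H + H                                  ≡⟨ cong (λ x → x + x) (ℚₚ.*-identityʳ H) ⟨
        H * 1ℚ + H * 1ℚ                        ≡⟨ cong (λ c → H * c + H * c) 1/1≡1 ⟨
        H * majorant b 0 + H * majorant b 0    ≡⟨ 2/1* (H * majorant b 0) ⟨
        (+ 2 / 1) * (H * majorant b 0)         ∎)
        where open ℚₚ.≤-Reasoning
      ‖remainder‖ (suc k) = ℚₚ.*-cancelˡ-≤-pos N₃ {{ℚ.positive (0</ (suc (suc (suc k))) 1)}} (begin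
        N₃ * ‖ remainder (suc k) ‖ ≡⟨ ‖ι*‖ (remainder (suc k)) (0≤/ (suc (suc (suc k))) 1) ⟨
        ‖ ι N₃ *ᵍ remainder (suc k) ‖                          ≡⟨ cong ‖_‖ (remainder-suc k) ⟩
        ‖ (z +ᵍ h) *ᵍ remainder k +ᵍ h *ᵍ h *ᵍ term z (suc k) ‖
          ≤⟨ ‖+‖-mono {(z +ᵍ h) *ᵍ remainder k} {h *ᵍ h *ᵍ term z (suc k)}
               (‖*‖-mono {z +ᵍ h} {remainder k} z+h≤b (‖remainder‖ k))
               (‖*‖-mono {h *ᵍ h} {term z (suc k)} (‖*‖ h h) (‖term‖ {z} z≤b (suc k))) ⟩
        (+ b / 1) * (H * majorant b k) + H * majorant b (suc k)
          ≡⟨ cong (_+ H * M) (solve 3 (λ b H m → b :* (H :* m) := H :* (b :* m)) refl (+ b / 1) H (majorant b k)) ⟩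
        H * ((+ b / 1) * majorant b k) + H * M ≡⟨ cong (λ x → H * x + H * M) (majorant-suc b k) ⟨
        H * (N₁ * M) + H * M ≤⟨ p≤p+q (0≤* 0≤H (majorant-nonneg b (suc k))) ⟩
        H * (N₁ * M) + H * M + H * M
          ≡⟨ solve 3 (λ H N M → H :* (N :* M) :+ H :* M :+ H :* M := (N :+ con 1ℚ :+ con 1ℚ) :* (H :* M)) refl H N₁ M ⟩
        (N₁ + 1ℚ + 1ℚ) * (H * M) ≡⟨ cong (_* (H * M)) (trans (/-suc (suc (suc k))) (cong (_+ 1ℚ) (/-suc (suc k)))) ⟨
        N₃ * (H * M)                                           ∎)
        where
        open ℚₚ.≤-Reasoning
        N₁ = + suc k / 1
        N₃ = + suc (suc (suc k)) / 1
        M = majorant b (suc k)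

      private
        Δ : ℕ → ℚ[i]
        Δ n = partial (z +ᵍ h) (2+ n) +ᵍ -ᵍ partial z (2+ n) +ᵍ -ᵍ (h *ᵍ partial z (suc n))

        Δ-zero : Δ 0 ≡ 0ᵍ
        Δ-zero = trans (cong₂ (λ a b → a +ᵍ -ᵍ b +ᵍ -ᵍ (h *ᵍ (0ᵍ +ᵍ term z 0))) (partial-two (z +ᵍ h)) (partial-two z))
          (trans (cong (λ a → (1ᵍ +ᵍ (z +ᵍ h)) +ᵍ -ᵍ (1ᵍ +ᵍ z) +ᵍ -ᵍ (h *ᵍ (0ᵍ +ᵍ a))) (term-zero z))
            (G.solve 2 (λ z h → (G.con 1ᵍ G.:+ (z G.:+ h)) G.:- (G.con 1ᵍ G.:+ z) G.:- h G.:* (G.con 0ᵍ G.:+ G.con 1ᵍ) G.:= G.con 0ᵍ) refl z h))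
          where
          partial-two : ∀ z → partial z 2 ≡ 1ᵍ +ᵍ z
          partial-two z = cong₂ _+ᵍ_ (trans (ℚ[i].+-identityˡ (term z 0)) (term-zero z)) (term-one z)

        ‖Δ‖ : ∀ n → ‖ Δ n ‖ ≤ℚ H * ∑ℚ n (majorant b)
        ‖Δ‖ zero = ℚₚ.≤-reflexive (trans (cong ‖_‖ Δ-zero) (sym (ℚₚ.*-zeroʳ H)))
        ‖Δ‖ (suc n) = begin
          ‖ Δ (suc n) ‖                  ≡⟨ cong ‖_‖ (G.solve 7 (λ A T B t C u h →
                (A G.:+ T) G.:- (B G.:+ t) G.:- h G.:* (C G.:+ u) G.:= (A G.:- B G.:- h G.:* C) G.:+ (T G.:- t G.:- h G.:* u)) refl
                (partial (z +ᵍ h) (2+ n)) (term (z +ᵍ h) (2+ n)) (partial z (2+ n)) (term z (2+ n))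
                (partial z (suc n)) (term z (suc n)) h) ⟩
          ‖ Δ n +ᵍ remainder n ‖         ≤⟨ ‖+‖-mono {Δ n} {remainder n} (‖Δ‖ n) (‖remainder‖ n) ⟩
          H * ∑ℚ n (majorant b) + H * majorant b n  ≡⟨ ℚₚ.*-distribˡ-+ H (∑ℚ n (majorant b)) (majorant b n) ⟨
          H * ∑ℚ (suc n) (majorant b)    ∎
          where open ℚₚ.≤-Reasoning

      -- The first error is the accumulated Taylor remainder. The second comes from truncation: the
      -- derivative of a sum of n + 2 terms is the sum of n + 1 terms, one short of the sum that 1 +
      -- h multiplies.
      partial-derivative : ∀ n → ‖ partial (z +ᵍ h) (2+ n) +ᵍ -ᵍ ((1ᵍ +ᵍ h) *ᵍ partial z (2+ n)) ‖
                               ≤ℚ ‖ h ‖ * ‖ h ‖ * ∑ℚ n (majorant b) + ‖ h ‖ * majorant b (suc n)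
      partial-derivative n = begin
        ‖ A +ᵍ -ᵍ ((1ᵍ +ᵍ h) *ᵍ (B +ᵍ t)) ‖    ≡⟨ cong ‖_‖ (G.solve 4 (λ A B t h →
             A G.:- (G.con 1ᵍ G.:+ h) G.:* (B G.:+ t) G.:= (A G.:- (B G.:+ t) G.:- h G.:* B) G.:+ G.:- (h G.:* t)) refl A B t h) ⟩
        ‖ Δ n +ᵍ -ᵍ (h *ᵍ t) ‖ ≤⟨ ‖+‖-mono {Δ n} { -ᵍ (h *ᵍ t)} (‖Δ‖ n) (subst (_≤ℚ ‖ h ‖ * majorant b (suc n)) (sym ‖- h *ᵍ t ‖)
                                                    (‖*‖-mono {h} {t} ℚₚ.≤-refl (‖term‖ {z} z≤b (suc n)))) ⟩
        H * ∑ℚ n (majorant b) + ‖ h ‖ * majorant b (suc n) ∎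
        where
        open ℚₚ.≤-Reasoning
        A = partial (z +ᵍ h) (2+ n)
        B = partial z (suc n)
        t = term z (suc n)

  ∑ℚ-majorant-≤ : ∀ b n k → ∑ℚ n (majorant b) ≤ℚ ∑ℚ (k ℕ.+ n) (majorant b)
  ∑ℚ-majorant-≤ b n zero    = ℚₚ.≤-refl
  ∑ℚ-majorant-≤ b n (suc k) = ℚₚ.≤-trans (∑ℚ-majorant-≤ b n k) (p≤p+q (majorant-nonneg b (k ℕ.+ n)))

  ∑ℚ-majorant-tail : ∀ b k → 2 ℕ.* b ℕ.≤ k → ∀ i → ∑ℚ (i ℕ.+ k) (majorant b) ≤ℚ ∑ℚ k (majorant b) + (+ 2 / 1) * majorant b k
  ∑ℚ-majorant-tail b k 2b≤k i = p-q≤r⇒p≤q+r (ℚₚ.≤-trans (p≤∣p∣ _)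
    (majorised-tail b (λ n → ∑ℚ n (majorant b)) (majorant b) (λ _ → refl)
      (λ n → ℚₚ.≤-reflexive (ℚₚ.0≤p⇒∣p∣≡p (majorant-nonneg b n))) k 2b≤k i))

  ∑ℚ-majorant-bounded : ∀ b → ∃[ E ] (∀ n → ∑ℚ n (majorant b) ≤ℚ E)
  ∑ℚ-majorant-bounded b = E , λ n → ℚₚ.≤-trans (∑ℚ-majorant-≤ b n k)
    (subst (λ j → ∑ℚ j (majorant b) ≤ℚ E) (ℕₚ.+-comm n k) (∑ℚ-majorant-tail b k ℕₚ.≤-refl n))
    where
    k = 2 ℕ.* b
    E = ∑ℚ k (majorant b) + (+ 2 / 1) * majorant b k

  majorant-null : ∀ b → Null (majorant b)
  majorant-null b ε 0<ε =
    let k , 2b≤k , 2maj<ε = majorant-small b 0<ε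
    in k , λ n k≤n → subst (λ n → ∣ majorant b n ∣ <ℚ ε) (ℕₚ.m∸n+n≡m k≤n) (begin-strict
      ∣ majorant b (n ℕ.∸ k ℕ.+ k) ∣         ≡⟨ ℚₚ.0≤p⇒∣p∣≡p (majorant-nonneg b (n ℕ.∸ k ℕ.+ k)) ⟩
      majorant b (n ℕ.∸ k ℕ.+ k)             ≤⟨ le k 2b≤k (n ℕ.∸ k) ⟩
      (+ 2 / 1) * majorant b k               <⟨ 2maj<ε ⟩
      ε                                      ∎)
    where
    open ℚₚ.≤-Reasoning
    le : ∀ k → 2 ℕ.* b ℕ.≤ k → ∀ i → majorant b (i ℕ.+ k) ≤ℚ (+ 2 / 1) * majorant b k
    le k 2b≤k i = subst₂ _≤ℚ_ ([x+y]-x≡y s m) ([x+y]-x≡y s ((+ 2 / 1) * majorant b k))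
      (ℚₚ.+-monoˡ-≤ (- s) (ℚₚ.≤-trans (ℚₚ.+-monoˡ-≤ m (∑ℚ-majorant-≤ b k i)) (∑ℚ-majorant-tail b k 2b≤k (suc i))))
      where
      s = ∑ℚ k (majorant b)
      m = majorant b (i ℕ.+ k)

-- Euler's method and exp (z + w) exp (- w) = exp z

module _ where

  open ℚ using (_+_; _*_; _-_; -_; ∣_∣) renaming (_≤_ to _≤ℚ_; _<_ to _<ℚ_)

  telescope : ∀ (g : ℕ → ℚ[i]) {c} K → (∀ j → j ℕ.< K → ‖ g (suc j) +ᵍ -ᵍ g j ‖ ≤ℚ c) →
              ‖ g K +ᵍ -ᵍ g 0 ‖ ≤ℚ (+ K / 1) * c
  telescope g {c} zero    step = ℚₚ.≤-reflexive (trans (cong ‖_‖ (ℚ[i].-‿inverseʳ (g 0)))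
    (sym (trans (cong (_* c) 0/1≡0) (ℚₚ.*-zeroˡ c))))
  telescope g {c} (suc K) step = begin
    ‖ g (suc K) +ᵍ -ᵍ g 0 ‖ ≡⟨ cong ‖_‖ (G.solve 3 (λ a b c → a G.:- c G.:= (b G.:- c) G.:+ (a G.:- b)) refl (g (suc K)) (g K) (g 0)) ⟩
    ‖ (g K +ᵍ -ᵍ g 0) +ᵍ (g (suc K) +ᵍ -ᵍ g K) ‖       ≤⟨ ‖+‖-mono {g K +ᵍ -ᵍ g 0} {g (suc K) +ᵍ -ᵍ g K}
                                                            (telescope g K (λ j j<K → step j (ℕₚ.m<n⇒m<1+n j<K))) (step K ℕₚ.≤-refl) ⟩
    (+ K / 1) * c + c ≡⟨ solve 2 (λ k c → k :* c :+ c := (k :+ con 1ℚ) :* c) refl (+ K / 1) c ⟩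
    (+ K / 1 + 1ℚ) * c                                 ≡⟨ cong (_* c) (/-suc K) ⟨
    (+ suc K / 1) * c                                  ∎
    where open ℚₚ.≤-Reasoning

  -- Euler's method for x′ = h x and y′ = - h y, whose product is constant.
  product-constant : ∀ (x y h : ℕ → ℚ[i]) K {E δ η} → 0ℚ ≤ℚ η →
    (∀ j → j ℕ.≤ K → ‖ x j ‖ ≤ℚ E) → (∀ j → j ℕ.≤ K → ‖ y j ‖ ≤ℚ E) → (∀ j → j ℕ.< K → ‖ h j ‖ ≤ℚ δ) →
    (∀ j → j ℕ.< K → ‖ x (suc j) +ᵍ -ᵍ ((1ᵍ +ᵍ h j) *ᵍ x j) ‖ ≤ℚ δ * η) →
    (∀ j → j ℕ.< K → ‖ y (suc j) +ᵍ -ᵍ ((1ᵍ +ᵍ -ᵍ h j) *ᵍ y j) ‖ ≤ℚ δ * η) →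
    ‖ x K *ᵍ y K +ᵍ -ᵍ (x 0 *ᵍ y 0) ‖ ≤ℚ (+ K / 1) * (δ * η * E + (1ℚ + δ) * E * (δ * η) + δ * δ * (E * E))
  product-constant x y h K {E} {δ} {η} 0≤η x≤E y≤E h≤δ x-step y-step = telescope (λ j → x j *ᵍ y j) K λ j j<K → begin
    ‖ x (suc j) *ᵍ y (suc j) +ᵍ -ᵍ (x j *ᵍ y j) ‖
      -- As (1 + h)(1 - h) = 1 - h², exact Euler steps would change the product only by h² x y; the
      -- other two summands are the errors of the steps.
      ≡⟨ cong ‖_‖ (G.solve 5 (λ x′ y′ x y h →
           x′ G.:* y′ G.:- x G.:* y G.:=
           (x′ G.:- (G.con 1ᵍ G.:+ h) G.:* x) G.:* y′ G.:+ (G.con 1ᵍ G.:+ h) G.:* x G.:* (y′ G.:- (G.con 1ᵍ G.:- h) G.:* y)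
             G.:+ G.:- (h G.:* h G.:* (x G.:* y))) refl (x (suc j)) (y (suc j)) (x j) (y j) (h j)) ⟩
    ‖ α j *ᵍ y (suc j) +ᵍ (1ᵍ +ᵍ h j) *ᵍ x j *ᵍ γ j +ᵍ -ᵍ (h j *ᵍ h j *ᵍ (x j *ᵍ y j)) ‖
      ≤⟨ ‖+‖-mono {α j *ᵍ y (suc j) +ᵍ (1ᵍ +ᵍ h j) *ᵍ x j *ᵍ γ j} { -ᵍ (h j *ᵍ h j *ᵍ (x j *ᵍ y j))}
           (‖+‖-mono {α j *ᵍ y (suc j)} {(1ᵍ +ᵍ h j) *ᵍ x j *ᵍ γ j}
             (‖*‖-mono {α j} {y (suc j)} (x-step j j<K) (y≤E (suc j) j<K))
             (‖*‖-mono {(1ᵍ +ᵍ h j) *ᵍ x j} {γ j}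
               (‖*‖-mono {1ᵍ +ᵍ h j} {x j} (‖+‖-mono {1ᵍ} {h j} (ℚₚ.≤-reflexive (‖ι‖ (ℚₚ.<⇒≤ 0<1))) (h≤δ j j<K)) (x≤E j (ℕₚ.<⇒≤ j<K)))
               (y-step j j<K)))
           (subst (_≤ℚ δ * δ * (E * E)) (sym ‖- h j *ᵍ h j *ᵍ (x j *ᵍ y j) ‖)
             (‖*‖-mono {h j *ᵍ h j} {x j *ᵍ y j} (‖*‖-mono {h j} {h j} (h≤δ j j<K) (h≤δ j j<K))
               (‖*‖-mono {x j} {y j} (x≤E j (ℕₚ.<⇒≤ j<K)) (y≤E j (ℕₚ.<⇒≤ j<K))))) ⟩
    δ * η * E + (1ℚ + δ) * E * (δ * η) + δ * δ * (E * E) ∎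
    where
    open ℚₚ.≤-Reasoning
    α γ : ℕ → ℚ[i]
    α j = x (suc j) +ᵍ -ᵍ ((1ᵍ +ᵍ h j) *ᵍ x j)
    γ j = y (suc j) +ᵍ -ᵍ ((1ᵍ +ᵍ -ᵍ h j) *ᵍ y j)

  -- The bound of product-constant for K = n + 1, δ = B/K and η = δ E + μ.
  Error : (B E : ℚ) (n : ℕ) (μ : ℚ) → ℚ
  Error B E n μ = B * (η * E + (1ℚ + δ) * E * η + δ * (E * E))
    where
    δ = B * (+ 1 / suc n)
    η = δ * E + μ

  1/-null : Null (λ n → + 1 / suc n)
  1/-null ε 0<ε =
    let N , 1/≤ε/2 = 1/-small (0<-half 0<ε)
    in N , λ n N≤n → subst (_<ℚ ε) (sym (ℚₚ.0≤p⇒∣p∣≡p (0≤/ 1 (suc n))))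
         (ℚₚ.≤-<-trans (1/≤ε/2 n N≤n) (subst (½ * ε <ℚ_) (halves ε) (p<p+q (0<-half 0<ε))))

  Null-const* : ∀ c {u} → Null u → Null (λ n → c * u n)
  Null-const* c = Null-bounded* (λ _ → c) (λ _ → ℚₚ.≤-refl)

  -- Both δ = B/(n + 1) and η = δ E + μ are null, and each summand contains one of them next to
  -- bounded factors.
  Error-null : ∀ B E {μ} → Null μ → Null (λ n → Error B E n (μ n))
  Error-null B E {μ} μ-null = Null-const* B (Null-+ (Null-+
      (Null-≡ (λ n → ℚₚ.*-comm (η n) E) (Null-const* E η-null))
      (Null-≡ (λ n → solve 3 (λ δ E η → (con 1ℚ :+ δ) :* E :* η := E :* η :+ E :* (δ :* η)) refl (δ n) E (η n))
        (Null-+ (Null-const* E η-null) (Null-const* E (Null-bounded* δ (λ n → bound n) η-null)))))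
      (Null-≡ (λ n → ℚₚ.*-comm (δ n) (E * E)) (Null-const* (E * E) δ-null)))
    where
    δ η : ℕ → ℚ
    δ n = B * (+ 1 / suc n)
    η n = δ n * E + μ n
    δ-null : Null δ
    δ-null = Null-const* B 1/-null
    η-null : Null η
    η-null = Null-+ (Null-≡ (λ n → ℚₚ.*-comm (δ n) E) (Null-const* E δ-null)) μ-null
    bound : ∀ n → ∣ δ n ∣ ≤ℚ ∣ B ∣ * 1ℚ
    bound n = subst (_≤ℚ ∣ B ∣ * 1ℚ) (sym (ℚₚ.∣p*q∣≡∣p∣*∣q∣ B (+ 1 / suc n)))
      (*-mono-≤ (ℚₚ.0≤∣p∣ B) (ℚₚ.<⇒≤ 0<1) ℚₚ.≤-refl (subst (_≤ℚ 1ℚ) (sym (ℚₚ.0≤p⇒∣p∣≡p (0≤/ 1 (suc n))))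
        (subst (+ 1 / suc n ≤ℚ_) 1/1≡1 (/-mono-≤ 1 (suc n) 1 1 (ℕ.s≤s ℕ.z≤n)))))

  product-constant-Error : ∀ (x y h : ℕ → ℚ[i]) n {B E μ} → 0ℚ ≤ℚ B → 0ℚ ≤ℚ E → 0ℚ ≤ℚ μ →
    let K = suc n ; δ = B * (+ 1 / suc n) ; η = δ * E + μ in
    (∀ j → j ℕ.≤ K → ‖ x j ‖ ≤ℚ E) → (∀ j → j ℕ.≤ K → ‖ y j ‖ ≤ℚ E) → (∀ j → j ℕ.< K → ‖ h j ‖ ≤ℚ δ) →
    (∀ j → j ℕ.< K → ‖ x (suc j) +ᵍ -ᵍ ((1ᵍ +ᵍ h j) *ᵍ x j) ‖ ≤ℚ δ * η) →
    (∀ j → j ℕ.< K → ‖ y (suc j) +ᵍ -ᵍ ((1ᵍ +ᵍ -ᵍ h j) *ᵍ y j) ‖ ≤ℚ δ * η) →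
    ‖ x K *ᵍ y K +ᵍ -ᵍ (x 0 *ᵍ y 0) ‖ ≤ℚ Error B E n μ
  product-constant-Error x y h n {B} {E} {μ} 0≤B 0≤E 0≤μ x≤E y≤E h≤δ x-step y-step =
    subst (‖ x K *ᵍ y K +ᵍ -ᵍ (x 0 *ᵍ y 0) ‖ ≤ℚ_) eq
      (product-constant x y h K 0≤η x≤E y≤E h≤δ x-step y-step)
    where
    K = suc n
    κ = + 1 / suc n
    δ = B * κ
    η = δ * E + μ
    0≤η : 0ℚ ≤ℚ η
    0≤η = ℚₚ.+-mono-≤ (0≤* (0≤* 0≤B (0≤/ 1 (suc n))) 0≤E) 0≤μ
    eq : (+ K / 1) * (δ * η * E + (1ℚ + δ) * E * (δ * η) + δ * δ * (E * E)) ≡ Error B E n μ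
    eq = begin
      (+ K / 1) * (B * κ * η * E + (1ℚ + δ) * E * (B * κ * η) + B * κ * δ * (E * E))
        ≡⟨ solve 6 (λ K B κ η E δ →
             K :* (B :* κ :* η :* E :+ (con 1ℚ :+ δ) :* E :* (B :* κ :* η) :+ B :* κ :* δ :* (E :* E))
             := (K :* κ) :* (B :* (η :* E :+ (con 1ℚ :+ δ) :* E :* η :+ δ :* (E :* E)))) refl (+ K / 1) B κ η E δ ⟩
      (+ K / 1) * κ * (B * (η * E + (1ℚ + δ) * E * η + δ * (E * E)))
        ≡⟨ trans (cong (_* (B * (η * E + (1ℚ + δ) * E * η + δ * (E * E)))) ([n/1]*[1/n]≡1 K)) (ℚₚ.*-identityˡ _) ⟩
      B * (η * E + (1ℚ + δ) * E * η + δ * (E * E)) ∎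
      where open ≡-Reasoning

module _ where

  open ℚ using (_+_; _*_; _-_; -_; ∣_∣) renaming (_≤_ to _≤ℚ_; _<_ to _<ℚ_)

  -- The Euler estimates concern partial sums of n + 2 terms, hence approximations of index n + 2.
  Null-shift₂ : ∀ {u v} → (∀ n → ∣ v (2+ n) ∣ ≤ℚ u n) → Null u → Null v
  Null-shift₂ {u} {v} v≤u nu ε 0<ε = let N , u< = nu ε 0<ε in suc (suc N) , λ where
    (2+ n) (ℕ.s≤s (ℕ.s≤s N≤n)) → ℚₚ.≤-<-trans (v≤u n) (ℚₚ.≤-<-trans (p≤∣p∣ (u n)) (u< n N≤n))

  ‖‖-null⇒≈ᶜ : ∀ z w {u} → (∀ n → ‖ z at suc (suc n) +ᵍ -ᵍ (w at suc (suc n)) ‖ ≤ℚ u n) → Null u → z ≈ᶜ w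
  ‖‖-null⇒≈ᶜ z w {u} d≤u nu =
      Null-shift₂ (λ n → ℚₚ.≤-trans (p≤p+q (ℚₚ.0≤∣p∣ (proj₂ (d n)))) (d≤u n)) nu
    , Null-shift₂ (λ n → ℚₚ.≤-trans (q≤p+q (ℚₚ.0≤∣p∣ (proj₁ (d n)))) (d≤u n)) nu
    where
    d : ℕ → ℚ[i]
    d n = z at suc (suc n) +ᵍ -ᵍ (w at suc (suc n))

  partial-0 : ∀ n → partial 0ᵍ (suc n) ≡ 1ᵍ
  partial-0 zero    = trans (ℚ[i].+-identityˡ (term 0ᵍ 0)) (term-zero 0ᵍ)
  partial-0 (suc n) = trans (cong₂ _+ᵍ_ (partial-0 n) (trans (cong (ι 1/ suc n ! *ᵍ_) (ℚ[i].zeroˡ (0ᵍ ^ᵍ n))) (ℚ[i].zeroʳ (ι 1/ suc n !))))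
                            (ℚ[i].+-identityʳ 1ᵍ)

  Euler-step : ∀ z h {b E δ} n → ‖ z ‖ ≤ℚ + b / 1 → ‖ z +ᵍ h ‖ ≤ℚ + b / 1 → ‖ h ‖ ≤ℚ δ → 0ℚ ≤ℚ E → (∀ n → ∑ℚ n (majorant b) ≤ℚ E) →
    ‖ partial (z +ᵍ h) (2+ n) +ᵍ -ᵍ ((1ᵍ +ᵍ h) *ᵍ partial z (2+ n)) ‖ ≤ℚ δ * (δ * E + majorant b (suc n))
  Euler-step z h {b} {E} {δ} n z≤b z+h≤b h≤δ 0≤E ∑≤E = begin
    ‖ partial (z +ᵍ h) (2+ n) +ᵍ -ᵍ ((1ᵍ +ᵍ h) *ᵍ partial z (2+ n)) ‖
      ≤⟨ partial-derivative z h z≤b z+h≤b n ⟩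
    ‖ h ‖ * ‖ h ‖ * ∑ℚ n (majorant b) + ‖ h ‖ * μ
      ≤⟨ ℚₚ.+-mono-≤ (*-mono-≤ (0≤* 0≤‖ h ‖ 0≤‖ h ‖) 0≤E (*-mono-≤ 0≤‖ h ‖ 0≤δ h≤δ h≤δ) (∑≤E n))
                     (*-mono-≤ 0≤‖ h ‖ (majorant-nonneg b (suc n)) h≤δ ℚₚ.≤-refl) ⟩
    δ * δ * E + δ * μ
      ≡⟨ solve 3 (λ δ E μ → δ :* δ :* E :+ δ :* μ := δ :* (δ :* E :+ μ)) refl δ E μ ⟩
    δ * (δ * E + μ) ∎
    where
    open ℚₚ.≤-Reasoning
    μ = majorant b (suc n)
    0≤δ : 0ℚ ≤ℚ δ
    0≤δ = ℚₚ.≤-trans 0≤‖ h ‖ h≤δ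

  0/n≡0 : ∀ n .{{_ : NonZero n}} → + 0 / n ≡ 0ℚ
  0/n≡0 n = trans (/-≡ 0 n 0 1 refl) 0/1≡0

  n/n≡1 : ∀ n .{{_ : NonZero n}} → + n / n ≡ 1ℚ
  n/n≡1 n = trans (/-≡ n n 1 1 (ℕₚ.*-comm n 1)) 1/1≡1

  j≤n⇒j/n≤1 : ∀ {j} n .{{_ : NonZero n}} → j ℕ.≤ n → + j / n ≤ℚ 1ℚ
  j≤n⇒j/n≤1 {j} n j≤n = subst (+ j / n ≤ℚ_) 1/1≡1 (/-mono-≤ j n 1 1 (ℕₚ.≤-trans (ℕₚ.≤-reflexive (ℕₚ.*-identityʳ j))
    (ℕₚ.≤-trans j≤n (ℕₚ.≤-reflexive (sym (ℕₚ.*-identityˡ n))))))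

  /1-mono-≤ : ∀ {m n} → m ℕ.≤ n → + m / 1 ≤ℚ + n / 1
  /1-mono-≤ {m} {n} m≤n = /-mono-≤ m 1 n 1 (ℕₚ.*-monoˡ-≤ 1 m≤n)

  module _ (z w : ℚ[i]) {b : ℕ} (z≤b : ‖ z ‖ ≤ℚ + b / 1) (w≤b : ‖ w ‖ ≤ℚ + b / 1)
           {E} (∑≤E : ∀ n → ∑ℚ n (majorant (b ℕ.+ b)) ≤ℚ E) (n : ℕ) where

    private
      K = suc n
      h = ι (+ 1 / K) *ᵍ w
      B = + b / 1
      δ = B * (+ 1 / K)
      μ = majorant (b ℕ.+ b) (suc n)
      0≤E : 0ℚ ≤ℚ E
      0≤E = ∑≤E 0
      w′ : ℕ → ℚ[i]
      w′ j = ι (+ j / K) *ᵍ w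
      w′0≡0 : w′ 0 ≡ 0ᵍ
      w′0≡0 = trans (cong (λ q → ι q *ᵍ w) (0/n≡0 K)) (ℚ[i].zeroˡ w)
      w′K≡w : w′ K ≡ w
      w′K≡w = trans (cong (λ q → ι q *ᵍ w) (n/n≡1 K)) (ℚ[i].*-identityˡ w)
      w′-suc : ∀ j → w′ (suc j) ≡ w′ j +ᵍ h
      w′-suc j = trans (cong (λ q → q *ᵍ w) (trans (cong ι (trans (cong (λ k → + k / K) (ℕₚ.+-comm 1 j)) (/-+ j 1 K))) (ι-+-homo (+ j / K) (+ 1 / K))))
        (ℚ[i].distribʳ w (ι (+ j / K)) (ι (+ 1 / K)))
      ‖w′‖ : ∀ j → j ℕ.≤ K → ‖ w′ j ‖ ≤ℚ B
      ‖w′‖ j j≤K = subst₂ _≤ℚ_ (sym (‖ι*‖ {+ j / K} w (0≤/ j K))) (ℚₚ.*-identityˡ B)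
        (*-mono-≤ (0≤/ j K) (0≤/ b 1) (j≤n⇒j/n≤1 K j≤K) w≤b)
      ‖h‖ : ‖ h ‖ ≤ℚ δ
      ‖h‖ = subst₂ _≤ℚ_ (sym (‖ι*‖ {+ 1 / K} w (0≤/ 1 K))) (ℚₚ.*-comm (+ 1 / K) B)
        (ℚₚ.*-monoˡ-≤-nonNeg (+ 1 / K) {{ℚ.nonNegative (0≤/ 1 K)}} w≤b)
      z+w′≤ : ∀ j → j ℕ.≤ K → ‖ z +ᵍ w′ j ‖ ≤ℚ + (b ℕ.+ b) / 1
      z+w′≤ j j≤K = subst (‖ z +ᵍ w′ j ‖ ≤ℚ_) (sym (/-+ b b 1)) (‖+‖-mono {z} {w′ j} z≤b (‖w′‖ j j≤K))
      -w′≤ : ∀ j → j ℕ.≤ K → ‖ -ᵍ w′ j ‖ ≤ℚ + (b ℕ.+ b) / 1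
      -w′≤ j j≤K = subst (_≤ℚ + (b ℕ.+ b) / 1) (sym ‖- w′ j ‖) (ℚₚ.≤-trans (‖w′‖ j j≤K) (/1-mono-≤ (ℕₚ.m≤m+n b b)))
      x y : ℕ → ℚ[i]
      x j = partial (z +ᵍ w′ j) (2+ n)
      y j = partial (-ᵍ w′ j) (2+ n)
      z+w′-suc : ∀ j → z +ᵍ w′ (suc j) ≡ (z +ᵍ w′ j) +ᵍ h
      z+w′-suc j = trans (cong (z +ᵍ_) (w′-suc j)) (sym (ℚ[i].+-assoc z (w′ j) h))
      -w′-suc : ∀ j → -ᵍ w′ (suc j) ≡ -ᵍ w′ j +ᵍ -ᵍ h
      -w′-suc j = trans (cong -ᵍ_ (w′-suc j)) (G.solve 2 (λ a h → G.:- (a G.:+ h) G.:= G.:- a G.:+ G.:- h) refl (w′ j) h)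

    -- The path runs from z to z + w in K = n + 1 steps, with x(j) close to exp(z + (j/K) w) and
    -- y(j) close to exp(-(j/K) w). The product starts as exp z and ends as exp(z + w) exp(-w).
    -- Steps and terms grow together in n, so that both kinds of error vanish.
    partial-+-neg : ‖ partial (z +ᵍ w) (2+ n) *ᵍ partial (-ᵍ w) (2+ n) +ᵍ -ᵍ partial z (2+ n) ‖ ≤ℚ Error B E n μ
    partial-+-neg = subst (λ d → ‖ d ‖ ≤ℚ Error B E n μ)
      (cong₂ (λ a b → a +ᵍ -ᵍ b)
        (cong (λ w → partial (z +ᵍ w) (2+ n) *ᵍ partial (-ᵍ w) (2+ n)) w′K≡w)
        (trans (cong₂ _*ᵍ_ (cong (λ a → partial a (2+ n)) (trans (cong (z +ᵍ_) w′0≡0) (ℚ[i].+-identityʳ z)))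
                           (trans (cong (λ a → partial (-ᵍ a) (2+ n)) w′0≡0) (partial-0 (suc n))))
               (ℚ[i].*-identityʳ (partial z (2+ n)))))
      (product-constant-Error x y (λ _ → h) n (0≤/ b 1) 0≤E (majorant-nonneg (b ℕ.+ b) (suc n))
        (λ j j≤K → ℚₚ.≤-trans (‖partial‖ {z +ᵍ w′ j} (z+w′≤ j j≤K) (2+ n)) (∑≤E (2+ n)))
        (λ j j≤K → ℚₚ.≤-trans (‖partial‖ { -ᵍ w′ j} (-w′≤ j j≤K) (2+ n)) (∑≤E (2+ n)))
        (λ _ _ → ‖h‖)
        (λ j j<K → subst (λ a → ‖ partial a (2+ n) +ᵍ -ᵍ ((1ᵍ +ᵍ h) *ᵍ x j) ‖ ≤ℚ δ * (δ * E + μ)) (sym (z+w′-suc j))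
          (Euler-step (z +ᵍ w′ j) h n (z+w′≤ j (ℕₚ.<⇒≤ j<K)) (subst (λ a → ‖ a ‖ ≤ℚ + (b ℕ.+ b) / 1) (z+w′-suc j) (z+w′≤ (suc j) j<K)) ‖h‖ 0≤E ∑≤E))
        (λ j j<K → subst (λ a → ‖ partial a (2+ n) +ᵍ -ᵍ ((1ᵍ +ᵍ -ᵍ h) *ᵍ y j) ‖ ≤ℚ δ * (δ * E + μ)) (sym (-w′-suc j))
          (Euler-step (-ᵍ w′ j) (-ᵍ h) n (-w′≤ j (ℕₚ.<⇒≤ j<K)) (subst (λ a → ‖ a ‖ ≤ℚ + (b ℕ.+ b) / 1) (-w′-suc j) (-w′≤ (suc j) j<K))
            (subst (_≤ℚ δ) (sym ‖- h ‖) ‖h‖) 0≤E ∑≤E)))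

  Null-suc : ∀ {u} → Null u → Null (λ n → u (suc n))
  Null-suc nu ε 0<ε = let N , u< = nu ε 0<ε in N , λ n N≤n → u< (suc n) (ℕₚ.m≤n⇒m≤1+n N≤n)

  exp-+-neg : ∀ z w → exp (z +ᶜ w) *ᶜ exp (-ᶜ w) ≈ᶜ exp z
  exp-+-neg z w =
    let bz , z≤ = ℂ-bounded z
        bw , w≤ = ℂ-bounded w
        b = bz ℕ.+ bw
        E , ∑≤E = ∑ℚ-majorant-bounded (b ℕ.+ b)
    in ‖‖-null⇒≈ᶜ (exp (z +ᶜ w) *ᶜ exp (-ᶜ w)) (exp z)
      (λ n → let m = suc (suc n) in
        subst (λ d → ‖ d ‖ ≤ℚ Error (+ b / 1) E n (majorant (b ℕ.+ b) (suc n)))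
          (sym (cong₂ (λ a b → a +ᵍ -ᵍ b) (cong₂ _*ᵍ_ (exp-at (z +ᶜ w) m) (exp-at (-ᶜ w) m)) (exp-at z m)))
          (partial-+-neg (z at m) (w at m)
            (ℚₚ.≤-trans (z≤ m) (/1-mono-≤ (ℕₚ.m≤m+n bz bw))) (ℚₚ.≤-trans (w≤ m) (/1-mono-≤ (ℕₚ.m≤n+m bw bz))) ∑≤E n))
      (Error-null (+ b / 1) E (Null-suc (majorant-null (b ℕ.+ b))))

-- The Cayley transform and the value of e at 1/4

module _ where

  open ℚ using (_+_; _*_; _-_; -_; ∣_∣) renaming (_≤_ to _≤ℚ_; _<_ to _<ℚ_)

  2ᵍ : ℚ[i]
  2ᵍ = 1ᵍ +ᵍ 1ᵍ

  i*ι : ∀ q → iᵍ *ᵍ ι q ≡ (0ℚ , q)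
  i*ι q = cong₂ _,_ (solve 1 (λ q → con 0ℚ :* q :+ :- (con 1ℚ :* con 0ℚ) := con 0ℚ) refl q)
                    (solve 1 (λ q → con 0ℚ :* con 0ℚ :+ con 1ℚ :* q := q) refl q)

  ‖i*ι‖ : ∀ {q} → 0ℚ ≤ℚ q → ‖ iᵍ *ᵍ ι q ‖ ≡ q
  ‖i*ι‖ {q} 0≤q = trans (cong ‖_‖ (i*ι q)) (trans (ℚₚ.+-identityˡ ∣ q ∣) (ℚₚ.0≤p⇒∣p∣≡p 0≤q))

  -- 1/(1 + it) = c (1 - it) for c = 1/(1 + t²)
  inverse : (t c : ℚ) → ℚ[i]
  inverse t c = ι c *ᵍ (1ᵍ +ᵍ -ᵍ (iᵍ *ᵍ ι t))

  -- (1 - it)/(1 + it)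
  cayley : (t c : ℚ) → ℚ[i]
  cayley t c = 2ᵍ *ᵍ inverse t c +ᵍ -ᵍ 1ᵍ

  module _ (t c : ℚ) (inv : c + c * (t * t) ≡ 1ℚ) where

    inverse-inverse : (1ᵍ +ᵍ iᵍ *ᵍ ι t) *ᵍ inverse t c ≡ 1ᵍ
    inverse-inverse = begin
      (1ᵍ +ᵍ iᵍ *ᵍ ι t) *ᵍ (ι c *ᵍ (1ᵍ +ᵍ -ᵍ (iᵍ *ᵍ ι t)))
        ≡⟨ G.solve 3 (λ i t c → (G.con 1ᵍ G.:+ i G.:* t) G.:* (c G.:* (G.con 1ᵍ G.:- i G.:* t)) G.:= c G.:- (i G.:* i) G.:* (c G.:* (t G.:* t))) refl iᵍ (ι t) (ι c) ⟩
      ι c +ᵍ -ᵍ (iᵍ *ᵍ iᵍ *ᵍ (ι c *ᵍ (ι t *ᵍ ι t)))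
        ≡⟨ cong (λ a → ι c +ᵍ -ᵍ (-ᵍ 1ᵍ *ᵍ (ι c *ᵍ a))) (sym (ι-*-homo t t)) ⟩
      ι c +ᵍ -ᵍ (-ᵍ 1ᵍ *ᵍ (ι c *ᵍ ι (t * t)))
        ≡⟨ cong (λ a → ι c +ᵍ -ᵍ (-ᵍ 1ᵍ *ᵍ a)) (sym (ι-*-homo c (t * t))) ⟩
      ι c +ᵍ -ᵍ (-ᵍ 1ᵍ *ᵍ ι (c * (t * t)))
        ≡⟨ G.solve 2 (λ a b → a G.:- (G.con (-ᵍ 1ᵍ) G.:* b) G.:= a G.:+ b) refl (ι c) (ι (c * (t * t))) ⟩
      ι c +ᵍ ι (c * (t * t))
        ≡⟨ trans (sym (ι-+-homo c (c * (t * t)))) (cong ι inv) ⟩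
      1ᵍ ∎
      where open ≡-Reasoning

    -- Since 1 = (1 + it) p, the transform 2p - 1 equals (1 - it) p, and c (1 - it) = p. As the
    -- derivative of p is -i p², this expresses that y = 2p - 1 solves y′ = -2i y/(1 + t²).
    ι*cayley : ι c *ᵍ cayley t c ≡ inverse t c *ᵍ inverse t c
    ι*cayley = begin
      ι c *ᵍ (2ᵍ *ᵍ p +ᵍ -ᵍ 1ᵍ) ≡⟨ cong (λ a → ι c *ᵍ (2ᵍ *ᵍ p +ᵍ -ᵍ a)) inverse-inverse ⟨
      ι c *ᵍ (2ᵍ *ᵍ p +ᵍ -ᵍ ((1ᵍ +ᵍ iᵍ *ᵍ ι t) *ᵍ p))    ≡⟨ G.solve 3 (λ c p a →
           c G.:* ((G.con 1ᵍ G.:+ G.con 1ᵍ) G.:* p G.:- (G.con 1ᵍ G.:+ a) G.:* p) G.:= c G.:* (G.con 1ᵍ G.:- a) G.:* p) refl (ι c) p (iᵍ *ᵍ ι t) ⟩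
      p *ᵍ p ∎
      where
      open ≡-Reasoning
      p = inverse t c

    ‖inverse‖ : 0ℚ ≤ℚ t → t ≤ℚ 1ℚ → 0ℚ ≤ℚ c → c ≤ℚ 1ℚ → ‖ inverse t c ‖ ≤ℚ 1ℚ + 1ℚ
    ‖inverse‖ 0≤t t≤1 0≤c c≤1 = subst (‖ inverse t c ‖ ≤ℚ_) (ℚₚ.*-identityˡ (1ℚ + 1ℚ))
      (‖*‖-mono {ι c} {1ᵍ +ᵍ -ᵍ (iᵍ *ᵍ ι t)} (subst (_≤ℚ 1ℚ) (sym (‖ι‖ 0≤c)) c≤1)
        (‖+‖-mono {1ᵍ} { -ᵍ (iᵍ *ᵍ ι t)} (ℚₚ.≤-reflexive (‖ι‖ (ℚₚ.<⇒≤ 0<1)))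
          (subst (_≤ℚ 1ℚ) (sym (trans ‖- iᵍ *ᵍ ι t ‖ (‖i*ι‖ 0≤t))) t≤1)))

  module _ (t c κ c′ : ℚ) (inv : c + c * (t * t) ≡ 1ℚ) (inv′ : c′ + c′ * ((t + κ) * (t + κ)) ≡ 1ℚ) where

    private
      p = inverse t c
      p′ = inverse (t + κ) c′
      k = iᵍ *ᵍ ι κ
      h = 2ᵍ *ᵍ (k *ᵍ ι c)

    -- The resolvent identity for 1/(1 + it), where the denominators differ by iκ.
    inverse-difference : p′ +ᵍ -ᵍ p ≡ -ᵍ (k *ᵍ p *ᵍ p′)
    inverse-difference = begin
      p′ +ᵍ -ᵍ p
        ≡⟨ cong₂ (λ a b → a +ᵍ -ᵍ b)
             (trans (sym (ℚ[i].*-identityʳ p′)) (cong (p′ *ᵍ_) (sym (inverse-inverse t c inv))))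
             (trans (sym (ℚ[i].*-identityʳ p)) (cong (p *ᵍ_) (sym (inverse-inverse (t + κ) c′ inv′)))) ⟩
      p′ *ᵍ ((1ᵍ +ᵍ iᵍ *ᵍ ι t) *ᵍ p) +ᵍ -ᵍ (p *ᵍ ((1ᵍ +ᵍ iᵍ *ᵍ ι (t + κ)) *ᵍ p′))
        ≡⟨ cong (λ a → p′ *ᵍ ((1ᵍ +ᵍ iᵍ *ᵍ ι t) *ᵍ p) +ᵍ -ᵍ (p *ᵍ ((1ᵍ +ᵍ iᵍ *ᵍ a) *ᵍ p′))) (ι-+-homo t κ) ⟩
      p′ *ᵍ ((1ᵍ +ᵍ iᵍ *ᵍ ι t) *ᵍ p) +ᵍ -ᵍ (p *ᵍ ((1ᵍ +ᵍ iᵍ *ᵍ (ι t +ᵍ ι κ)) *ᵍ p′))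
        ≡⟨ G.solve 5 (λ p p′ i t κ →
             p′ G.:* ((G.con 1ᵍ G.:+ i G.:* t) G.:* p) G.:- p G.:* ((G.con 1ᵍ G.:+ i G.:* (t G.:+ κ)) G.:* p′) G.:= G.:- (i G.:* κ G.:* p G.:* p′)) refl p p′ iᵍ (ι t) (ι κ) ⟩
      -ᵍ (k *ᵍ p *ᵍ p′) ∎
      where open ≡-Reasoning

    -- The exact change of the transform is -2 k p p′, the Euler step is -2 k p². A second use of
    -- the resolvent identity shows that they differ by a term of second order in κ.
    cayley-Euler : cayley (t + κ) c′ +ᵍ -ᵍ ((1ᵍ +ᵍ -ᵍ h) *ᵍ cayley t c) ≡ 2ᵍ *ᵍ (k *ᵍ p *ᵍ (k *ᵍ p *ᵍ p′))
    cayley-Euler = begin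
      (2ᵍ *ᵍ p′ +ᵍ -ᵍ 1ᵍ) +ᵍ -ᵍ ((1ᵍ +ᵍ -ᵍ (2ᵍ *ᵍ (k *ᵍ ι c))) *ᵍ (2ᵍ *ᵍ p +ᵍ -ᵍ 1ᵍ))
        ≡⟨ G.solve 4 (λ p p′ k c → let two = G.con 1ᵍ G.:+ G.con 1ᵍ in
             (two G.:* p′ G.:- G.con 1ᵍ) G.:- (G.con 1ᵍ G.:- two G.:* (k G.:* c)) G.:* (two G.:* p G.:- G.con 1ᵍ)
             G.:= two G.:* (p′ G.:- p) G.:+ two G.:* (k G.:* (c G.:* (two G.:* p G.:- G.con 1ᵍ)))) refl p p′ k (ι c) ⟩
      2ᵍ *ᵍ (p′ +ᵍ -ᵍ p) +ᵍ 2ᵍ *ᵍ (k *ᵍ (ι c *ᵍ cayley t c))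
        ≡⟨ cong (λ a → 2ᵍ *ᵍ (p′ +ᵍ -ᵍ p) +ᵍ 2ᵍ *ᵍ (k *ᵍ a)) (ι*cayley t c inv) ⟩
      2ᵍ *ᵍ (p′ +ᵍ -ᵍ p) +ᵍ 2ᵍ *ᵍ (k *ᵍ (p *ᵍ p))
        ≡⟨ cong (λ a → 2ᵍ *ᵍ a +ᵍ 2ᵍ *ᵍ (k *ᵍ (p *ᵍ p))) inverse-difference ⟩
      2ᵍ *ᵍ (-ᵍ (k *ᵍ p *ᵍ p′)) +ᵍ 2ᵍ *ᵍ (k *ᵍ (p *ᵍ p))
        ≡⟨ G.solve 3 (λ k p p′ → let two = G.con 1ᵍ G.:+ G.con 1ᵍ in
             two G.:* (G.:- (k G.:* p G.:* p′)) G.:+ two G.:* (k G.:* (p G.:* p)) G.:= two G.:* (k G.:* p G.:* G.:- (p′ G.:- p))) refl k p p′ ⟩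
      2ᵍ *ᵍ (k *ᵍ p *ᵍ -ᵍ (p′ +ᵍ -ᵍ p))
        ≡⟨ cong (λ a → 2ᵍ *ᵍ (k *ᵍ p *ᵍ -ᵍ a)) inverse-difference ⟩
      2ᵍ *ᵍ (k *ᵍ p *ᵍ -ᵍ (-ᵍ (k *ᵍ p *ᵍ p′)))
        ≡⟨ G.solve 3 (λ k p p′ → let two = G.con 1ᵍ G.:+ G.con 1ᵍ in
             two G.:* (k G.:* p G.:* G.:- (G.:- (k G.:* p G.:* p′))) G.:= two G.:* (k G.:* p G.:* (k G.:* p G.:* p′))) refl k p p′ ⟩
      2ᵍ *ᵍ (k *ᵍ p *ᵍ (k *ᵍ p *ᵍ p′)) ∎
      where open ≡-Reasoning

  opaque
    unfolding Defs._/_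

    4/1≡1+1+1+1 : + 4 / 1 ≡ (1ℚ + 1ℚ) * (1ℚ + 1ℚ)
    4/1≡1+1+1+1 = refl

    2/1*1/4≡½ : (+ 2 / 1) * (+ 1 / 4) ≡ ½
    2/1*1/4≡½ = refl

    1/2≡½ : + 1 / 2 ≡ ½
    1/2≡½ = refl

  ½*p≤p : ∀ {p} → 0ℚ ≤ℚ p → ½ * p ≤ℚ p
  ½*p≤p {p} 0≤p = subst (½ * p ≤ℚ_) (halves p) (p≤p+q (0≤* (ℚₚ.<⇒≤ 0<½) 0≤p))

  0≤πterm : ∀ a j → 0ℚ ≤ℚ πterm a j
  0≤πterm a j = 0≤/ (4 ℕ.* suc a) (suc a ℕ.* suc a ℕ.+ j ℕ.* j)

  πterm≤ : ∀ a j → πterm a j ≤ℚ (+ 4 / 1) * (+ 1 / suc a)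
  πterm≤ a j = subst (πterm a j ≤ℚ_) (sym (/-* 4 1 1 K)) (/-mono-≤ (4 ℕ.* K) (K ℕ.* K ℕ.+ j ℕ.* j) (4 ℕ.* 1) (1 ℕ.* K) (begin
    4 ℕ.* K ℕ.* (1 ℕ.* K) ≡⟨ ℕ-Solver.solve 1 (λ k → κ 4 ⊗ k ⊗ (κ 1 ⊗ k) ⊜ (κ 4 ⊗ κ 1) ⊗ (k ⊗ k)) refl K ⟩
    4 ℕ.* 1 ℕ.* (K ℕ.* K)                 ≤⟨ ℕₚ.*-monoʳ-≤ (4 ℕ.* 1) (ℕₚ.m≤m+n (K ℕ.* K) (j ℕ.* j)) ⟩
    4 ℕ.* 1 ℕ.* (K ℕ.* K ℕ.+ j ℕ.* j)     ∎))
    where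
    open ℕₚ.≤-Reasoning
    open ℕ-Solver using () renaming (_:+_ to _⊕_; _:*_ to _⊗_; _:=_ to _⊜_; con to κ)
    K = suc a

  ∑πterm≤4 : ∀ a j → j ℕ.≤ suc a → ∑ℚ j (πterm a) ≤ℚ + 4 / 1
  ∑πterm≤4 a j j≤K = begin
    ∑ℚ j (πterm a)                                ≤⟨ ∑ℚ-mono j (λ i _ → πterm≤ a i) ⟩
    ∑ℚ j (λ _ → (+ 4 / 1) * κ)                    ≡⟨ ∑ℚ-const j ((+ 4 / 1) * κ) ⟩
    (+ j / 1) * ((+ 4 / 1) * κ) ≤⟨ ℚₚ.*-monoʳ-≤-nonNeg _ {{ℚ.nonNegative (0≤* (0≤/ 4 1) (0≤/ 1 (suc a)))}} (/1-mono-≤ j≤K) ⟩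
    (+ suc a / 1) * ((+ 4 / 1) * κ) ≡⟨ solve 3 (λ k f κ → k :* (f :* κ) := f :* (k :* κ)) refl (+ suc a / 1) (+ 4 / 1) κ ⟩
    (+ 4 / 1) * ((+ suc a / 1) * κ) ≡⟨ trans (cong ((+ 4 / 1) *_) ([n/1]*[1/n]≡1 (suc a))) (ℚₚ.*-identityʳ (+ 4 / 1)) ⟩
    + 4 / 1                                       ∎
    where
    open ℚₚ.≤-Reasoning
    κ = + 1 / suc a

  0≤∑πterm : ∀ a j → 0ℚ ≤ℚ ∑ℚ j (πterm a)
  0≤∑πterm a zero    = ℚₚ.≤-refl
  0≤∑πterm a (suc j) = ℚₚ.+-mono-≤ (0≤∑πterm a j) (0≤πterm a j)

  module _ (a : ℕ) where

    private
      K = suc a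
      κ = + 1 / K

    -- The value of 1/(1 + t²), the derivative of arctan t, at t = j/K.
    slope : ℕ → ℚ
    slope j = + (K ℕ.* K) / (K ℕ.* K ℕ.+ j ℕ.* j)

    slope-inverse : ∀ j → slope j + slope j * ((+ j / K) * (+ j / K)) ≡ 1ℚ
    slope-inverse j = begin
      slope j + slope j * ((+ j / K) * (+ j / K)) ≡⟨ cong (λ x → slope j + slope j * x) (/-* j K j K) ⟩
      slope j + slope j * (+ (j ℕ.* j) / (K ℕ.* K)) ≡⟨ cong (λ x → slope j + x) (trans (/-* (K ℕ.* K) D (j ℕ.* j) (K ℕ.* K))
                                                                   (/-≡ (K ℕ.* K ℕ.* (j ℕ.* j)) (D ℕ.* (K ℕ.* K)) (j ℕ.* j) D
                                                                     (ℕ-Solver.solve 3 (λ k j d → k ⊗ j ⊗ d ⊜ j ⊗ (d ⊗ k)) refl (K ℕ.* K) (j ℕ.* j) D))) ⟩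
      + (K ℕ.* K) / D + + (j ℕ.* j) / D                       ≡⟨ /-+ (K ℕ.* K) (j ℕ.* j) D ⟨
      + D / D                                                 ≡⟨ n/n≡1 D ⟩
      1ℚ                                                      ∎
      where
      open ≡-Reasoning
      open ℕ-Solver using () renaming (_:+_ to _⊕_; _:*_ to _⊗_; _:=_ to _⊜_)
      D = K ℕ.* K ℕ.+ j ℕ.* j

    0≤slope : ∀ j → 0ℚ ≤ℚ slope j
    0≤slope j = 0≤/ (K ℕ.* K) (K ℕ.* K ℕ.+ j ℕ.* j)

    slope≤1 : ∀ j → slope j ≤ℚ 1ℚ
    slope≤1 j = j≤n⇒j/n≤1 (K ℕ.* K ℕ.+ j ℕ.* j) (ℕₚ.m≤m+n (K ℕ.* K) (j ℕ.* j))

    -- The link between both factors: half a summand of the Riemann sum for π is exactly the Euler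
    -- step 2κ/(1 + t²) of the Cayley transform.
    ½πterm : ∀ j → ½ * πterm a j ≡ (1ℚ + 1ℚ) * (κ * slope j)
    ½πterm j = begin
      ½ * πterm a j                                       ≡⟨ cong (½ *_) (sym eq) ⟩
      ½ * ((+ 4 / 1) * (κ * slope j)) ≡⟨ cong (λ f → ½ * (f * (κ * slope j))) 4/1≡1+1+1+1 ⟩
      ½ * ((1ℚ + 1ℚ) * (1ℚ + 1ℚ) * (κ * slope j)) ≡⟨ solve 1 (λ x → con ½ :* ((con 1ℚ :+ con 1ℚ) :* (con 1ℚ :+ con 1ℚ) :* x)
                                                               := (con 1ℚ :+ con 1ℚ) :* x) refl (κ * slope j) ⟩
      (1ℚ + 1ℚ) * (κ * slope j)                           ∎
      where
      open ≡-Reasoning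
      open ℕ-Solver using () renaming (_:+_ to _⊕_; _:*_ to _⊗_; _:=_ to _⊜_; con to n)
      D = K ℕ.* K ℕ.+ j ℕ.* j
      eq : (+ 4 / 1) * (κ * slope j) ≡ πterm a j
      eq = trans (cong ((+ 4 / 1) *_) (/-* 1 K (K ℕ.* K) D)) (trans (/-* 4 1 (1 ℕ.* (K ℕ.* K)) (K ℕ.* D))
        (/-≡ (4 ℕ.* (1 ℕ.* (K ℕ.* K))) (1 ℕ.* (K ℕ.* D)) (4 ℕ.* K) D
          (ℕ-Solver.solve 2 (λ k d → n 4 ⊗ (n 1 ⊗ (k ⊗ k)) ⊗ d ⊜ n 4 ⊗ k ⊗ (n 1 ⊗ (k ⊗ d))) refl K D)))

    private
      t : ℕ → ℚ
      t j = + j / K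
      δ = (+ 4 / 1) * κ
      h y : ℕ → ℚ[i]
      h j = iᵍ *ᵍ ι (½ * πterm a j)
      y j = cayley (t j) (slope j)
      t-suc : ∀ j → t (suc j) ≡ t j + κ
      t-suc j = trans (cong (λ k → + k / K) (ℕₚ.+-comm 1 j)) (/-+ j 1 K)
      ‖p‖ : ∀ j → j ℕ.≤ K → ‖ inverse (t j) (slope j) ‖ ≤ℚ 1ℚ + 1ℚ
      ‖p‖ j j≤K = ‖inverse‖ (t j) (slope j) (slope-inverse j) (0≤/ j K) (j≤n⇒j/n≤1 K j≤K) (0≤slope j) (slope≤1 j)
      h≡ : ∀ j → h j ≡ 2ᵍ *ᵍ (iᵍ *ᵍ ι κ *ᵍ ι (slope j))
      h≡ j = begin
        iᵍ *ᵍ ι (½ * πterm a j)                        ≡⟨ cong (λ q → iᵍ *ᵍ ι q) (½πterm j) ⟩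
        iᵍ *ᵍ ι ((1ℚ + 1ℚ) * (κ * slope j)) ≡⟨ cong (iᵍ *ᵍ_) (trans (ι-*-homo (1ℚ + 1ℚ) (κ * slope j)) (cong₂ _*ᵍ_ (ι-+-homo 1ℚ 1ℚ) (ι-*-homo κ (slope j)))) ⟩
        iᵍ *ᵍ (2ᵍ *ᵍ (ι κ *ᵍ ι (slope j))) ≡⟨ G.solve 4 (λ i c κ s → i G.:* (c G.:* (κ G.:* s)) G.:= c G.:* (i G.:* κ G.:* s)) refl iᵍ 2ᵍ (ι κ) (ι (slope j)) ⟩
        2ᵍ *ᵍ (iᵍ *ᵍ ι κ *ᵍ ι (slope j))               ∎
        where open ≡-Reasoning
      ‖2‖ : ‖ 2ᵍ ‖ ≡ 1ℚ + 1ℚ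
      ‖2‖ = refl
      ‖y‖ : ∀ j → j ℕ.≤ K → ‖ y j ‖ ≤ℚ + 5 / 1
      ‖y‖ j j≤K = subst (‖ y j ‖ ≤ℚ_) (sym (trans (/-suc 4) (cong (_+ 1ℚ) 4/1≡1+1+1+1)))
        (‖+‖-mono {2ᵍ *ᵍ inverse (t j) (slope j)} { -ᵍ 1ᵍ} (‖*‖-mono {2ᵍ} {inverse (t j) (slope j)} (ℚₚ.≤-reflexive ‖2‖) (‖p‖ j j≤K)) ℚₚ.≤-refl)
      ‖h‖ : ∀ j → ‖ h j ‖ ≤ℚ δ
      ‖h‖ j = subst (_≤ℚ δ) (sym (‖i*ι‖ (0≤* (ℚₚ.<⇒≤ 0<½) (0≤πterm a j)))) (ℚₚ.≤-trans (½*p≤p (0≤πterm a j)) (πterm≤ a j))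
      y-step : ∀ j → j ℕ.< K → ‖ y (suc j) +ᵍ -ᵍ ((1ᵍ +ᵍ -ᵍ h j) *ᵍ y j) ‖ ≤ℚ δ * δ
      y-step j j<K = begin
        ‖ cayley (t (suc j)) (slope (suc j)) +ᵍ -ᵍ ((1ᵍ +ᵍ -ᵍ h j) *ᵍ y j) ‖
          ≡⟨ cong₂ (λ t′ h → ‖ cayley t′ (slope (suc j)) +ᵍ -ᵍ ((1ᵍ +ᵍ -ᵍ h) *ᵍ y j) ‖) (t-suc j) (h≡ j) ⟩
        ‖ cayley (t j + κ) (slope (suc j)) +ᵍ -ᵍ ((1ᵍ +ᵍ -ᵍ (2ᵍ *ᵍ (iᵍ *ᵍ ι κ *ᵍ ι (slope j)))) *ᵍ y j) ‖
          ≡⟨ cong ‖_‖ (cayley-Euler (t j) (slope j) κ (slope (suc j)) (slope-inverse j)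
               (subst (λ t → slope (suc j) + slope (suc j) * (t * t) ≡ 1ℚ) (t-suc j) (slope-inverse (suc j)))) ⟩
        ‖ 2ᵍ *ᵍ (iᵍ *ᵍ ι κ *ᵍ p *ᵍ (iᵍ *ᵍ ι κ *ᵍ p *ᵍ p′)) ‖
          ≤⟨ ‖*‖-mono {2ᵍ} {iᵍ *ᵍ ι κ *ᵍ p *ᵍ (iᵍ *ᵍ ι κ *ᵍ p *ᵍ p′)} (ℚₚ.≤-reflexive ‖2‖)
               (‖*‖-mono {iᵍ *ᵍ ι κ *ᵍ p} {iᵍ *ᵍ ι κ *ᵍ p *ᵍ p′} ‖kp‖
                 (‖*‖-mono {iᵍ *ᵍ ι κ *ᵍ p} {p′} ‖kp‖ (subst (λ t → ‖ inverse t (slope (suc j)) ‖ ≤ℚ 1ℚ + 1ℚ) (t-suc j) (‖p‖ (suc j) j<K)))) ⟩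
        (1ℚ + 1ℚ) * (κ * (1ℚ + 1ℚ) * (κ * (1ℚ + 1ℚ) * (1ℚ + 1ℚ)))
          ≡⟨ solve 2 (λ c κ → c :* (κ :* c :* (κ :* c :* c)) := (c :* c :* κ) :* (c :* c :* κ)) refl (1ℚ + 1ℚ) κ ⟩
        ((1ℚ + 1ℚ) * (1ℚ + 1ℚ) * κ) * ((1ℚ + 1ℚ) * (1ℚ + 1ℚ) * κ)
          ≡⟨ cong (λ f → f * κ * (f * κ)) 4/1≡1+1+1+1 ⟨
        δ * δ ∎
        where
        open ℚₚ.≤-Reasoning
        p = inverse (t j) (slope j)
        p′ = inverse (t j + κ) (slope (suc j))
        ‖kp‖ : ‖ iᵍ *ᵍ ι κ *ᵍ p ‖ ≤ℚ κ * (1ℚ + 1ℚ)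
        ‖kp‖ = ‖*‖-mono {iᵍ *ᵍ ι κ} {p} (ℚₚ.≤-reflexive (‖i*ι‖ (0≤/ 1 K))) (‖p‖ j (ℕₚ.<⇒≤ j<K))

    module _ {E} (∑≤E : ∀ n → ∑ℚ n (majorant 4) ≤ℚ E) (n : ℕ) where

      private
        -- One bound has to serve for both factors: E for the partial sums and 5 = 2 · 2 + 1 for the
        -- Cayley transforms. It is also at least 1, by which δ² is absorbed into δ (δ E′ + μ).
        E′ = E + + 5 / 1
        μ = majorant 4 (suc n)
        0≤E : 0ℚ ≤ℚ E
        0≤E = ∑≤E 0
        E≤E′ : E ≤ℚ E′
        E≤E′ = p≤p+q (0≤/ 5 1)
        1≤E′ : 1ℚ ≤ℚ E′
        1≤E′ = ℚₚ.≤-trans (subst (_≤ℚ + 5 / 1) 1/1≡1 (/1-mono-≤ {1} {5} (ℕ.s≤s ℕ.z≤n))) (q≤p+q 0≤E)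
        0≤E′ : 0ℚ ≤ℚ E′
        0≤E′ = ℚₚ.≤-trans 0≤E E≤E′
        0≤δ : 0ℚ ≤ℚ δ
        0≤δ = 0≤* (0≤/ 4 1) (0≤/ 1 K)
        0≤μ : 0ℚ ≤ℚ μ
        0≤μ = majorant-nonneg 4 (suc n)
        arg : ℕ → ℚ[i]
        arg j = iᵍ *ᵍ ι (½ * ∑ℚ j (πterm a))
        arg-suc : ∀ j → arg (suc j) ≡ arg j +ᵍ h j
        arg-suc j = trans (cong (iᵍ *ᵍ_) (trans (cong ι (ℚₚ.*-distribˡ-+ ½ (∑ℚ j (πterm a)) (πterm a j))) (ι-+-homo (½ * ∑ℚ j (πterm a)) (½ * πterm a j))))
          (ℚ[i].distribˡ iᵍ (ι (½ * ∑ℚ j (πterm a))) (ι (½ * πterm a j)))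
        ‖arg‖ : ∀ j → j ℕ.≤ K → ‖ arg j ‖ ≤ℚ + 4 / 1
        ‖arg‖ j j≤K = subst (_≤ℚ + 4 / 1) (sym (‖i*ι‖ (0≤* (ℚₚ.<⇒≤ 0<½) (0≤∑πterm a j))))
          (ℚₚ.≤-trans (½*p≤p (0≤∑πterm a j)) (∑πterm≤4 a j j≤K))
        x : ℕ → ℚ[i]
        x j = partial (arg j) (2+ n)

      partial-½π : ‖ partial (0ℚ , ½ * πℚ a) (2+ n) *ᵍ -ᵍ iᵍ +ᵍ -ᵍ 1ᵍ ‖ ≤ℚ Error (+ 4 / 1) E′ a μ
      partial-½π = subst (λ d → ‖ d ‖ ≤ℚ Error (+ 4 / 1) E′ a μ)
        (cong₂ (λ a b → a +ᵍ -ᵍ b)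
          (cong₂ _*ᵍ_ (cong (λ z → partial z (2+ n)) (i*ι (½ * πℚ a))) y-last)
          (trans (cong₂ _*ᵍ_ (trans (cong (λ z → partial z (2+ n)) (i*ι (½ * 0ℚ))) (partial-0 (suc n))) y-first) (ℚ[i].*-identityˡ 1ᵍ)))
        (product-constant-Error x y h a (0≤/ 4 1) 0≤E′ 0≤μ
          (λ j j≤K → ℚₚ.≤-trans (ℚₚ.≤-trans (‖partial‖ {arg j} (‖arg‖ j j≤K) (2+ n)) (∑≤E (2+ n))) E≤E′)
          (λ j j≤K → ℚₚ.≤-trans (‖y‖ j j≤K) (q≤p+q 0≤E))
          (λ j _ → ‖h‖ j)
          (λ j j<K → subst (λ z → ‖ partial z (2+ n) +ᵍ -ᵍ ((1ᵍ +ᵍ h j) *ᵍ x j) ‖ ≤ℚ δ * (δ * E′ + μ)) (sym (arg-suc j))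
            (Euler-step (arg j) (h j) n (‖arg‖ j (ℕₚ.<⇒≤ j<K)) (subst (λ z → ‖ z ‖ ≤ℚ + 4 / 1) (arg-suc j) (‖arg‖ (suc j) j<K)) (‖h‖ j)
              0≤E′ (λ n → ℚₚ.≤-trans (∑≤E n) E≤E′)))
          (λ j j<K → ℚₚ.≤-trans (y-step j j<K) (ℚₚ.*-monoˡ-≤-nonNeg δ {{ℚ.nonNegative 0≤δ}}
            (ℚₚ.≤-trans (subst (_≤ℚ δ * E′) (ℚₚ.*-identityʳ δ) (ℚₚ.*-monoˡ-≤-nonNeg δ {{ℚ.nonNegative 0≤δ}} 1≤E′)) (p≤p+q 0≤μ)))))
        where
        open ℕ-Solver using () renaming (_:+_ to _⊕_; _:*_ to _⊗_; _:=_ to _⊜_; con to κ′)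
        y-first : y 0 ≡ 1ᵍ
        y-first = cong₂ cayley (0/n≡0 K) (trans (/-≡ (K ℕ.* K) (K ℕ.* K ℕ.+ 0) 1 1
          (ℕ-Solver.solve 1 (λ k → k ⊗ κ′ 1 ⊜ κ′ 1 ⊗ (k ⊕ κ′ 0)) refl (K ℕ.* K))) 1/1≡1)
        -- At t = 1 the transform is (1 - i)/(1 + i) = -i.
        y-last : y K ≡ -ᵍ iᵍ
        y-last = trans (cong₂ cayley (n/n≡1 K) (/-≡ (K ℕ.* K) (K ℕ.* K ℕ.+ K ℕ.* K) 1 2
          (ℕ-Solver.solve 1 (λ k → k ⊗ κ′ 2 ⊜ κ′ 1 ⊗ (k ⊕ k)) refl (K ℕ.* K)))) (cong (cayley 1ℚ) 1/2≡½)

  iπ/2 : ℂ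
  iπ/2 = mkℂ 0ℝ (fromℚ ½ Defs.* π)

  -iᶜ : ℂ
  -iᶜ = mkℂ 0ℝ (Defs.- 1ℝ)

  exp-iπ/2 : exp iπ/2 *ᶜ -iᶜ ≈ᶜ 1ᶜ
  exp-iπ/2 =
    let E , ∑≤E = ∑ℚ-majorant-bounded 4
    in ‖‖-null⇒≈ᶜ (exp iπ/2 *ᶜ -iᶜ) 1ᶜ
      -- The approximation of index n + 2 contains `πℚ (2+ n)`, which fixes the number of Euler
      -- steps as n + 3. The error therefore has index n + 2 while the majorant has index n + 1, a
      -- mismatch that `ℕ.pred` absorbs below.
      (λ n → subst (λ z → ‖ z *ᵍ -ᵍ iᵍ +ᵍ -ᵍ 1ᵍ ‖ ≤ℚ Error (+ 4 / 1) (E + + 5 / 1) (2+ n) (majorant 4 (suc n)))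
        (sym (exp-at iπ/2 (2+ n))) (partial-½π (2+ n) ∑≤E n))
      (Null-suc (Null-suc (Error-null (+ 4 / 1) (E + + 5 / 1) {λ m → majorant 4 (ℕ.pred m)}
        (Null-shift₂ (λ n → ℚₚ.≤-reflexive (ℚₚ.0≤p⇒∣p∣≡p (majorant-nonneg 4 (suc n)))) (Null-suc (majorant-null 4))))))

-- Numerical bounds from three terms of the series; conjugation

module _ where

  open ℚ using (_+_; _*_; _-_; -_; ∣_∣) renaming (_≤_ to _≤ℚ_; _<_ to _<ℚ_)

  opaque
    unfolding Defs._/_

    2*majorant≤½ : (+ 2 / 1) * majorant 1 3 ≤ℚ ½
    2*majorant≤½ = ℚₚ.≤ᵇ⇒≤ {(+ 2 / 1) * majorant 1 3} {½} _

  ∣p∣≤q⇒-q≤p : ∀ {p q} → ∣ p ∣ ≤ℚ q → - q ≤ℚ p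
  ∣p∣≤q⇒-q≤p {p} {q} h = subst (- q ≤ℚ_) (solve 1 (λ p → :- (:- p) := p) refl p)
    (ℚₚ.neg-antimono-≤ (ℚₚ.≤-trans (-p≤∣p∣ p) h))

  -- For arguments of norm at most 1 the tail from index 3 on is at most 2/3! = 1/3, so a
  -- nonnegative sum of the first three terms cannot fall below -1/2 later.
  majorised-lower : ∀ (s t : ℕ → ℚ) → (∀ n → s (suc n) ≡ s n + t n) → (∀ n → ∣ t n ∣ ≤ℚ majorant 1 n) → 0ℚ ≤ℚ s 3 →
                    ∀ n → - ½ ≤ℚ s (suc (suc (suc n)))
  majorised-lower s t step t≤ 0≤s₃ n = subst (λ k → - ½ ≤ℚ s k) (ℕₚ.+-comm n 3) (begin
    - ½                                ≤⟨ ℚₚ.neg-antimono-≤ 2*majorant≤½ ⟩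
    - ((+ 2 / 1) * majorant 1 3) ≤⟨ ∣p∣≤q⇒-q≤p (majorised-tail 1 s t step t≤ 3 (ℕ.s≤s (ℕ.s≤s ℕ.z≤n)) n) ⟩
    s (n ℕ.+ 3) - s 3                  ≤⟨ ℚₚ.+-monoʳ-≤ (s (n ℕ.+ 3)) (ℚₚ.neg-antimono-≤ 0≤s₃) ⟩
    s (n ℕ.+ 3) - 0ℚ                   ≡⟨ ℚₚ.+-identityʳ (s (n ℕ.+ 3)) ⟩
    s (n ℕ.+ 3)                        ∎)
    where open ℚₚ.≤-Reasoning

  module _ {v : ℚ} (0≤v : 0ℚ ≤ℚ v) (v≤1 : v ≤ℚ 1ℚ) where

    private
      z : ℚ[i]
      z = 0ℚ , v
      z≤1 : ‖ z ‖ ≤ℚ + 1 / 1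
      z≤1 = subst₂ _≤ℚ_ (sym (trans (ℚₚ.+-identityˡ ∣ v ∣) (ℚₚ.0≤p⇒∣p∣≡p 0≤v))) (sym 1/1≡1) v≤1
      c = 1/ 2 !
      0≤c : 0ℚ ≤ℚ c
      0≤c = 0≤/ 1 2
      -- The terms 1, iv and -v²/2. For 0 ≤ v ≤ 1 both parts are nonnegative, as `majorised-lower`
      -- requires.
      partial-3 : partial z 3 ≡ (1ℚ - c * (v * v) , v)
      partial-3 = trans (cong (λ a → a +ᵍ term z 2) (cong₂ (λ a b → 0ᵍ +ᵍ a +ᵍ b) (term-zero z) (term-one z)))
        (cong₂ _,_
          (solve 2 (λ c v → con 0ℚ :+ con 1ℚ :+ con 0ℚ :+ (c :* (con 0ℚ :* (con 0ℚ :* con 1ℚ :+ :- (v :* con 0ℚ))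
               :+ :- (v :* (con 0ℚ :* con 0ℚ :+ v :* con 1ℚ)))
               :+ :- (con 0ℚ :* (con 0ℚ :* (con 0ℚ :* con 0ℚ :+ v :* con 1ℚ) :+ v :* (con 0ℚ :* con 1ℚ :+ :- (v :* con 0ℚ)))))
               := con 1ℚ :- c :* (v :* v)) refl c v)
          (solve 2 (λ c v → con 0ℚ :+ con 0ℚ :+ v :+ (c :* (con 0ℚ :* (con 0ℚ :* con 0ℚ :+ v :* con 1ℚ) :+ v :* (con 0ℚ :* con 1ℚ :+ :- (v :* con 0ℚ)))
               :+ con 0ℚ :* (con 0ℚ :* (con 0ℚ :* con 1ℚ :+ :- (v :* con 0ℚ))
               :+ :- (v :* (con 0ℚ :* con 0ℚ :+ v :* con 1ℚ))))
               := v) refl c v))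
      c*v²≤1 : c * (v * v) ≤ℚ 1ℚ
      c*v²≤1 = *-mono-≤ 0≤c (ℚₚ.<⇒≤ 0<1) (subst (c ≤ℚ_) 1/1≡1 (/-mono-≤ 1 2 1 1 (ℕ.s≤s ℕ.z≤n))) (*-mono-≤ 0≤v (ℚₚ.<⇒≤ 0<1) v≤1 v≤1)

    re-partial≥-½ : ∀ n → - ½ ≤ℚ proj₁ (partial z (suc (suc (suc n))))
    re-partial≥-½ = majorised-lower (λ n → proj₁ (partial z n)) (λ n → proj₁ (term z n)) (λ _ → refl)
      (λ n → ℚₚ.≤-trans (p≤p+q (ℚₚ.0≤∣p∣ (proj₂ (term z n)))) (‖term‖ {z} z≤1 n))
      (subst (0ℚ ≤ℚ_) (sym (cong proj₁ partial-3))
        (subst (_≤ℚ 1ℚ - c * (v * v)) (ℚₚ.+-inverseʳ (c * (v * v))) (ℚₚ.+-monoˡ-≤ (- (c * (v * v))) c*v²≤1)))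

    im-partial≥-½ : ∀ n → - ½ ≤ℚ proj₂ (partial z (suc (suc (suc n))))
    im-partial≥-½ = majorised-lower (λ n → proj₂ (partial z n)) (λ n → proj₂ (term z n)) (λ _ → refl)
      (λ n → ℚₚ.≤-trans (q≤p+q (ℚₚ.0≤∣p∣ (proj₁ (term z n)))) (‖term‖ {z} z≤1 n))
      (subst (0ℚ ≤ℚ_) (sym (cong proj₂ partial-3)) 0≤v)

  conjᵍ : ℚ[i] → ℚ[i]
  conjᵍ (x , y) = x , - y

  conjᵍ-+ : ∀ z w → conjᵍ (z +ᵍ w) ≡ conjᵍ z +ᵍ conjᵍ w
  conjᵍ-+ (x , y) (u , v) = cong (x + u ,_) (ℚₚ.neg-distrib-+ y v)

  conjᵍ-* : ∀ z w → conjᵍ (z *ᵍ w) ≡ conjᵍ z *ᵍ conjᵍ w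
  conjᵍ-* (x , y) (u , v) = cong₂ _,_
    (solve 4 (λ x y u v → x :* u :+ :- (y :* v) := x :* u :+ :- (:- y :* :- v)) refl x y u v)
    (solve 4 (λ x y u v → :- (x :* v :+ y :* u) := x :* :- v :+ :- y :* u) refl x y u v)

  conjᵍ-^ : ∀ z n → conjᵍ (z ^ᵍ n) ≡ conjᵍ z ^ᵍ n
  conjᵍ-^ z zero    = refl
  conjᵍ-^ z (suc n) = trans (conjᵍ-* z (z ^ᵍ n)) (cong (conjᵍ z *ᵍ_) (conjᵍ-^ z n))

  conjᵍ-partial : ∀ z n → conjᵍ (partial z n) ≡ partial (conjᵍ z) n
  conjᵍ-partial z zero    = refl
  conjᵍ-partial z (suc n) = trans (conjᵍ-+ (partial z n) (term z n))
    (cong₂ _+ᵍ_ (conjᵍ-partial z n) (trans (conjᵍ-* (ι 1/ n ! ) (z ^ᵍ n)) (cong (ι 1/ n ! *ᵍ_) (conjᵍ-^ z n))))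

  exp-pointwise : ∀ {z w} → (∀ n → z at n ≡ w at n) → exp z ≈ᶜ exp w
  exp-pointwise {z} {w} z≡w = pointwise-≈ᶜ {exp z} {exp w} λ n →
    trans (exp-at z n) (trans (cong (λ a → partial a n) (z≡w n)) (sym (exp-at w n)))

  conj-exp : ∀ z → conj (exp z) ≈ᶜ exp (conj z)
  conj-exp z = pointwise-≈ᶜ {conj (exp z)} {exp (conj z)} λ n →
    trans (cong conjᵍ (exp-at z n)) (trans (conjᵍ-partial (z at n) n) (sym (exp-at (conj z) n)))

  exp-0 : exp 0ᶜ ≈ᶜ 1ᶜ
  exp-0 = ‖‖-null⇒≈ᶜ (exp 0ᶜ) 1ᶜ {λ _ → 0ℚ}
    (λ n → ℚₚ.≤-reflexive (cong (λ a → ‖ a +ᵍ -ᵍ 1ᵍ ‖) (trans (exp-at 0ᶜ (2+ n)) (partial-0 (suc n)))))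
    (λ ε 0<ε → always λ _ → 0<ε)

-- The functional equation, and translations by 1/4

module _ where

  open Defs using (_+_; _*_; -_)
  private module ℂᵣ = CommutativeRing ℂ-commutativeRing

  -- In `exp-+-neg` one divides by `exp (-ᶜ w)`; that its inverse is `exp w` is the case z = 0 of
  -- the same identity.
  exp-+ : ∀ z w → exp (z +ᶜ w) ≈ᶜ exp z *ᶜ exp w
  exp-+ z w = divide-by-unit ℂ-commutativeRing {exp (z +ᶜ w)} {exp (-ᶜ w)} {exp z} {exp w} (exp-+-neg z w) (begin
    exp (-ᶜ w) *ᶜ exp w        ≈⟨ ℂᵣ.*-comm (exp (-ᶜ w)) (exp w) ⟩
    exp w *ᶜ exp (-ᶜ w)        ≈⟨ ℂᵣ.*-cong {exp (0ᶜ +ᶜ w)} {exp w} {exp (-ᶜ w)} {exp (-ᶜ w)}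
                                    (exp-pointwise {0ᶜ +ᶜ w} {w} λ n → ℚ[i].+-identityˡ (w at n)) (ℂᵣ.refl {exp (-ᶜ w)}) ⟨
    exp (0ᶜ +ᶜ w) *ᶜ exp (-ᶜ w) ≈⟨ exp-+-neg 0ᶜ w ⟩
    exp 0ᶜ                     ≈⟨ exp-0 ⟩
    1ᶜ                         ∎)
    where open import Relation.Binary.Reasoning.Setoid ℂᵣ.setoid

  iᶜ : ℂ
  iᶜ = mkℂ 0ℝ 1ℝ

  exp-iπ/2≈i : exp iπ/2 ≈ᶜ iᶜ
  exp-iπ/2≈i = ℂᵣ.trans {exp iπ/2} {1ᶜ *ᶜ iᶜ} {iᶜ}
    (divide-by-unit ℂ-commutativeRing {exp iπ/2} { -iᶜ} {1ᶜ} {iᶜ} exp-iπ/2 (pointwise-≈ᶜ { -iᶜ *ᶜ iᶜ} {1ᶜ} λ _ → refl))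
    (ℂᵣ.*-identityˡ iᶜ)

  𝐞 : ℚ → ℂ
  𝐞 q = e (fromℚ q)

  private
    angle : ℚ → ℂ
    angle q = mkℂ 0ℝ (fromℕ 2 * π * fromℚ q)

  𝐞-+ : ∀ p q → 𝐞 (p ℚ.+ q) ≈ᶜ 𝐞 p *ᶜ 𝐞 q
  𝐞-+ p q = ℂᵣ.trans {𝐞 (p ℚ.+ q)} {exp (angle p +ᶜ angle q)} {𝐞 p *ᶜ 𝐞 q}
    (exp-pointwise {angle (p ℚ.+ q)} {angle p +ᶜ angle q} λ n → cong₂ _,_ (sym (ℚₚ.+-identityʳ 0ℚ))
      (ℚₚ.*-distribˡ-+ ((+ 2 / 1) ℚ.* πℚ n) p q))
    (exp-+ (angle p) (angle q))

  𝐞-conj : ∀ q → conj (𝐞 q) ≈ᶜ 𝐞 (ℚ.- q)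
  𝐞-conj q = ℂᵣ.trans {conj (𝐞 q)} {exp (conj (angle q))} {𝐞 (ℚ.- q)} (conj-exp (angle q))
    (exp-pointwise {conj (angle q)} {angle (ℚ.- q)} λ n → cong (0ℚ ,_) (ℚₚ.neg-distribʳ-* ((+ 2 / 1) ℚ.* πℚ n) q))

  𝐞-0 : 𝐞 0ℚ ≈ᶜ 1ᶜ
  𝐞-0 = ℂᵣ.trans {𝐞 0ℚ} {exp 0ᶜ} {1ᶜ}
    (exp-pointwise {angle 0ℚ} {0ᶜ} λ n → cong (0ℚ ,_) (ℚₚ.*-zeroʳ ((+ 2 / 1) ℚ.* πℚ n))) exp-0

  ¼ : ℚ
  ¼ = + 1 / 4

  𝐞-¼ : 𝐞 ¼ ≈ᶜ iᶜ
  𝐞-¼ = ℂᵣ.trans {𝐞 ¼} {exp iπ/2} {iᶜ}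
    (exp-pointwise {angle ¼} {iπ/2} λ n → cong (0ℚ ,_)
      (trans (solve 3 (λ c p q → c :* p :* q := (c :* q) :* p) refl (+ 2 / 1) (πℚ n) ¼) (cong (ℚ._* πℚ n) 2/1*1/4≡½)))
    exp-iπ/2≈i

  𝐞-¼+ : ∀ q → 𝐞 (¼ ℚ.+ q) ≈ᶜ iᶜ *ᶜ 𝐞 q
  𝐞-¼+ q = ℂᵣ.trans {𝐞 (¼ ℚ.+ q)} {𝐞 ¼ *ᶜ 𝐞 q} {iᶜ *ᶜ 𝐞 q} (𝐞-+ ¼ q) (ℂᵣ.*-cong {𝐞 ¼} {iᶜ} {𝐞 q} {𝐞 q} 𝐞-¼ (ℂᵣ.refl {𝐞 q}))

  i*i* : ∀ z → iᶜ *ᶜ (iᶜ *ᶜ z) ≈ᶜ -ᶜ z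
  i*i* z = pointwise-≈ᶜ {iᶜ *ᶜ (iᶜ *ᶜ z)} { -ᶜ z} λ n →
    ℚ[i]-Solver.solve 1 (λ z → c (0ℚ , 1ℚ) ⊗ (c (0ℚ , 1ℚ) ⊗ z) ⊜ ⊝ z) refl (z at n)
    where open ℚ[i]-Solver using () renaming (_:*_ to _⊗_; _:=_ to _⊜_; con to c; :-_ to ⊝_)

  -ᶜ-involutive : ∀ z → -ᶜ (-ᶜ z) ≈ᶜ z
  -ᶜ-involutive z = pointwise-≈ᶜ { -ᶜ (-ᶜ z)} {z} λ n → ℚ[i]-Solver.solve 1 (λ z → ⊝ (⊝ z) ⊜ z) refl (z at n)
    where open ℚ[i]-Solver using () renaming (_:=_ to _⊜_; :-_ to ⊝_)

  re-i* : ∀ z → re (iᶜ *ᶜ z) ≈ - im z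
  re-i* z = pointwise-≈ {re (iᶜ *ᶜ z)} { - im z} λ n →
    solve 2 (λ a b → con 0ℚ :* a :+ :- (con 1ℚ :* b) := :- b) refl (seq (re z) n) (seq (im z) n)

  𝐞-½+ : ∀ q → 𝐞 (¼ ℚ.+ (¼ ℚ.+ q)) ≈ᶜ -ᶜ 𝐞 q
  𝐞-½+ q = begin
    𝐞 (¼ ℚ.+ (¼ ℚ.+ q))    ≈⟨ 𝐞-¼+ (¼ ℚ.+ q) ⟩
    iᶜ *ᶜ 𝐞 (¼ ℚ.+ q)      ≈⟨ ℂᵣ.*-cong {iᶜ} {iᶜ} {𝐞 (¼ ℚ.+ q)} {iᶜ *ᶜ 𝐞 q} (ℂᵣ.refl {iᶜ}) (𝐞-¼+ q) ⟩
    iᶜ *ᶜ (iᶜ *ᶜ 𝐞 q)      ≈⟨ i*i* (𝐞 q) ⟩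
    -ᶜ 𝐞 q                 ∎
    where open import Relation.Binary.Reasoning.Setoid ℂᵣ.setoid

  opaque
    unfolding Defs._/_

    4*¼≡1 : ¼ ℚ.+ (¼ ℚ.+ (¼ ℚ.+ (¼ ℚ.+ 0ℚ))) ≡ 1ℚ
    4*¼≡1 = refl

  𝐞-4*¼+ : ∀ q → 𝐞 (¼ ℚ.+ (¼ ℚ.+ (¼ ℚ.+ (¼ ℚ.+ q)))) ≈ᶜ 𝐞 q
  𝐞-4*¼+ q = begin
    𝐞 (¼ ℚ.+ (¼ ℚ.+ (¼ ℚ.+ (¼ ℚ.+ q))))    ≈⟨ 𝐞-½+ (¼ ℚ.+ (¼ ℚ.+ q)) ⟩
    -ᶜ 𝐞 (¼ ℚ.+ (¼ ℚ.+ q))                 ≈⟨ ℂᵣ.-‿cong {𝐞 (¼ ℚ.+ (¼ ℚ.+ q))} { -ᶜ 𝐞 q} (𝐞-½+ q) ⟩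
    -ᶜ (-ᶜ 𝐞 q)                            ≈⟨ -ᶜ-involutive (𝐞 q) ⟩
    𝐞 q                                    ∎
    where open import Relation.Binary.Reasoning.Setoid ℂᵣ.setoid

  -- e(1) = e(1/4)⁴ = i⁴.
  𝐞-1 : 𝐞 1ℚ ≈ᶜ 1ᶜ
  𝐞-1 = subst (λ q → 𝐞 q ≈ᶜ 1ᶜ) 4*¼≡1
    (ℂᵣ.trans {𝐞 (¼ ℚ.+ (¼ ℚ.+ (¼ ℚ.+ (¼ ℚ.+ 0ℚ))))} {𝐞 0ℚ} {1ᶜ} (𝐞-4*¼+ 0ℚ) 𝐞-0)

-- The real part of e(y) for y in [1/4, 1/2]

module _ where

  open ℚ using (_+_; _*_; _-_; -_; ∣_∣) renaming (_≤_ to _≤ℚ_; _<_ to _<ℚ_)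

  πℚ≤4 : ∀ n → πℚ n ≤ℚ + 4 / 1
  πℚ≤4 n = ∑πterm≤4 n (suc n) ℕₚ.≤-refl

  -- With the crude bound 4 for π, the argument 2πu stays in [0, 1] for 0 ≤ u ≤ 1/8, the range of
  -- the bounds from three terms.
  ⅛ : ℚ
  ⅛ = + 1 / 8

  opaque
    unfolding Defs._/_

    2*4*⅛≡1 : (+ 2 / 1) * (+ 4 / 1) * ⅛ ≡ 1ℚ
    2*4*⅛≡1 = refl

    ½-⅜≡⅛ : ½ - (¼ + ⅛) ≡ ⅛
    ½-⅜≡⅛ = refl

    ½≡2*¼ : ½ ≡ ¼ + ¼
    ½≡2*¼ = refl

  module _ {u : ℚ} (0≤u : 0ℚ ≤ℚ u) (u≤⅛ : u ≤ℚ ⅛) where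

    private
      v : ℕ → ℚ
      v n = (+ 2 / 1) * πℚ n * u
      0≤πℚ : ∀ n → 0ℚ ≤ℚ πℚ n
      0≤πℚ n = 0≤∑πterm n (suc n)
      0≤v : ∀ n → 0ℚ ≤ℚ v n
      0≤v n = 0≤* (0≤* (0≤/ 2 1) (0≤πℚ n)) 0≤u
      v≤1 : ∀ n → v n ≤ℚ 1ℚ
      v≤1 n = subst (v n ≤ℚ_) 2*4*⅛≡1 (*-mono-≤ (0≤* (0≤/ 2 1) (0≤πℚ n)) (0≤/ 1 8)
        (ℚₚ.*-monoˡ-≤-nonNeg (+ 2 / 1) {{ℚ.nonNegative (0≤/ 2 1)}} (πℚ≤4 n)) u≤⅛)
      eventually-≥ : ∀ x → (∀ n → - ½ ≤ℚ seq x (suc (suc (suc n)))) → fromℚ (- ½) ≤ x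
      eventually-≥ x h ε 0<ε = 3 , λ where
        (suc (suc (suc n))) _ → ℚₚ.≤-<-trans (h n) (p<p+q 0<ε)
        (suc (suc zero)) (ℕ.s≤s (ℕ.s≤s ()))
        (suc zero) (ℕ.s≤s ())

    re-𝐞≥-½ : fromℚ (- ½) ≤ re (𝐞 u)
    re-𝐞≥-½ = eventually-≥ (re (𝐞 u)) λ n → subst (λ a → - ½ ≤ℚ proj₁ a) (sym (exp-at (mkℂ 0ℝ (fromℕ 2 Defs.* π Defs.* fromℚ u)) (suc (suc (suc n)))))
      (re-partial≥-½ (0≤v (suc (suc (suc n)))) (v≤1 (suc (suc (suc n)))) n)

    im-𝐞≥-½ : fromℚ (- ½) ≤ im (𝐞 u)
    im-𝐞≥-½ = eventually-≥ (im (𝐞 u)) λ n → subst (λ a → - ½ ≤ℚ proj₂ a) (sym (exp-at (mkℂ 0ℝ (fromℕ 2 Defs.* π Defs.* fromℚ u)) (suc (suc (suc n)))))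
      (im-partial≥-½ (0≤v (suc (suc (suc n)))) (v≤1 (suc (suc (suc n)))) n)

  neg-antimono-≤ : ∀ {x y} → x ≤ y → (Defs.- y) ≤ (Defs.- x)
  neg-antimono-≤ {x} {y} x≤y ε 0<ε = eventually (λ n h → subst₂ _<ℚ_
      (solve 2 (λ x y → x :- (x :+ y) := :- y) refl (seq x n) (seq y n))
      (solve 3 (λ x y e → (y :+ e) :- (x :+ y) := :- x :+ e) refl (seq x n) (seq y n) ε)
      (ℚₚ.+-monoˡ-< (- (seq x n + seq y n)) h))
    (x≤y ε 0<ε)

  -x≤½ : ∀ {x} → fromℚ (- ½) ≤ x → (Defs.- x) ≤ fromℚ ½
  -x≤½ {x} h = neg-antimono-≤ {fromℚ (- ½)} {x} h

  module _ {y : ℚ} where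

    -- e(1/4 + u) = i e(u)
    re-𝐞≤½-lower : ¼ ≤ℚ y → y ≤ℚ ¼ + ⅛ → re (𝐞 y) ≤ fromℚ ½
    re-𝐞≤½-lower ¼≤y y≤⅜ = ≤-trans {re (𝐞 y)} {Defs.- im (𝐞 u)} {fromℚ ½}
      (≤-reflexive {re (𝐞 y)} {Defs.- im (𝐞 u)}
        (≈-trans {re (𝐞 y)} {re (iᶜ *ᶜ 𝐞 u)} {Defs.- im (𝐞 u)}
          (subst (λ q → re (𝐞 q) ≈ re (iᶜ *ᶜ 𝐞 u)) ¼+u≡y (proj₁ (𝐞-¼+ u))) (re-i* (𝐞 u))))
      (-x≤½ {im (𝐞 u)} (im-𝐞≥-½ {u} 0≤u u≤⅛))
      where
      u = y - ¼
      ¼+u≡y : ¼ + u ≡ y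
      ¼+u≡y = solve 2 (λ q y → q :+ (y :- q) := y) refl ¼ y
      0≤u : 0ℚ ≤ℚ u
      0≤u = subst (_≤ℚ u) (ℚₚ.+-inverseʳ ¼) (ℚₚ.+-monoˡ-≤ (- ¼) ¼≤y)
      u≤⅛ : u ≤ℚ ⅛
      u≤⅛ = subst (u ≤ℚ_) ([x+y]-x≡y ¼ ⅛) (ℚₚ.+-monoˡ-≤ (- ¼) y≤⅜)

    -- e(1/2 - u) = - conj (e(u))
    re-𝐞≤½-upper : ¼ + ⅛ ≤ℚ y → y ≤ℚ ½ → re (𝐞 y) ≤ fromℚ ½
    re-𝐞≤½-upper ⅜≤y y≤½ = ≤-trans {re (𝐞 y)} {Defs.- re (𝐞 u)} {fromℚ ½}
      (≤-reflexive {re (𝐞 y)} {Defs.- re (𝐞 u)}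
        (≈-trans {re (𝐞 y)} {re (-ᶜ 𝐞 (- u))} {Defs.- re (𝐞 u)}
          (subst (λ q → re (𝐞 q) ≈ re (-ᶜ 𝐞 (- u))) ½-u≡y (proj₁ (𝐞-½+ (- u))))
          (-ℝ-cong {re (𝐞 (- u))} {re (𝐞 u)} (≈-sym {re (𝐞 u)} {re (𝐞 (- u))} (proj₁ (𝐞-conj u))))))
      (-x≤½ {re (𝐞 u)} (re-𝐞≥-½ {u} 0≤u u≤⅛))
      where
      u = ½ - y
      ½-u≡y : ¼ + (¼ + - u) ≡ y
      ½-u≡y = trans (cong (λ h → ¼ + (¼ + - (h - y))) ½≡2*¼)
        (solve 2 (λ q y → q :+ (q :+ :- ((q :+ q) :- y)) := y) refl ¼ y)
      0≤u : 0ℚ ≤ℚ u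
      0≤u = subst (_≤ℚ u) (ℚₚ.+-inverseʳ y) (ℚₚ.+-monoˡ-≤ (- y) y≤½)
      u≤⅛ : u ≤ℚ ⅛
      u≤⅛ = subst (u ≤ℚ_) ½-⅜≡⅛ (ℚₚ.+-monoʳ-≤ ½ (ℚₚ.neg-antimono-≤ ⅜≤y))

    -- Split at 3/8, so that y is within 1/8 of 1/4 or of 1/2; comparison of rationals decides the
    -- case.
    re-𝐞≤½ : ¼ ≤ℚ y → y ≤ℚ ½ → re (𝐞 y) ≤ fromℚ ½
    re-𝐞≤½ ¼≤y y≤½ = [ re-𝐞≤½-lower ¼≤y , (λ ⅜≤y → re-𝐞≤½-upper ⅜≤y y≤½) ]′ (ℚₚ.≤-total y (¼ + ⅛))

-- The concrete complex numbers and additive characters modulo r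

open Defs using (_+_; _*_; -_; ∣_∣)

private module Rℂ = CommutativeRing ℂ-commutativeRing

complexNumbers : ComplexNumbers
complexNumbers = record
  { ℝ-ring = ℝ-commutativeRing
  ; ℂ-ring = ℂ-commutativeRing
  ; _≤_ = _≤_
  ; ≤-isPreorder = record
    { isEquivalence = Rℝ.isEquivalence
    ; reflexive = λ {x} {y} → ≤-reflexive {x} {y}
    ; trans = λ {x} {y} {z} → ≤-trans {x} {y} {z}
    }
  ; +-mono-≤ = λ {x} {y} {u} {v} → +ℝ-mono-≤ {x} {y} {u} {v}
  ; 0≤* = λ {x} {y} → 0≤ℝ* {x} {y}
  ; 0≤x² = 0≤x²ℝ
  ; square-cancel-≤ = λ {x} {y} → square-cancel-≤ {x} {y}
  ; fromℚ = fromℚ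
  ; fromℚ-+ = λ p q → ≈-refl {fromℚ (p ℚ.+ q)}
  ; fromℚ-* = λ p q → ≈-refl {fromℚ (p ℚ.* q)}
  ; fromℚ-neg = λ p → ≈-refl {fromℚ (ℚ.- p)}
  ; fromℚ-0 = ≈-refl {0ℝ}
  ; fromℚ-1 = ≈-refl {1ℝ}
  ; fromℚ-mono-≤ = λ {p} {q} p≤q → pointwise-≤ {fromℚ p} {fromℚ q} λ _ → p≤q
  ; re = re
  ; re-cong = proj₁
  ; re-+ = λ z w → ≈-refl {re (z +ᶜ w)}
  ; re-neg = λ z → ≈-refl {re (-ᶜ z)}
  ; re-0 = ≈-refl {0ℝ}
  ; re-1 = ≈-refl {1ℝ}
  ; conj = conj
  ; conj-cong = λ {z} {w} (p , q) → p , -ℝ-cong {im z} {im w} q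
  ; conj-+ = λ z w → pointwise-≈ᶜ {conj (z +ᶜ w)} {conj z +ᶜ conj w} λ n → conjᵍ-+ (z at n) (w at n)
  ; conj-* = λ z w → pointwise-≈ᶜ {conj (z *ᶜ w)} {conj z *ᶜ conj w} λ n → conjᵍ-* (z at n) (w at n)
  ; conj-0 = pointwise-≈ᶜ {conj 0ᶜ} {0ᶜ} λ _ → refl
  ; conj-1 = pointwise-≈ᶜ {conj 1ᶜ} {1ᶜ} λ _ → refl
  ; ∣_∣ = ∣_∣
  ; ∣∣-cong = λ {z} {w} → ∣∣-cong {z} {w}
  ; 0≤∣∣ = 0≤∣_∣
  ; ∣0∣ = square-injective {∣ 0ᶜ ∣} {0ℝ} 0≤∣ 0ᶜ ∣ (≤-reflexive {0ℝ} {0ℝ} (≈-refl {0ℝ}))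
      (≈-trans {∣ 0ᶜ ∣ ²} {norm 0ᶜ} {0ℝ ²} ∣ 0ᶜ ∣² (pointwise-≈ {norm 0ᶜ} {0ℝ ²} λ _ → refl))
  ; ∣1∣ = square-injective {∣ 1ᶜ ∣} {1ℝ} 0≤∣ 1ᶜ ∣ (pointwise-≤ {0ℝ} {1ℝ} λ _ → ℚₚ.<⇒≤ 0<1)
      (≈-trans {∣ 1ᶜ ∣ ²} {norm 1ᶜ} {1ℝ ²} ∣ 1ᶜ ∣² (pointwise-≈ {norm 1ᶜ} {1ℝ ²} λ _ → refl))
  ; ∣∣≤0⇒≈0 = λ {z} → ∣∣≤0⇒≈0 z
  ; ∣∣-* = ∣∣-*
  ; ∣conj∣ = ∣conj∣
  ; re≤∣∣ = re≤∣_∣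
  ; ∣∣²-+ = ∣∣²-+
  }
  where
  -- If x is the real or imaginary part, then x² ≤ |z|² ≤ 0 gives x ≤ 0, and the same argument for
  -- -x gives x ≥ 0.
  ∣∣≤0⇒≈0 : ∀ z → ∣ z ∣ ≤ 0ℝ → z ≈ᶜ 0ᶜ
  ∣∣≤0⇒≈0 z ∣z∣≤0 = zero-part (re z) (λ n → p≤p+q (0≤p² (seq (im z) n))) , zero-part (im z) (λ n → q≤p+q (0≤p² (seq (re z) n)))
    where
    norm≤0 : norm z ≤ 0ℝ
    norm≤0 = ≤-trans {norm z} {∣ z ∣ ²} {0ℝ} (≤-reflexive {norm z} {∣ z ∣ ²} (≈-sym {∣ z ∣ ²} {norm z} ∣ z ∣²))
      (≤-reflexive {∣ z ∣ ²} {0ℝ} (≈-trans {∣ z ∣ ²} {0ℝ * 0ℝ} {0ℝ}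
        (*ℝ-cong {∣ z ∣} {0ℝ} {∣ z ∣} {0ℝ} ∣z∣≈0 ∣z∣≈0) (pointwise-≈ {0ℝ * 0ℝ} {0ℝ} λ _ → refl)))
      where
      ∣z∣≈0 : ∣ z ∣ ≈ 0ℝ
      ∣z∣≈0 = ≤-antisym {∣ z ∣} {0ℝ} ∣z∣≤0 0≤∣ z ∣
    zero-part : ∀ x → (∀ n → seq (x ²) n ℚ.≤ seq (norm z) n) → x ≈ 0ℝ
    zero-part x x²≤ = ≤-antisym {x} {0ℝ} (below x x²≤)
      (subst-neg (below (- x) λ n → subst (ℚ._≤ seq (norm z) n) (neg² (seq x n)) (x²≤ n)))
      where
      neg² : ∀ p → p ℚ.* p ≡ (ℚ.- p) ℚ.* (ℚ.- p)
      neg² p = trans (sym (⁻¹-involutive (p ℚ.* p))) (trans (cong ℚ.-_ (ℚₚ.neg-distribˡ-* p p)) (ℚₚ.neg-distribʳ-* (ℚ.- p) p))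
        where open import Algebra.Properties.Group ℚₚ.+-0-group using (⁻¹-involutive)
      below : ∀ x → (∀ n → seq (x ²) n ℚ.≤ seq (norm z) n) → x ≤ 0ℝ
      below x x²≤ = square-cancel-≤ {x} {0ℝ} (≤-reflexive {0ℝ} {0ℝ} (≈-refl {0ℝ}))
        (≤-trans {x ²} {norm z} {0ℝ ²} (pointwise-≤ {x ²} {norm z} x²≤) (≤-trans {norm z} {0ℝ} {0ℝ ²} norm≤0 (0≤x²ℝ 0ℝ)))
      subst-neg : (- x) ≤ 0ℝ → 0ℝ ≤ x
      subst-neg h = ≤-trans {0ℝ} { - (- x)} {x} (neg-antimono-≤ { - x} {0ℝ} h)
        (pointwise-≤ { - (- x)} {x} λ n → ℚₚ.≤-reflexive (⁻¹-involutive (seq x n)))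
        where open import Algebra.Properties.Group ℚₚ.+-0-group using (⁻¹-involutive)

opaque
  unfolding _/_

  /-+-ℤ : ∀ i j n .{{_ : NonZero n}} → (i ℤ.+ j) / n ≡ i / n ℚ.+ j / n
  /-+-ℤ i j n@(suc n-1) = sym (ℚₚ.toℚᵘ-injective (begin
    ℚ.toℚᵘ (i / n ℚ.+ j / n)                  ≈⟨ ℚₚ.toℚᵘ-homo-+ (i / n) (j / n) ⟩
    ℚ.toℚᵘ (i / n) ℚᵘ.+ ℚ.toℚᵘ (j / n) ≈⟨ ℚᵘₚ.+-cong (ℚₚ.toℚᵘ-fromℚᵘ (mkℚᵘ i n-1)) (ℚₚ.toℚᵘ-fromℚᵘ (mkℚᵘ j n-1)) ⟩
    mkℚᵘ i n-1 ℚᵘ.+ mkℚᵘ j n-1 ≈⟨ ℚᵘ.*≡* (trans (cong (ℤ._* + n) (sym (ℤₚ.*-distribʳ-+ (+ n) i j))) (trans (ℤₚ.*-assoc (i ℤ.+ j) (+ n) (+ n))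
                                                 (cong ((i ℤ.+ j) ℤ.*_) (sym (ℤₚ.pos-* n n))))) ⟩
    mkℚᵘ (i ℤ.+ j) n-1                        ≈⟨ ℚₚ.toℚᵘ-fromℚᵘ (mkℚᵘ (i ℤ.+ j) n-1) ⟨
    ℚ.toℚᵘ ((i ℤ.+ j) / n)                    ∎))
    where open ℚᵘₚ.≃-Reasoning

/-neg-ℤ : ∀ i n .{{_ : NonZero n}} → (ℤ.- i) / n ≡ ℚ.- (i / n)
/-neg-ℤ i n = inverseʳ-unique (i / n) ((ℤ.- i) / n) (trans (sym (/-+-ℤ i (ℤ.- i) n)) (trans (cong (λ m → m / n) (ℤₚ.+-inverseʳ i)) (0/n≡0 n)))
  where open import Algebra.Properties.Group ℚₚ.+-0-group using (inverseʳ-unique)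

module _ (r : ℕ) .{{_ : NonZero r}} where

  χ : ℤ → ℂ
  χ j = 𝐞 (j / r)

  χ-+ : ∀ i j → χ (i ℤ.+ j) ≈ᶜ χ i *ᶜ χ j
  χ-+ i j = subst (λ q → 𝐞 q ≈ᶜ χ i *ᶜ χ j) (sym (/-+-ℤ i j r)) (𝐞-+ (i / r) (j / r))

  χ-0 : χ (+ 0) ≈ᶜ 1ᶜ
  χ-0 = subst (λ q → 𝐞 q ≈ᶜ 1ᶜ) (sym (0/n≡0 r)) 𝐞-0

  χ-r : χ (+ r) ≈ᶜ 1ᶜ
  χ-r = subst (λ q → 𝐞 q ≈ᶜ 1ᶜ) (sym (n/n≡1 r)) 𝐞-1

  χ-conj : ∀ j → conj (χ j) ≈ᶜ χ (ℤ.- j)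
  χ-conj j = subst (λ q → conj (χ j) ≈ᶜ 𝐞 q) (sym (/-neg-ℤ j r)) (𝐞-conj (j / r))

  ¼≤ : ∀ j → r ℕ.≤ 4 ℕ.* j → ¼ ℚ.≤ + j / r
  ¼≤ j r≤4j = /-mono-≤ 1 4 j r (ℕₚ.≤-trans (ℕₚ.≤-reflexive (ℕₚ.*-identityˡ r)) (ℕₚ.≤-trans r≤4j (ℕₚ.≤-reflexive (ℕₚ.*-comm 4 j))))

  ≤½ : ∀ j → 2 ℕ.* j ℕ.≤ r → + j / r ℚ.≤ ½
  ≤½ j 2j≤r = subst (+ j / r ℚ.≤_) 1/2≡½ (/-mono-≤ j r 1 2 (ℕₚ.≤-trans (ℕₚ.≤-reflexive (ℕₚ.*-comm j 2)) (ℕₚ.≤-trans 2j≤r (ℕₚ.≤-reflexive (sym (ℕₚ.*-identityˡ r))))))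

  re-χ≤½ : ∀ j → r ℕ.≤ 4 ℕ.* j → 2 ℕ.* j ℕ.≤ r → re (χ (+ j)) ≤ fromℚ ½
  re-χ≤½ j r≤4j 2j≤r = re-𝐞≤½ {+ j / r} (¼≤ j r≤4j) (≤½ j 2j≤r)

module _
  (I r₁ r₂ : ℕ) .{{_ : NonZero r₁}} (b : ℤ → ℂ) (b₁ b₂ : Fin I → ℤ → ℂ) (R₁ R₂ : ℝ)
  (b≈ : ∀ m → b m ≈ᶜ (∑ℂ[ i ∈ allFin I ] b₁ i m *ᶜ b₂ i m))
  (b₁-periodic : ∀ m i → b₁ i (m ℤ.+ + r₁) ≈ᶜ b₁ i m) (b₁≤R₁ : ∀ m i → ∣ b₁ i m ∣ ≤ R₁)
  (b₂-periodic : ∀ m i → b₂ i (m ℤ.+ + r₂) ≈ᶜ b₂ i m) (b₂≤R₂ : ∀ m i → ∣ b₂ i m ∣ ≤ R₂)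
  (H : ℕ) (A : ℤ) (M : ℕ) .{{s≢0 : NonZero (H ℕ.* r₂)}}
  where

  private
    module Ineq = Differencing.Inequality complexNumbers {r₁} {χ r₁} (χ-+ r₁) (χ-0 r₁) (χ-r r₁) (χ-conj r₁) (re-χ≤½ r₁)
      (allFin I) {r₂} b b₁ b₂ R₁ R₂ {λ i m → b₁ i m *ᶜ b₂ i m} b≈ (λ i m → Rℂ.refl {b₁ i m *ᶜ b₂ i m})
      (λ i m → b₁-periodic m i) (λ i m → b₁≤R₁ m i) (λ i m → b₂-periodic m i) (λ i m → b₂≤R₂ m i) H A M

  bound : ∣ ∑ℂ[ m ∈ interval A M ] b m ∣ ² ≤ fromℕ 2 * (fromℕ ((M ℕ.+ H ℕ.* r₂) ℕ.* (H ℕ.* r₂)) * (R₁ * R₂) ² * fromℕ I ²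
          + fromℕ (H ℕ.* r₂) * R₂ ² * fromℕ I * (∑ℝ[ h ∈ 0<∣h∣≤ (M ℕ./ (H ℕ.* r₂)) ] ∑ℝ[ k ∈ ∣k∣≤ (r₁ ℕ./ 2) ] ∣ ∑ℂ[ i ∈ allFin I ] B̂ r₁ (H ℕ.* r₂) (b₁ i) h k ∣ * fromℚ (weight M r₁ k)))
  bound =
    -- Each layer of the nested sums gets a name and is passed explicitly, so that it is compared by
    -- reflexivity and never inferred by unfolding real arithmetic.
    let S′ : ℂ
        S′ = ∑ℂ[ m ∈ interval A M ] b m
        Z″ : ℝ
        Z″ = ∑ℝ[ h ∈ 0<∣h∣≤ (M ℕ./ (H ℕ.* r₂)) ] ∑ℝ[ k ∈ ∣k∣≤ (r₁ ℕ./ 2) ] ∣ ∑ℂ[ i ∈ allFin I ] B̂ r₁ (H ℕ.* r₂) (b₁ i) h k ∣ * fromℚ (weight M r₁ k)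
        Z′ : ℤ → ℝ
        Z′ = λ h → ∑ℝ[ k ∈ ∣k∣≤ (r₁ ℕ./ 2) ] ∣ ∑ℂ[ i ∈ allFin I ] B̂ r₁ (H ℕ.* r₂) (b₁ i) h k ∣ * fromℚ (weight M r₁ k)
        t : ℤ → ℤ → ℝ
        t = λ h k → ∣ ∑ℂ[ i ∈ allFin I ] B̂ r₁ (H ℕ.* r₂) (b₁ i) h k ∣ * fromℚ (weight M r₁ k)
        v : ℤ → ℤ → ℂ
        v = λ h k → ∑ℂ[ i ∈ allFin I ] B̂ r₁ (H ℕ.* r₂) (b₁ i) h k
        B̂′ : Fin I → ℤ → ℤ → ℂ
        B̂′ = λ i → B̂ r₁ (H ℕ.* r₂) (b₁ i)
        w : Fin I → ℤ → ℤ → ℕ → ℂ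
        w = λ i h k m → b₁ i (+ m ℤ.+ h ℤ.* + (H ℕ.* r₂)) *ᶜ conj (b₁ i (+ m)) *ᶜ e (fromℚ ((ℤ.- (k ℤ.* + m)) / r₁))
    in Ineq.inequality-≈ {S′} {Z″} {I} {Z′} {t} {v} {B̂′} {w}
      (Listₚ.length-tabulate {n = I} (λ i → i)) (Rℂ.refl {S′}) (≈-refl {Z″})
      (λ h → ≈-refl {Z′ h}) (λ h k → ≈-refl {t h k}) (λ h k → Rℂ.refl {v h k})
      (λ i h k → Rℂ.refl {B̂′ i h k}) (λ i h k m → Rℂ.refl {w i h k m})

theorem10 : ∃[ C ]
    ((I r r₁ r₂ : ℕ) .{{_ : NonZero I}} .{{_ : NonZero r}} .{{_ : NonZero r₁}} .{{_ : NonZero r₂}} →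
    r ≡ r₁ ℕ.* r₂ →
    (b : ℤ → ℂ) (b₁ b₂ : Fin I → ℤ → ℂ) (R₁ R₂ : ℝ) →
    (∀ m → b m ≈ᶜ (∑ℂ[ i ∈ allFin I ] b₁ i m *ᶜ b₂ i m)) →
    (∀ m i → b₁ i (m ℤ.+ + r₁) ≈ᶜ b₁ i m) →
    (∀ m i → ∣ b₁ i m ∣ ≤ R₁) →
    (∀ m i → b₂ i (m ℤ.+ + r₂) ≈ᶜ b₂ i m) →
    (∀ m i → ∣ b₂ i m ∣ ≤ R₂) →
    (H : ℕ) .{{_ : NonZero H}} (A : ℤ) (M : ℕ) .{{_ : NonZero M}} →
    ∣ ∑ℂ[ m ∈ interval A M ] b m ∣ ²
    ≤ C * (fromℕ ((M ℕ.+ H ℕ.* r₂) ℕ.* (H ℕ.* r₂)) * (R₁ * R₂) ² * fromℕ I ²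
    + fromℕ (H ℕ.* r₂) * R₂ ² * fromℕ I *
    (∑ℝ[ h ∈ 0<∣h∣≤ (M ℕ./ (H ℕ.* r₂)) {{m*n≢0 H r₂}} ]
    ∑ℝ[ k ∈ ∣k∣≤ (r₁ ℕ./ 2) ]
    ∣ ∑ℂ[ i ∈ allFin I ] B̂ r₁ (H ℕ.* r₂) (b₁ i) h k ∣ * fromℚ (weight M r₁ k))))
theorem10 = fromℕ 2 , λ I r r₁ r₂ _ b b₁ b₂ R₁ R₂ b≈ b₁-periodic b₁≤R₁ b₂-periodic b₂≤R₂ H A M →
  bound I r₁ r₂ b b₁ b₂ R₁ R₂ b≈ b₁-periodic b₁≤R₁ b₂-periodic b₂≤R₂ H A M {{m*n≢0 H r₂}}
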